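{- Let $k\geq2$ be an integer and $C_0\geq1$. There are constants $K_0=K_0(k,C_0)$ and $C=C(k)$ such that the following holds. Let $N\geq1$, let $H$ be a positive integer, set $B=N/H$, assume $B\geq1$, let $L\geq2$ and $0<\eta<1$, and suppose that $\nu\colon[N]\to\mathbb R_{\geq0}$ satisfies the $(K,L,\eta)$ linear forms condition at scale $(N,B,H)$ with $K\geq K_0$. Set $$\eta_*=\eta+L^{ -1}+H^{ -1},\qquad c=2^{ -2(k-1)}.$$ Let $\mu\colon\mathbb Z^{k-1}\to\mathbb C$ be $1$-bounded and supported on $([-C_0B,C_0B]\cap\mathbb Z)^{k-1}$. Let $S\subseteq\{2,\ldots,k\}$, and let $g_2,\ldots,g_k\colon\mathbb Z\to\mathbb C$ be supported on $[N]$ with $|g_i|\leq\nu$ for $i\in S$ and $|g_i|\leq1_{[N]}$ for $i\notin S$. Set $D=\mathcal D_\mu(g_2,\ldots,g_k)$, let $C_{\mathrm{sup}}\geq C_0$, set $K_{\mathrm{bd}}=(2C_{\mathrm{sup}}+1)^{k-1}$, and let $$D^\sharp(x)=1_{[N]}(x)\operatorname{clip}_{K_{\mathrm{bd}}}(D(x)).$$ Then $$\Bigl|\mathbb E_{x\in[N]}(\nu(x)-1)|D(x)|^2\Bigr|\ll_{k,C_0}\eta_*^c+R_\nu^C/B$$ and $$\mathbb E_{x\in[N]}|D(x)-D^\sharp(x)|^2\ll_{k,C_0}\eta_*^c+R_\nu^C/B.$$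
   Context: For a real number $X\geq1$, $[X]=\{1,\ldots,\lfloor X\rfloor\}$; $\mathbb E_{n\in S}$ is the average over a finite nonempty set. A function is $1$-bounded if its values have modulus at most $1$. Functions on $[N]$ are extended by zero to $\mathbb Z$. $X\ll_{k,C_0}Y$ means $X\leq C'Y$ with $C'$ depending only on $k,C_0$. $R_\nu=\max(1,\|\nu\|_{\ell^\infty([N])})$. For $R\geq1$ and $z\in\mathbb C$, $\operatorname{clip}_R(z)=z$ if $|z|\leq R$ and $\operatorname{clip}_R(z)=Rz/|z|$ if $|z|>R$. Normalised dual function: with $M=B^{k-2}N=B^{k-1}H$, $$\mathcal D_\mu(g_2,\ldots,g_k)(x)=\frac1M\sum_{\mathbf b=(b_2,\ldots,b_k)\in\mathbb Z^{k-1}}\mu(\mathbf b)\sum_{m\in[H]}\prod_{i=2}^kg_i(x+b_im).$$ Linear forms condition: let $N,B\geq1$, $H$ a positive integer, $K,L\geq2$, $0<\eta<1$. The function $\nu\colon[N]\to\mathbb R_{\geq0}$ satisfies the $(K,L,\eta)$ linear forms condition at scale $(N,B,H)$ if the following holds. Let $0\leq s\leq K$ and $1\leq J\leq K$ be integers, and let $I\subseteq[N]$ and $I_1,\ldots,I_s\subseteq[H]$ be intervals with $|I|\geq N/L$ and $|I_t|\geq H/L$ for $1\leq t\leq s$. For $1\leq j\leq J$ let $\Psi_j(x,\mathbf h)=x+a_j+\sum_{t=1}^sc_{j,t}h_t$ with integers $a_j,c_{j,t}$ satisfying $|a_j|\leq KN$, $|c_{j,t}|\leq KB$, and suppose the vectors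 $(c_{j,1},\ldots,c_{j,s})$, $1\leq j\leq J$, are pairwise distinct. Then for every $W_1,\ldots,W_J\in\{\nu,1_{[N]}\}$, $$\Bigl|\mathbb E_{x\in I}\mathbb E_{h_1\in I_1,\ldots,h_s\in I_s}\prod_{j=1}^JW_j(\Psi_j(x,\mathbf h))-\mathbb E_{x\in I}\mathbb E_{h_1\in I_1,\ldots,h_s\in I_s}\prod_{j=1}^J1_{[N]}(\Psi_j(x,\mathbf h))\Bigr|\leq\eta.$$ When $s=0$ the averages over the $h_t$ are omitted. -}

module Defs where

open import Algebra.Bundles using (CommutativeRing; RawMonoid; RawSemiring; Semiring)
open import Algebra.Core using (Op₁; Op₂)
open import Algebra.Structures using (IsCommutativeRing)
open import Data.Bool.Base using (if_then_else_)
open import Data.Fin.Base using (Fin)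
open import Data.Integer.Base as ℤ using (ℤ; +_)
import Data.Integer.Properties as ℤ
open import Data.List.Base as List using (List; []; _∷_; upTo; length; allFin; cartesianProductWith)
open import Data.Nat.Base as ℕ using (ℕ; zero; suc; NonZero; _∸_)
open import Data.Product.Base using (∃; _×_; _,_; proj₁)
open import Data.Sum.Base using (_⊎_; inj₁; inj₂)
open import Data.Vec.Base as Vec using (Vec; []; _∷_)
open import Data.Vec.Relation.Unary.All using (All)
open import Level using (0ℓ)
open import Relation.Binary.Bundles using (DecTotalOrder)
open import Relation.Binary.Core using (Rel)
open import Relation.Binary.PropositionalEquality.Core using (_≡_; _≢_; refl; sym; trans; cong; cong₂; subst; subst₂)
open import Relation.Binary.Structures using (IsDecTotalOrder)
open import Relation.Nullary using (¬_; Dec; yes; no; does)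
open import Relation.Nullary.Decidable using (_×-dec_)
import Algebra.Construct.NaturalChoice.Max
import Algebra.Definitions.RawMonoid
import Algebra.Definitions.RawSemiring
import Algebra.Properties.Ring
import Relation.Binary.Properties.DecTotalOrder

-- The real numbers, as a Dedekind-complete ordered field; classically these
-- axioms determine ℝ up to unique isomorphism.  The order is decidable and the
-- Archimedean property comes with a witness, as in classical mathematics, where
-- both follow from the remaining axioms.  The value of 0# ⁻¹ is unspecified.
record Reals : Set₁ where
  infix  8 _⁻¹
  infix  8 -_
  infixl 7 _*_
  infixl 6 _+_
  infix  4 _≤_
  field
    ℝ                 : Set
    _+_ _*_           : Op₂ ℝ
    -_ _⁻¹            : Op₁ ℝ
    0# 1#             : ℝ
    _≤_               : Rel ℝ 0ℓ
    isCommutativeRing : IsCommutativeRing _≡_ _+_ _*_ -_ 0# 1#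
    0≢1               : 0# ≢ 1#
    ⁻¹-inverseʳ       : ∀ x → x ≢ 0# → x * x ⁻¹ ≡ 1#
    isDecTotalOrder   : IsDecTotalOrder _≡_ _≤_
    +-monoʳ-≤         : ∀ z {x y} → x ≤ y → z + x ≤ z + y
    *-nonNegative     : ∀ {x y} → 0# ≤ x → 0# ≤ y → 0# ≤ x * y

  commutativeRing : CommutativeRing 0ℓ 0ℓ
  commutativeRing = record { isCommutativeRing = isCommutativeRing }

  open CommutativeRing commutativeRing public
    using (_-_; semiring; ring)

  open Semiring semiring public
    using (rawSemiring)

  open RawSemiring rawSemiring public
    using (+-rawMonoid; *-rawMonoid)

  open Algebra.Definitions.RawSemiring rawSemiring public
    using (_^_)

  fromℕ : ℕ → ℝ
  fromℕ n = Algebra.Definitions.RawMonoid._×_ +-rawMonoid n 1#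

  UpperBound : (ℝ → Set) → ℝ → Set
  UpperBound P u = ∀ x → P x → x ≤ u

  LeastUpperBound : (ℝ → Set) → ℝ → Set
  LeastUpperBound P s = UpperBound P s × (∀ u → UpperBound P u → s ≤ u)

  field
    archimedean  : ∀ x → ∃ λ n → x ≤ fromℕ n
    completeness : (P : ℝ → Set) → ∃ P → ∃ (UpperBound P) → ∃ (LeastUpperBound P)

-- The set {offset + 1, …, offset + size}, contained in {1, …, n}.
record Interval (n : ℕ) : Set where
  field
    offset size : ℕ
    bounded     : offset ℕ.+ size ℕ.≤ n

run : ℕ → ℕ → List ℤ
run offset size = List.map (λ i → + (offset ℕ.+ suc i)) (upTo size)

elements : ∀ {n} → Interval n → List ℤ
elements I = run (Interval.offset I) (Interval.size I)

[-_,_] : ℕ → ℕ → List ℤ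
[- r , s ] = List.map (λ i → + i ℤ.- + r) (upTo (suc (r ℕ.+ s)))

tuples : ∀ {A : Set} {n} → Vec (List A) n → List (Vec A n)
tuples []         = [] ∷ []
tuples (xs ∷ xss) = cartesianProductWith _∷_ xs (tuples xss)

dot : ∀ {n} → Vec ℤ n → Vec ℤ n → ℤ
dot c h = Vec.foldr _ ℤ._+_ (+ 0) (Vec.zipWith ℤ._*_ c h)

bigOp : ∀ (M : RawMonoid 0ℓ 0ℓ) {A : Set} → List A → (A → RawMonoid.Carrier M) → RawMonoid.Carrier M
bigOp M xs f = List.foldr (λ x acc → f x ∙ acc) ε xs
  where open RawMonoid M

SupportedOn : {A B : Set} → B → (A → Set) → (A → B) → Set
SupportedOn z P f = ∀ x → ¬ P x → f x ≡ z

module Analysis (𝓡 : Reals) where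

  open Reals 𝓡 public

  decTotalOrder : DecTotalOrder 0ℓ 0ℓ 0ℓ
  decTotalOrder = record { isDecTotalOrder = isDecTotalOrder }

  private
    module R = CommutativeRing commutativeRing
    module O = DecTotalOrder decTotalOrder

  open Relation.Binary.Properties.DecTotalOrder decTotalOrder public
    using (_<_)

  open Algebra.Construct.NaturalChoice.Max O.totalOrder public
    using (_⊔_)

  infixl 7 _/_
  _/_ : Op₂ ℝ
  x / y = x * y ⁻¹

  ∣_∣ : ℝ → ℝ
  ∣ x ∣ = x ⊔ (- x)

  private
    module Max = Algebra.Construct.NaturalChoice.Max O.totalOrder

  0≤1 : 0# ≤ 1#
  0≤1 with O.total 0# 1#
  ... | inj₁ p = p
  ... | inj₂ 1≤0 = subst (0# ≤_) -1*-1≡1 (*-nonNegative 0≤-1 0≤-1)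
    where
    open Algebra.Properties.Ring ring
    -1*-1≡1 : (- 1#) * (- 1#) ≡ 1#
    -1*-1≡1 = trans (-1*x≈-x (- 1#)) (-‿involutive 1#)
    0≤-1 : 0# ≤ - 1#
    0≤-1 = subst₂ _≤_ (R.-‿inverseˡ 1#) (R.+-identityʳ (- 1#)) (+-monoʳ-≤ (- 1#) 1≤0)

  *-monoʳ-≤ : ∀ {x y z} → 0# ≤ z → x ≤ y → z * x ≤ z * y
  *-monoʳ-≤ {x} {y} {z} 0≤z x≤y =
    subst₂ _≤_ (R.+-identityʳ _) eq (+-monoʳ-≤ (z * x) (*-nonNegative 0≤z 0≤y-x))
    where
    0≤y-x : 0# ≤ - x + y
    0≤y-x = subst (_≤ (- x + y)) (R.-‿inverseˡ x) (+-monoʳ-≤ (- x) x≤y)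
    eq : z * x + z * (- x + y) ≡ z * y
    eq = trans (sym (R.distribˡ z x (- x + y))) (cong (z *_)
           (trans (sym (R.+-assoc x (- x) y))
             (trans (cong (_+ y) (R.-‿inverseʳ x)) (R.+-identityˡ y))))

  1≤^ : ∀ {t} n → 1# ≤ t → 1# ≤ t ^ n
  1≤^ zero    1≤t = O.refl
  1≤^ {t} (suc n) 1≤t = O.trans 1≤t
    (subst (_≤ t * t ^ n) (R.*-identityʳ t) (*-monoʳ-≤ (O.trans 0≤1 1≤t) (1≤^ n 1≤t)))

  RootSet : ℕ → ℝ → ℝ → Set
  RootSet q y t = 0# ≤ t × t ^ q ≤ y ⊔ 0#

  rootSet-sup : ∀ q .{{_ : NonZero q}} y → ∃ (LeastUpperBound (RootSet q y))
  rootSet-sup (suc q) y = completeness _ (0# , O.refl , 0^q≤) (1# + y⁺ , bound)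
    where
    y⁺ : ℝ
    y⁺ = y ⊔ 0#
    0≤y⁺ : 0# ≤ y⁺
    0≤y⁺ = Max.x≤y⊔x y 0#
    0^q≤ : 0# ^ suc q ≤ y⁺
    0^q≤ = subst (_≤ y⁺) (sym (R.zeroˡ (0# ^ q))) 0≤y⁺
    bound : UpperBound (RootSet (suc q) y) (1# + y⁺)
    bound t (0≤t , tq≤y) with O.total t 1#
    ... | inj₁ t≤1 = O.trans t≤1 (subst (_≤ 1# + y⁺) (R.+-identityʳ 1#) (+-monoʳ-≤ 1# 0≤y⁺))
    ... | inj₂ 1≤t = O.trans t≤t^ (O.trans tq≤y y⁺≤)
      where
      t≤t^ : t ≤ t * t ^ q
      t≤t^ = subst (_≤ t * t ^ q) (R.*-identityʳ t) (*-monoʳ-≤ 0≤t (1≤^ q 1≤t))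
      y⁺≤ : y⁺ ≤ 1# + y⁺
      y⁺≤ = subst₂ _≤_ (R.+-identityʳ y⁺) (R.+-comm y⁺ 1#) (+-monoʳ-≤ y⁺ 0≤1)

  -- y ^1/ q is sup {t ≥ 0 ∣ t^q ≤ y}, the nonnegative q-th root of y ≥ 0
  -- (and 0# for y < 0#).
  infixr 8 _^1/_
  _^1/_ : ℝ → (q : ℕ) → .{{NonZero q}} → ℝ
  y ^1/ q = proj₁ (rootSet-sup q y)

  √_ : ℝ → ℝ
  √ y = y ^1/ 2

  floorUpTo : ℝ → ℕ → ℕ
  floorUpTo x zero    = zero
  floorUpTo x (suc n) = if does (fromℕ (suc n) O.≤? x) then suc n else floorUpTo x n

  -- The largest natural number n with fromℕ n ≤ x (for x ≥ 0), found by
  -- searching downwards from an Archimedean bound for x.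
  ⌊_⌋ : ℝ → ℕ
  ⌊ x ⌋ = floorUpTo x (proj₁ (archimedean x))

  _∈[_] : ℤ → ℝ → Set
  x ∈[ X ] = + 1 ℤ.≤ x × x ℤ.≤ + ⌊ X ⌋

  _∈[_]? : ∀ x X → Dec (x ∈[ X ])
  x ∈[ X ]? = (+ 1 ℤ.≤? x) ×-dec (x ℤ.≤? + ⌊ X ⌋)

  [1⋯_] : ℝ → List ℤ
  [1⋯ X ] = run 0 ⌊ X ⌋

  𝟙[_] : ℝ → ℤ → ℝ
  𝟙[ N ] x = if does (x ∈[ N ]?) then 1# else 0#

  ∑ ∏ : {A : Set} → List A → (A → ℝ) → ℝ
  ∑ = bigOp +-rawMonoid
  ∏ = bigOp *-rawMonoid

  𝔼 : {A : Set} → List A → (A → ℝ) → ℝ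
  𝔼 xs f = ∑ xs f / fromℕ (length xs)

  -- max (1, ‖ν‖_∞), the norm being taken over {1, …, ⌊N⌋}.
  Rsup : ℝ → (ℤ → ℝ) → ℝ
  Rsup N ν = 1# ⊔ List.foldr (λ x acc → ∣ ν x ∣ ⊔ acc) 0# [1⋯ N ]

  record ℂ : Set where
    constructor _+i_
    field
      re im : ℝ
  open ℂ public

  0ℂ 1ℂ : ℂ
  0ℂ = 0# +i 0#
  1ℂ = 1# +i 0#

  infixl 7 _*ℂ_ _•_
  infixl 6 _+ℂ_ _-ℂ_
  _+ℂ_ _-ℂ_ _*ℂ_ : Op₂ ℂ
  z +ℂ w = (re z + re w) +i (im z + im w)
  z -ℂ w = (re z - re w) +i (im z - im w)
  z *ℂ w = (re z * re w - im z * im w) +i (re z * im w + im z * re w)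

  _•_ : ℝ → ℂ → ℂ
  r • z = (r * re z) +i (r * im z)

  ∣_∣ℂ : ℂ → ℝ
  ∣ z ∣ℂ = √ (re z * re z + im z * im z)

  clip : ℝ → ℂ → ℂ
  clip R z = if does (∣ z ∣ℂ O.≤? R) then z else (R / ∣ z ∣ℂ) • z

  ∑ℂ ∏ℂ : {A : Set} → List A → (A → ℂ) → ℂ
  ∑ℂ = bigOp (record { Carrier = ℂ ; _≈_ = _≡_ ; _∙_ = _+ℂ_ ; ε = 0ℂ })
  ∏ℂ = bigOp (record { Carrier = ℂ ; _≈_ = _≡_ ; _∙_ = _*ℂ_ ; ε = 1ℂ })

  Box : ℝ → ∀ {n} → Vec ℤ n → Set
  Box r = All (λ z → fromℕ ℤ.∣ z ∣ ≤ r)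

  -- The sum over all of ℤⁿ of a function supported on the box of radius r;
  -- it does not depend on the choice of r.
  ∑ℤ^ : ∀ n (r : ℝ) (f : Vec ℤ n → ℂ) → SupportedOn 0ℂ (Box r) f → ℂ
  ∑ℤ^ n r f _ = ∑ℂ (tuples (Vec.replicate n [- ⌊ r ⌋ , ⌊ r ⌋ ])) f

  *ℂ-supported : ∀ {n} r (f g : Vec ℤ n → ℂ) →
                 SupportedOn 0ℂ (Box r) f → SupportedOn 0ℂ (Box r) (λ b → f b *ℂ g b)
  *ℂ-supported r f g supp b b∉ = trans (cong (λ z → z *ℂ g b) (supp b b∉)) (zeroˡ (g b))
    where
    zeroˡ : ∀ w → 0ℂ *ℂ w ≡ 0ℂ
    zeroˡ w = cong₂ _+i_
      (trans (cong₂ _-_ (R.zeroˡ (re w)) (R.zeroˡ (im w))) (R.-‿inverseʳ 0#))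
      (trans (cong₂ _+_ (R.zeroˡ (im w)) (R.zeroˡ (re w))) (R.+-identityʳ 0#))

  -- The dual function 𝒟_μ(g₂, …, g_k).  Here and below an index i : Fin (k ∸ 1)
  -- stands for the index i + 2 of {2, …, k}.
  dual : ∀ (k : ℕ) (N B : ℝ) (H : ℕ) (r : ℝ) (μ : Vec ℤ (k ∸ 1) → ℂ) → SupportedOn 0ℂ (Box r) μ →
         (Fin (k ∸ 1) → ℤ → ℂ) → ℤ → ℂ
  dual k N B H r μ supp g x = (1# / M) • ∑ℤ^ (k ∸ 1) r (λ b → μ b *ℂ inner b) (*ℂ-supported r μ inner supp)
    where
    M : ℝ
    M = B ^ (k ∸ 2) * N
    inner : Vec ℤ (k ∸ 1) → ℂ
    inner b = ∑ℂ (run 0 H) λ m → ∏ℂ (allFin (k ∸ 1)) λ i → g i (x ℤ.+ Vec.lookup b i ℤ.* m)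

  -- The h-average runs over I₁ × ⋯ × I_s; for s = 0 this is a single point.
  LinearFormsCondition : (ν : ℤ → ℝ) (K L η N B : ℝ) (H : ℕ) → Set
  LinearFormsCondition ν K L η N B H =
    ∀ (s J : ℕ) → fromℕ s ≤ K → 1 ℕ.≤ J → fromℕ J ≤ K →
    ∀ (I : Interval ⌊ N ⌋) (Is : Vec (Interval H) s) →
    N / L ≤ fromℕ (Interval.size I) →
    (∀ t → fromℕ H / L ≤ fromℕ (Interval.size (Vec.lookup Is t))) →
    ∀ (a : Fin J → ℤ) (c : Fin J → Vec ℤ s) →
    (∀ j → fromℕ ℤ.∣ a j ∣ ≤ K * N) →
    (∀ j t → fromℕ ℤ.∣ Vec.lookup (c j) t ∣ ≤ K * B) →
    (∀ i j → i ≢ j → c i ≢ c j) →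
    let Ψ : Fin J → ℤ → Vec ℤ s → ℤ
        Ψ j x h = x ℤ.+ a j ℤ.+ dot (c j) h
        average : (Fin J → ℤ → ℝ) → ℝ
        average W = 𝔼 (elements I) λ x → 𝔼 (tuples (Vec.map elements Is)) λ h →
                    ∏ (allFin J) λ j → W j (Ψ j x h)
    in ∀ (W : Fin J → ℤ → ℝ) → (∀ j → W j ≡ ν ⊎ W j ≡ 𝟙[ N ]) →
       ∣ average W - average (λ _ → 𝟙[ N ]) ∣ ≤ η

{-# OPTIONS --safe #-}
-- Write w = ν − 1_[N] and expand |D|² over pairs (b, b′).  The pairs in which some b_i
-- vanishes or two of them coincide form a proportion O(1/B) of all pairs and are bounded
-- by a power of R_ν.  For any other pair average over the substitutions
--   m ↦ m + Σ t_i,  m′ ↦ m′ + Σ t′_i,  x ↦ x − b · t − b′ · t′,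
-- with all t_i and t′_i in {1, …, T} and T ≈ H/L: then the factor g_i(x + b_i m) no longer
-- depends on t_i, and the change in the range of m costs only T/H ≤ 1/L + 1/H.  Now 2(k − 1)
-- applications of the Cauchy–Schwarz inequality, each weighted by a majorant ν or 1_[N],
-- remove every g_i and leave averages of products of w and ν along forms with distinct
-- coefficient vectors, which the linear forms condition evaluates.
--
-- For the second estimate, |D| is at most the same expression with each g_i replaced by its
-- majorant, while the expression with each g_i replaced by 1_[N] is at most K_bd.  So
-- |D − D♯| is at most the difference of these two expressions, whose second moment is given
-- by the linear forms condition directly.
module Submission where

open import Defs
open import Algebra.Bundles using (CommutativeRing; RawMonoid)
import Algebra.Construct.NaturalChoice.Max
import Algebra.Definitions.RawMonoid
import Algebra.Properties.AbelianGroup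
import Algebra.Properties.CommutativeSemiring.Exp
import Algebra.Properties.Monoid.Mult
import Algebra.Properties.Monoid.Mult.TCOptimised
import Algebra.Properties.Ring
import Algebra.Properties.Semiring.Mult
import Algebra.Solver.Ring
open import Algebra.Solver.Ring.AlmostCommutativeRing using (fromCommutativeRing; _-Raw-AlmostCommutative⟶_)
open import Data.Bool.Base using (Bool; true; false; if_then_else_)
open import Data.Empty using (⊥-elim)
open import Data.Fin.Base as Fin using (Fin; zero; suc)
import Data.Fin.Properties as Fin
open import Data.Integer.Base as ℤ using (ℤ; +_; -[1+_]; +[1+_])
import Data.Integer.Properties as ℤ
import Data.Integer.Solver
open import Data.List.Base as List using (List; []; _∷_; upTo; applyUpTo; length; allFin; tabulate; cartesianProductWith; _++_)
open import Data.List.Membership.Propositional.Properties using (∈-lookup; ∈-upTo⁻; ∈-upTo⁺; ∈-map⁻; ∈-map⁺; ∈-cartesianProductWith⁻)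
open import Data.List.Properties as List using (length-map; length-upTo; length-++)
open import Data.List.Relation.Unary.All as All using (All; []; _∷_)
import Data.List.Relation.Unary.All.Properties as All
open import Data.List.Relation.Unary.AllPairs as AllPairs using (AllPairs; []; _∷_)
import Data.List.Relation.Unary.AllPairs.Properties as AllPairs
open import Data.List.Relation.Unary.Any using (here; there)
open import Data.List.Relation.Unary.Unique.Propositional using (Unique)
import Data.List.Relation.Unary.Unique.Propositional.Properties as Unique
open import Data.Maybe.Base using (Maybe; just; nothing)
open import Data.Nat.Base as ℕ using (ℕ; zero; suc; NonZero; _∸_)
import Data.Nat.Properties as ℕ
open import Data.Product.Base using (Σ; ∃; _×_; _,_; proj₁; proj₂; map₂)
open import Data.Sum.Base using (_⊎_; inj₁; inj₂; [_,_]′)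
open import Data.Unit.Base using (⊤; tt)
open import Data.Vec.Base as Vec using (Vec; []; _∷_; lookup; replicate)
import Data.Vec.Properties as Vec
open import Data.Vec.Relation.Unary.All as VecAll using ([]; _∷_)
import Data.Vec.Relation.Unary.All.Properties as VecAll
open import Function.Base using (_∘_)
open import Level using (0ℓ)
open import Relation.Binary.Bundles using (DecTotalOrder)
open import Relation.Binary.PropositionalEquality using (_≡_; _≢_; refl; sym; trans; cong; cong₂; subst; subst₂; module ≡-Reasoning)
import Relation.Binary.Properties.DecTotalOrder
import Relation.Binary.Reasoning.PartialOrder
open import Relation.Nullary using (¬_; yes; no; does)

-- Off the degenerate pairs nothing may be bounded pointwise, since ν has no bound better than R_ν.
-- For the range of m this is why T is at least H/L: the two boundary runs created by a shift can be
-- enlarged to runs of length T, on which the linear forms condition bounds the mean of the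
-- majorant. For x there is no error at all. The integrand vanishes off [N], so its mean over [N] is
-- 2A + 1 times its mean over 2A + 1 adjacent translates of [N], also after a shift by at most A⌊N⌋;
-- each translate is then absorbed into the constants a_j of the forms. After the substitution the
-- factor g_i(x + b_i m) has coefficient b_i - b_j at t_j and -b′_j at t′_j. Nondegeneracy of b and
-- of b′ makes all of these but the one at t_i nonzero, and this keeps the copies made by doubling a
-- variable distinct. As m and m′ have their own variables, coincidences between b and b′ do no
-- harm. Each Cauchy-Schwarz step takes a square root, whence c = 2^(-2(k-1)). The steps are carried
-- out for real functions, so products of the g_i are first expanded into products of real and
-- imaginary parts.

module Development (𝓡 : Reals) where

  open import Data.List.Membership.Propositional using (_∈_)
  open Analysis 𝓡

  -- Arithmetic in an ordered field

  module R = CommutativeRing commutativeRing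
  module RP = Algebra.Properties.Ring ring
  module O = DecTotalOrder decTotalOrder
  module ≤-Reasoning = Relation.Binary.Reasoning.PartialOrder O.poset

  fromℕ-+ : ∀ m n → fromℕ (m ℕ.+ n) ≡ fromℕ m + fromℕ n
  fromℕ-+ m n = Algebra.Properties.Monoid.Mult.×-homo-+ R.+-monoid 1# m n

  fromℕ-* : ∀ m n → fromℕ (m ℕ.* n) ≡ fromℕ m * fromℕ n
  fromℕ-* = Algebra.Properties.Semiring.Mult.×1-homo-* semiring

  -- Serves the ring solver, whose integer constants are interpreted by `coeff`: the homomorphism
  -- laws are proved for this map and carried over along `coeff≡fromℤ`.
  fromℤ : ℤ → ℝ
  fromℤ (+ n)    = fromℕ n
  fromℤ -[1+ n ] = - fromℕ (suc n)

  fromℤ-neg : ∀ i → fromℤ (ℤ.- i) ≡ - fromℤ i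
  fromℤ-neg (+ zero)  = sym RP.-0#≈0#
  fromℤ-neg +[1+ n ]  = refl
  fromℤ-neg -[1+ n ]  = sym (RP.-‿involutive _)

  fromℤ-⊖ : ∀ m n → fromℤ (m ℤ.⊖ n) ≡ fromℕ m - fromℕ n
  fromℤ-⊖ m zero = trans (sym (R.+-identityʳ _)) (cong (λ z → fromℕ m + z) (sym RP.-0#≈0#))
  fromℤ-⊖ zero (suc n) = sym (R.+-identityˡ _)
  fromℤ-⊖ (suc m) (suc n) = begin
    fromℤ (suc m ℤ.⊖ suc n)            ≡⟨ cong fromℤ (ℤ.[1+m]⊖[1+n]≡m⊖n m n) ⟩
    fromℤ (m ℤ.⊖ n)                    ≡⟨ fromℤ-⊖ m n ⟩
    fromℕ m - fromℕ n                  ≡⟨ cong (_- fromℕ n) (sym (trans (cong (_+ fromℕ m) (R.-‿inverseʳ 1#)) (R.+-identityˡ _))) ⟩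
    ((1# - 1#) + fromℕ m) - fromℕ n    ≡⟨ cong (_- fromℕ n) (trans (cong (_+ fromℕ m) (R.+-comm 1# (- 1#))) (R.+-assoc _ _ _)) ⟩
    ((- 1#) + (1# + fromℕ m)) - fromℕ n ≡⟨ cong (_- fromℕ n) (R.+-comm _ _) ⟩
    ((1# + fromℕ m) + - 1#) - fromℕ n  ≡⟨ R.+-assoc _ _ _ ⟩
    (1# + fromℕ m) + (- 1# - fromℕ n)  ≡⟨ cong (λ z → (1# + fromℕ m) + z) (Algebra.Properties.AbelianGroup.⁻¹-∙-comm R.+-abelianGroup _ _) ⟩
    fromℕ (suc m) - fromℕ (suc n) ∎
    where open ≡-Reasoning

  fromℤ-+ : ∀ i j → fromℤ (i ℤ.+ j) ≡ fromℤ i + fromℤ j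
  fromℤ-+ (+ m) (+ n) = fromℕ-+ m n
  fromℤ-+ (+ m) -[1+ n ] = fromℤ-⊖ m (suc n)
  fromℤ-+ -[1+ m ] (+ n) = trans (fromℤ-⊖ n (suc m)) (R.+-comm _ _)
  fromℤ-+ -[1+ m ] -[1+ n ] =
    trans (cong (-_ ∘ fromℕ ∘ suc) (sym (ℕ.+-suc m n)))
    (trans (cong -_ (fromℕ-+ (suc m) (suc n)))
    (sym (Algebra.Properties.AbelianGroup.⁻¹-∙-comm R.+-abelianGroup _ _)))

  fromℤ-* : ∀ i j → fromℤ (i ℤ.* j) ≡ fromℤ i * fromℤ j
  fromℤ-* (+ m) (+ n) = trans (cong fromℤ (sym (ℤ.pos-* m n))) (fromℕ-* m n)
  fromℤ-* (+ m) -[1+ n ] = begin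
    fromℤ (+ m ℤ.* -[1+ n ])         ≡⟨ cong fromℤ (sym (ℤ.neg-distribʳ-* (+ m) (+ suc n))) ⟩
    fromℤ (ℤ.- (+ m ℤ.* + suc n))    ≡⟨ fromℤ-neg (+ m ℤ.* + suc n) ⟩
    - fromℤ (+ m ℤ.* + suc n)        ≡⟨ cong (-_ ∘ fromℤ) (sym (ℤ.pos-* m (suc n))) ⟩
    - fromℕ (m ℕ.* suc n)            ≡⟨ cong -_ (fromℕ-* m (suc n)) ⟩
    - (fromℕ m * fromℕ (suc n))      ≡⟨ RP.-‿distribʳ-* _ _ ⟩
    fromℕ m * - fromℕ (suc n) ∎
    where open ≡-Reasoning
  fromℤ-* -[1+ m ] (+ n) = begin
    fromℤ (-[1+ m ] ℤ.* + n)         ≡⟨ cong fromℤ (sym (ℤ.neg-distribˡ-* (+ suc m) (+ n))) ⟩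
    fromℤ (ℤ.- (+ suc m ℤ.* + n))    ≡⟨ fromℤ-neg (+ suc m ℤ.* + n) ⟩
    - fromℤ (+ suc m ℤ.* + n)        ≡⟨ cong (-_ ∘ fromℤ) (sym (ℤ.pos-* (suc m) n)) ⟩
    - fromℕ (suc m ℕ.* n)            ≡⟨ cong -_ (fromℕ-* (suc m) n) ⟩
    - (fromℕ (suc m) * fromℕ n)      ≡⟨ RP.-‿distribˡ-* _ _ ⟩
    - fromℕ (suc m) * fromℕ n ∎
    where open ≡-Reasoning
  fromℤ-* -[1+ m ] -[1+ n ] = begin
    fromℕ (suc m ℕ.* suc n)              ≡⟨ fromℕ-* (suc m) (suc n) ⟩
    fromℕ (suc m) * fromℕ (suc n)        ≡⟨ sym (RP.-‿involutive _) ⟩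
    - - (fromℕ (suc m) * fromℕ (suc n))  ≡⟨ cong -_ (RP.-‿distribˡ-* _ _) ⟩
    - (- fromℕ (suc m) * fromℕ (suc n))  ≡⟨ RP.-‿distribʳ-* _ _ ⟩
    - fromℕ (suc m) * - fromℕ (suc n) ∎
    where open ≡-Reasoning

  -- The optimised multiple makes the constants 0, 1 and 2 of the solver reduce to 0#, 1# and 1# + 1#.
  coeff : ℤ → ℝ
  coeff (+ n)    = Algebra.Definitions.RawMonoid._×′_ +-rawMonoid n 1#
  coeff -[1+ n ] = - Algebra.Definitions.RawMonoid._×′_ +-rawMonoid (suc n) 1#

  coeff≡fromℤ : ∀ i → coeff i ≡ fromℤ i
  coeff≡fromℤ (+ n)    = sym (Algebra.Properties.Monoid.Mult.TCOptimised.×ᵤ≈× R.+-monoid n 1#)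
  coeff≡fromℤ -[1+ n ] = cong -_ (sym (Algebra.Properties.Monoid.Mult.TCOptimised.×ᵤ≈× R.+-monoid (suc n) 1#))

  coeff-morphism : ℤ.+-*-rawRing -Raw-AlmostCommutative⟶ fromCommutativeRing commutativeRing
  coeff-morphism = record
    { ⟦_⟧    = coeff
    ; +-homo = λ i j → trans (coeff≡fromℤ (i ℤ.+ j)) (trans (fromℤ-+ i j) (sym (cong₂ _+_ (coeff≡fromℤ i) (coeff≡fromℤ j))))
    ; *-homo = λ i j → trans (coeff≡fromℤ (i ℤ.* j)) (trans (fromℤ-* i j) (sym (cong₂ _*_ (coeff≡fromℤ i) (coeff≡fromℤ j))))
    ; -‿homo = λ i → trans (coeff≡fromℤ (ℤ.- i)) (trans (fromℤ-neg i) (cong -_ (sym (coeff≡fromℤ i))))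
    ; 0-homo = refl
    ; 1-homo = refl
    }

  coeff≟ : ∀ i j → Maybe (coeff i ≡ coeff j)
  coeff≟ i j with i ℤ.≟ j
  ... | yes i≡j = just (cong coeff i≡j)
  ... | no _    = nothing

  open Algebra.Solver.Ring ℤ.+-*-rawRing (fromCommutativeRing commutativeRing) coeff-morphism coeff≟
    using (solve; _:=_; _:+_; _:*_; _:-_; :-_; con; _:^_; Polynomial)

  :1 :2 : ∀ {n} → Polynomial n
  :1 = con (+ 1)
  :2 = con (+ 2)

  2# : ℝ
  2# = 1# + 1#

  open O using () renaming (refl to ≤-refl; reflexive to ≤-reflexive; trans to ≤-trans; antisym to ≤-antisym; total to ≤-total)
  open Relation.Binary.Properties.DecTotalOrder decTotalOrder using (≰⇒≥)
  open Algebra.Construct.NaturalChoice.Max O.totalOrder using (x≤x⊔y; x≤y⊔x; ⊔-lub; ⊔-sel)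

  x≤y⇒0≤y-x : ∀ {x y} → x ≤ y → 0# ≤ y - x
  x≤y⇒0≤y-x {x} {y} p = subst₂ _≤_ (R.-‿inverseˡ x) (R.+-comm _ _) (+-monoʳ-≤ (- x) p)

  -- The shape in which the ring solver proves inequalities: y − x is rewritten as an expression known to be nonnegative.
  ≤-by : ∀ {x y e} → 0# ≤ e → y - x ≡ e → x ≤ y
  ≤-by {x} {y} 0≤e eq = subst₂ _≤_ (R.+-identityʳ x)
    (solve 2 (λ x y → x :+ (y :- x) := y) refl x y) (+-monoʳ-≤ x (subst (0# ≤_) (sym eq) 0≤e))

  +-mono-≤ : ∀ {a b c d} → a ≤ b → c ≤ d → a + c ≤ b + d
  +-mono-≤ {a} {b} {c} {d} p q = ≤-trans (+-monoʳ-≤ a q) (subst₂ _≤_ (R.+-comm d a) (R.+-comm d b) (+-monoʳ-≤ d p))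

  +-nonNegative : ∀ {x y} → 0# ≤ x → 0# ≤ y → 0# ≤ x + y
  +-nonNegative p q = subst (_≤ _) (R.+-identityʳ 0#) (+-mono-≤ p q)

  neg-mono-≤ : ∀ {x y} → x ≤ y → - y ≤ - x
  neg-mono-≤ {x} {y} p = ≤-by (x≤y⇒0≤y-x p) (solve 2 (λ x y → :- x :- (:- y) := y :- x) refl x y)

  *-monoˡ-≤ : ∀ {x y z} → 0# ≤ z → x ≤ y → x * z ≤ y * z
  *-monoˡ-≤ {x} {y} {z} p q = subst₂ _≤_ (R.*-comm z x) (R.*-comm z y) (*-monoʳ-≤ p q)

  *-mono-≤ : ∀ {a b c d} → 0# ≤ b → 0# ≤ c → a ≤ b → c ≤ d → a * c ≤ b * d
  *-mono-≤ 0≤b 0≤c a≤b c≤d = ≤-trans (*-monoˡ-≤ 0≤c a≤b) (*-monoʳ-≤ 0≤b c≤d)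

  0≤x*x : ∀ x → 0# ≤ x * x
  0≤x*x x with ≤-total 0# x
  ... | inj₁ 0≤x = *-nonNegative 0≤x 0≤x
  ... | inj₂ x≤0 = subst (0# ≤_) (solve 1 (λ x → (con (+ 0) :- x) :* (con (+ 0) :- x) := x :* x) refl x)
                     (*-nonNegative (x≤y⇒0≤y-x x≤0) (x≤y⇒0≤y-x x≤0))

  0≤2 : 0# ≤ 2#
  0≤2 = +-nonNegative 0≤1 0≤1

  1≤2 : 1# ≤ 2#
  1≤2 = ≤-by 0≤1 (solve 0 (:2 :- :1 := :1) refl)

  x≤y+x : ∀ {x y} → 0# ≤ y → x ≤ y + x
  x≤y+x {x} {y} p = ≤-by p (solve 2 (λ x y → y :+ x :- x := y) refl x y)

  x≤x+y : ∀ {x y} → 0# ≤ y → x ≤ x + y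
  x≤x+y {x} {y} p = ≤-by p (solve 2 (λ x y → x :+ y :- x := y) refl x y)

  x≤∣x∣ : ∀ x → x ≤ ∣ x ∣
  x≤∣x∣ x = x≤x⊔y x (- x)

  -x≤∣x∣ : ∀ x → - x ≤ ∣ x ∣
  -x≤∣x∣ x = x≤y⊔x x (- x)

  ∣∣-lub : ∀ {x r} → x ≤ r → - x ≤ r → ∣ x ∣ ≤ r
  ∣∣-lub = ⊔-lub

  0≤∣x∣ : ∀ x → 0# ≤ ∣ x ∣
  0≤∣x∣ x with ≤-total 0# x
  ... | inj₁ 0≤x = ≤-trans 0≤x (x≤∣x∣ x)
  ... | inj₂ x≤0 = ≤-trans (subst (_≤ - x) RP.-0#≈0# (neg-mono-≤ x≤0)) (-x≤∣x∣ x)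

  ∣∣-bounds : ∀ {x r} → ∣ x ∣ ≤ r → x ≤ r × - x ≤ r
  ∣∣-bounds {x} p = ≤-trans (x≤∣x∣ x) p , ≤-trans (-x≤∣x∣ x) p

  ∣x+y∣≤ : ∀ x y → ∣ x + y ∣ ≤ ∣ x ∣ + ∣ y ∣
  ∣x+y∣≤ x y = ∣∣-lub (+-mono-≤ (x≤∣x∣ x) (x≤∣x∣ y))
    (subst (_≤ ∣ x ∣ + ∣ y ∣) (solve 2 (λ x y → :- x :+ :- y := :- (x :+ y)) refl x y) (+-mono-≤ (-x≤∣x∣ x) (-x≤∣x∣ y)))

  ∣-x∣≡∣x∣ : ∀ x → ∣ - x ∣ ≡ ∣ x ∣
  ∣-x∣≡∣x∣ x = ≤-antisym (∣∣-lub (-x≤∣x∣ x) (subst (_≤ ∣ x ∣) (sym (RP.-‿involutive x)) (x≤∣x∣ x)))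
    (∣∣-lub (subst (_≤ ∣ - x ∣) (RP.-‿involutive x) (-x≤∣x∣ (- x))) (x≤∣x∣ (- x)))

  ∣x∣≡x : ∀ {x} → 0# ≤ x → ∣ x ∣ ≡ x
  ∣x∣≡x {x} p = ≤-antisym (∣∣-lub ≤-refl (≤-trans (subst (- x ≤_) RP.-0#≈0# (neg-mono-≤ p)) p)) (x≤∣x∣ x)

  x+x≥0⇒x≥0 : ∀ {x} → 0# ≤ x + x → 0# ≤ x
  x+x≥0⇒x≥0 {x} p with ≤-total 0# x
  ... | inj₁ 0≤x = 0≤x
  ... | inj₂ x≤0 = ≤-trans p (subst (x + x ≤_) (R.+-identityʳ x) (+-monoʳ-≤ x x≤0))

  -- No signs need to be distinguished: (a - x)(b + y) + (a + x)(b - y) is twice ab - xy, and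
  -- changing the sign of y gives the other half.
  ∣x*y∣≤ : ∀ {x y a b} → ∣ x ∣ ≤ a → ∣ y ∣ ≤ b → ∣ x * y ∣ ≤ a * b
  ∣x*y∣≤ {x} {y} {a} {b} p q = ∣∣-lub
    (≤-by (x+x≥0⇒x≥0 (subst (0# ≤_)
        (solve 4 (λ x y a b → (a :- x) :* (b :- :- y) :+ (a :- :- x) :* (b :- y) := (a :* b :- x :* y) :+ (a :* b :- x :* y)) refl x y a b)
        (+-nonNegative (*-nonNegative A B′) (*-nonNegative A′ B)))) refl)
    (≤-by (x+x≥0⇒x≥0 (subst (0# ≤_)
        (solve 4 (λ x y a b → (a :- x) :* (b :- y) :+ (a :- :- x) :* (b :- :- y) := (a :* b :- :- (x :* y)) :+ (a :* b :- :- (x :* y))) refl x y a b)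
        (+-nonNegative (*-nonNegative A B) (*-nonNegative A′ B′)))) refl)
    where
    A  = x≤y⇒0≤y-x (proj₁ (∣∣-bounds p))
    A′ = x≤y⇒0≤y-x (proj₂ (∣∣-bounds p))
    B  = x≤y⇒0≤y-x (proj₁ (∣∣-bounds q))
    B′ = x≤y⇒0≤y-x (proj₂ (∣∣-bounds q))

  x*x≤∣∣ : ∀ {x a} → ∣ x ∣ ≤ a → x * x ≤ a * a
  x*x≤∣∣ {x} p = ≤-trans (x≤∣x∣ _) (∣x*y∣≤ p p)

  -- Otherwise d = x − y ≥ 0 satisfies d * d ≤ 0, which forces d = 0.
  x*x≤y*y⇒x≤y : ∀ {x y} → 0# ≤ y → x * x ≤ y * y → x ≤ y
  x*x≤y*y⇒x≤y {x} {y} 0≤y p with ≤-total x y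
  ... | inj₁ x≤y = x≤y
  ... | inj₂ y≤x with O._≟_ x y
  ...   | yes refl = ≤-refl
  ...   | no x≢y = ⊥-elim (x≢y (≤-antisym (≤-by 0≤y-x refl) y≤x))
    where
    d = x - y
    dd≤0 : d * d ≤ 0#
    dd≤0 = ≤-by (+-nonNegative (x≤y⇒0≤y-x p) (+-nonNegative (*-nonNegative 0≤y (x≤y⇒0≤y-x y≤x)) (*-nonNegative 0≤y (x≤y⇒0≤y-x y≤x))))
      (solve 2 (λ x y → con (+ 0) :- (x :- y) :* (x :- y) := (y :* y :- x :* x) :+ (y :* (x :- y) :+ y :* (x :- y))) refl x y)
    d≡0 : d ≡ 0#
    d≡0 with O._≟_ d 0#
    ... | yes q = q
    ... | no q = ⊥-elim (0≢1 (≤-antisym 0≤1 (subst₂ _≤_ e (R.zeroˡ _) (*-monoˡ-≤ (0≤x*x (d ⁻¹)) dd≤0))))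
      where
      e : d * d * (d ⁻¹ * d ⁻¹) ≡ 1#
      e = trans (solve 2 (λ d e → d :* d :* (e :* e) := (d :* e) :* (d :* e)) refl d (d ⁻¹))
            (trans (cong₂ _*_ (⁻¹-inverseʳ d q) (⁻¹-inverseʳ d q)) (R.*-identityˡ 1#))
    0≤y-x : 0# ≤ y - x
    0≤y-x = ≤-reflexive (trans (sym RP.-0#≈0#) (trans (cong -_ (sym d≡0)) (solve 2 (λ x y → :- (x :- y) := y :- x) refl x y)))

  -- The second component has the orientation that `⁻¹-inverseʳ` expects, opposite to that in
  -- `0# < x`.
  Positive : ℝ → Set
  Positive x = 0# ≤ x × x ≢ 0#

  0<1 : Positive 1#
  0<1 = 0≤1 , 0≢1 ∘ sym

  1≤⇒pos : ∀ {x} → 1# ≤ x → Positive x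
  1≤⇒pos p = ≤-trans 0≤1 p , λ { refl → 0≢1 (≤-antisym 0≤1 p) }

  ≤-pos : ∀ {x y} → Positive x → x ≤ y → Positive y
  ≤-pos (0≤x , x≢0) p = ≤-trans 0≤x p , λ { refl → x≢0 (≤-antisym p 0≤x) }

  x*x⁻¹ : ∀ {x} → Positive x → x * x ⁻¹ ≡ 1#
  x*x⁻¹ (_ , x≢0) = ⁻¹-inverseʳ _ x≢0

  ⁻¹-pos : ∀ {x} → Positive x → Positive (x ⁻¹)
  ⁻¹-pos {x} x>0@(0≤x , x≢0) = subst (0# ≤_)
    (trans (solve 2 (λ x y → x :* (y :* y) := (x :* y) :* y) refl x (x ⁻¹)) (trans (cong (_* x ⁻¹) (x*x⁻¹ x>0)) (R.*-identityˡ _)))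
    (*-nonNegative 0≤x (0≤x*x (x ⁻¹)))
    , λ e → 0≢1 (trans (sym (R.zeroʳ x)) (trans (cong (x *_) (sym e)) (x*x⁻¹ x>0)))

  *-pos : ∀ {x y} → Positive x → Positive y → Positive (x * y)
  *-pos {x} {y} x>0 y>0 = *-nonNegative (proj₁ x>0) (proj₁ y>0) , λ e → proj₂ y>0 (begin
    y               ≡⟨ sym (R.*-identityˡ y) ⟩
    1# * y          ≡⟨ cong (_* y) (sym (x*x⁻¹ x>0)) ⟩
    x * x ⁻¹ * y    ≡⟨ solve 3 (λ x z y → x :* z :* y := (x :* y) :* z) refl x (x ⁻¹) y ⟩
    x * y * x ⁻¹    ≡⟨ cong (_* x ⁻¹) e ⟩
    0# * x ⁻¹       ≡⟨ R.zeroˡ _ ⟩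
    0# ∎)
    where open ≡-Reasoning

  /-cancel : ∀ {x y} → Positive y → x / y * y ≡ x
  /-cancel {x} {y} y>0 = trans (solve 3 (λ x z y → x :* z :* y := x :* (y :* z)) refl x (y ⁻¹) y)
    (trans (cong (x *_) (x*x⁻¹ y>0)) (R.*-identityʳ x))

  */-cancel : ∀ {x y} → Positive y → x * y / y ≡ x
  */-cancel {x} {y} y>0 = trans (R.*-assoc x y _) (trans (cong (x *_) (x*x⁻¹ y>0)) (R.*-identityʳ x))

  x≤a*y⇒x/y≤a : ∀ {x y a} → Positive y → x ≤ a * y → x / y ≤ a
  x≤a*y⇒x/y≤a y>0 p = subst (_ ≤_) (*/-cancel y>0) (*-monoˡ-≤ (proj₁ (⁻¹-pos y>0)) p)

  a*y≤x⇒a≤x/y : ∀ {x y a} → Positive y → a * y ≤ x → a ≤ x / y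
  a*y≤x⇒a≤x/y y>0 p = subst (_≤ _) (*/-cancel y>0) (*-monoˡ-≤ (proj₁ (⁻¹-pos y>0)) p)

  *-cancelˡ-≤-pos : ∀ {x y z} → Positive z → z * x ≤ z * y → x ≤ y
  *-cancelˡ-≤-pos {x} {y} {z} z>0 p = subst₂ _≤_ (e x) (e y) (*-monoˡ-≤ (proj₁ (⁻¹-pos z>0)) p)
    where
    e : ∀ x → z * x * z ⁻¹ ≡ x
    e x = trans (cong (_/ z) (R.*-comm z x)) (*/-cancel z>0)

  0≤fromℕ : ∀ n → 0# ≤ fromℕ n
  0≤fromℕ zero    = ≤-refl
  0≤fromℕ (suc n) = +-nonNegative 0≤1 (0≤fromℕ n)

  1≤fromℕ-suc : ∀ n → 1# ≤ fromℕ (suc n)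
  1≤fromℕ-suc n = x≤x+y (0≤fromℕ n)

  fromℕ-mono : ∀ {m n} → m ℕ.≤ n → fromℕ m ≤ fromℕ n
  fromℕ-mono {n = n} ℕ.z≤n = 0≤fromℕ n
  fromℕ-mono (ℕ.s≤s p)     = +-monoʳ-≤ 1# (fromℕ-mono p)

  fromℕ-pos : ∀ {n} → 1 ℕ.≤ n → Positive (fromℕ n)
  fromℕ-pos {suc n} _ = 1≤⇒pos (1≤fromℕ-suc n)

  fromℕ-cancel-≤ : ∀ {m n} → fromℕ m ≤ fromℕ n → m ℕ.≤ n
  fromℕ-cancel-≤ {zero}          p = ℕ.z≤n
  fromℕ-cancel-≤ {suc m} {zero}  p = ⊥-elim (0≢1 (≤-antisym 0≤1 (≤-trans (1≤fromℕ-suc m) p)))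
  fromℕ-cancel-≤ {suc m} {suc n} p = ℕ.s≤s (fromℕ-cancel-≤
    (≤-by (x≤y⇒0≤y-x p) (solve 2 (λ m n → n :- m := :1 :+ n :- (:1 :+ m)) refl (fromℕ m) (fromℕ n))))

  module Exp = Algebra.Properties.CommutativeSemiring.Exp R.commutativeSemiring

  0≤^ : ∀ {x} n → 0# ≤ x → 0# ≤ x ^ n
  0≤^ zero    p = 0≤1
  0≤^ (suc n) p = *-nonNegative p (0≤^ n p)

  ^-monoˡ-≤ : ∀ {x y} n → 0# ≤ x → x ≤ y → x ^ n ≤ y ^ n
  ^-monoˡ-≤ zero    0≤x x≤y = ≤-refl
  ^-monoˡ-≤ (suc n) 0≤x x≤y = *-mono-≤ (≤-trans 0≤x x≤y) (0≤^ n 0≤x) x≤y (^-monoˡ-≤ n 0≤x x≤y)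

  ^-pos : ∀ {x} n → Positive x → Positive (x ^ n)
  ^-pos zero    p = 0<1
  ^-pos (suc n) p = *-pos p (^-pos n p)

  ^-≤1 : ∀ {x} n → 0# ≤ x → x ≤ 1# → x ^ n ≤ 1#
  ^-≤1 zero    0≤x x≤1 = ≤-refl
  ^-≤1 (suc n) 0≤x x≤1 = ≤-trans (*-mono-≤ 0≤1 (0≤^ n 0≤x) x≤1 (^-≤1 n 0≤x x≤1)) (≤-reflexive (R.*-identityˡ 1#))

  x^n≤x : ∀ {x} n .{{_ : NonZero n}} → 0# ≤ x → x ≤ 1# → x ^ n ≤ x
  x^n≤x (suc n) 0≤x x≤1 = ≤-trans (*-monoʳ-≤ 0≤x (^-≤1 n 0≤x x≤1)) (≤-reflexive (R.*-identityʳ _))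

  -- The final bounds have the root of η* on their large side, so what matters there is that the
  -- root dominates every candidate.
  ≤-^1/ : ∀ q .{{_ : NonZero q}} {t y} → 0# ≤ t → t ^ q ≤ y → t ≤ y ^1/ q
  ≤-^1/ q {t} {y} 0≤t t^q≤y = proj₁ (proj₂ (rootSet-sup q y)) t (0≤t , ≤-trans t^q≤y (x≤x⊔y y 0#))

  ^1/-nonNegative : ∀ q .{{_ : NonZero q}} y → 0# ≤ y ^1/ q
  ^1/-nonNegative q@(suc n) y = proj₁ (proj₂ (rootSet-sup q y)) 0# (≤-refl , ≤-trans (≤-reflexive (R.zeroˡ _)) (x≤y⊔x y 0#))

  -- Finite sums, averages and products

  private variable
    X Y : Set

  ∑-mono-∈ : ∀ (xs : List X) {f g : X → ℝ} → (∀ x → x ∈ xs → f x ≤ g x) → ∑ xs f ≤ ∑ xs g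
  ∑-mono-∈ []       p = ≤-refl
  ∑-mono-∈ (x ∷ xs) p = +-mono-≤ (p x (here refl)) (∑-mono-∈ xs λ y y∈ → p y (there y∈))

  ∑-cong-∈ : ∀ (xs : List X) {f g : X → ℝ} → (∀ x → x ∈ xs → f x ≡ g x) → ∑ xs f ≡ ∑ xs g
  ∑-cong-∈ []       p = refl
  ∑-cong-∈ (x ∷ xs) p = cong₂ _+_ (p x (here refl)) (∑-cong-∈ xs λ y y∈ → p y (there y∈))

  ∑-mono : ∀ (xs : List X) {f g : X → ℝ} → (∀ x → f x ≤ g x) → ∑ xs f ≤ ∑ xs g
  ∑-mono xs p = ∑-mono-∈ xs λ x _ → p x

  ∑-cong : ∀ (xs : List X) {f g : X → ℝ} → (∀ x → f x ≡ g x) → ∑ xs f ≡ ∑ xs g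
  ∑-cong xs p = ∑-cong-∈ xs λ x _ → p x

  ∑-+ : ∀ (xs : List X) (f g : X → ℝ) → ∑ xs (λ x → f x + g x) ≡ ∑ xs f + ∑ xs g
  ∑-+ []       f g = sym (R.+-identityʳ 0#)
  ∑-+ (x ∷ xs) f g = trans (cong (λ z → f x + g x + z) (∑-+ xs f g))
    (solve 4 (λ a b c d → a :+ b :+ (c :+ d) := a :+ c :+ (b :+ d)) refl (f x) (g x) (∑ xs f) (∑ xs g))

  ∑-*ˡ : ∀ (xs : List X) c (f : X → ℝ) → ∑ xs (λ x → c * f x) ≡ c * ∑ xs f
  ∑-*ˡ []       c f = sym (R.zeroʳ c)
  ∑-*ˡ (x ∷ xs) c f = trans (cong (λ z → c * f x + z) (∑-*ˡ xs c f)) (sym (R.distribˡ c _ _))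

  ∑-*ʳ : ∀ (xs : List X) c (f : X → ℝ) → ∑ xs (λ x → f x * c) ≡ ∑ xs f * c
  ∑-*ʳ xs c f = trans (∑-cong xs λ x → R.*-comm (f x) c) (trans (∑-*ˡ xs c f) (R.*-comm c _))

  ∑-0 : ∀ (xs : List X) → ∑ xs (λ _ → 0#) ≡ 0#
  ∑-0 []       = refl
  ∑-0 (x ∷ xs) = trans (cong (λ z → 0# + z) (∑-0 xs)) (R.+-identityʳ 0#)

  ∑-nonNegative : ∀ (xs : List X) {f : X → ℝ} → (∀ x → 0# ≤ f x) → 0# ≤ ∑ xs f
  ∑-nonNegative xs p = ≤-trans (≤-reflexive (sym (∑-0 xs))) (∑-mono xs p)

  ∑-const : ∀ (xs : List X) c → ∑ xs (λ _ → c) ≡ fromℕ (length xs) * c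
  ∑-const []       c = sym (R.zeroˡ c)
  ∑-const (x ∷ xs) c = trans (cong (λ z → c + z) (∑-const xs c))
    (solve 2 (λ c n → c :+ n :* c := (:1 :+ n) :* c) refl c (fromℕ (length xs)))

  ∑-swap : ∀ (xs : List X) (ys : List Y) (f : X → Y → ℝ) →
           ∑ xs (λ x → ∑ ys (f x)) ≡ ∑ ys (λ y → ∑ xs λ x → f x y)
  ∑-swap []       ys f = sym (∑-0 ys)
  ∑-swap (x ∷ xs) ys f = trans (cong (λ z → ∑ ys (f x) + z) (∑-swap xs ys f)) (sym (∑-+ ys (f x) (λ y → ∑ xs λ x → f x y)))

  ∑-++ : ∀ (xs ys : List X) (f : X → ℝ) → ∑ (xs ++ ys) f ≡ ∑ xs f + ∑ ys f
  ∑-++ []       ys f = sym (R.+-identityˡ _)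
  ∑-++ (x ∷ xs) ys f = trans (cong (λ z → f x + z) (∑-++ xs ys f)) (sym (R.+-assoc _ _ _))

  ∑-map : ∀ (g : X → Y) (xs : List X) (f : Y → ℝ) → ∑ (List.map g xs) f ≡ ∑ xs (f ∘ g)
  ∑-map g []       f = refl
  ∑-map g (x ∷ xs) f = cong (λ z → f (g x) + z) (∑-map g xs f)

  ∑-cartesianProductWith : ∀ {C : Set} (h : X → Y → C) (xs : List X) (ys : List Y) (f : C → ℝ) →
                           ∑ (cartesianProductWith h xs ys) f ≡ ∑ xs (λ x → ∑ ys λ y → f (h x y))
  ∑-cartesianProductWith h []       ys f = refl
  ∑-cartesianProductWith h (x ∷ xs) ys f = trans (∑-++ (List.map (h x) ys) _ f)
    (cong₂ _+_ (∑-map (h x) ys f) (∑-cartesianProductWith h xs ys f))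

  ∣∑∣≤ : ∀ (xs : List X) (f : X → ℝ) → ∣ ∑ xs f ∣ ≤ ∑ xs (λ x → ∣ f x ∣)
  ∣∑∣≤ []       f = ≤-reflexive (∣x∣≡x ≤-refl)
  ∣∑∣≤ (x ∷ xs) f = ≤-trans (∣x+y∣≤ _ _) (+-monoʳ-≤ _ (∣∑∣≤ xs f))

  ∑-*-∑ : ∀ (xs : List X) (ys : List Y) (f : X → ℝ) (g : Y → ℝ) →
          ∑ xs f * ∑ ys g ≡ ∑ xs (λ x → ∑ ys λ y → f x * g y)
  ∑-*-∑ xs ys f g = trans (sym (∑-*ʳ xs _ f)) (∑-cong xs λ x → sym (∑-*ˡ ys (f x) g))

  ∑-applyUpTo : ∀ (g : ℕ → X) n (f : X → ℝ) → ∑ (applyUpTo g n) f ≡ ∑ (upTo n) (f ∘ g)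
  ∑-applyUpTo g zero    f = refl
  ∑-applyUpTo g (suc n) f = cong (λ z → f (g 0) + z)
    (trans (∑-applyUpTo (g ∘ suc) n f) (sym (∑-applyUpTo suc n (f ∘ g))))

  ∑-upTo-suc : ∀ n (f : ℕ → ℝ) → ∑ (upTo (suc n)) f ≡ f 0 + ∑ (upTo n) (f ∘ suc)
  ∑-upTo-suc n f = cong (λ z → f 0 + z) (∑-applyUpTo suc n f)

  ∑-upTo-+ : ∀ m n (f : ℕ → ℝ) → ∑ (upTo (m ℕ.+ n)) f ≡ ∑ (upTo m) f + ∑ (upTo n) (λ i → f (m ℕ.+ i))
  ∑-upTo-+ zero    n f = sym (R.+-identityˡ _)
  ∑-upTo-+ (suc m) n f = begin
    ∑ (upTo (suc m ℕ.+ n)) f                                           ≡⟨ ∑-upTo-suc (m ℕ.+ n) f ⟩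
    f 0 + ∑ (upTo (m ℕ.+ n)) (f ∘ suc)                                 ≡⟨ cong (λ z → f 0 + z) (∑-upTo-+ m n (f ∘ suc)) ⟩
    f 0 + (∑ (upTo m) (f ∘ suc) + ∑ (upTo n) (λ i → f (suc m ℕ.+ i)))  ≡⟨ sym (R.+-assoc _ _ _) ⟩
    f 0 + ∑ (upTo m) (f ∘ suc) + ∑ (upTo n) (λ i → f (suc m ℕ.+ i))    ≡⟨ cong (_+ ∑ (upTo n) (λ i → f (suc m ℕ.+ i))) (sym (∑-upTo-suc m f)) ⟩
    ∑ (upTo (suc m)) f + ∑ (upTo n) (λ i → f (suc m ℕ.+ i)) ∎
    where open ≡-Reasoning

  ∑-run : ∀ a n (f : ℤ → ℝ) → ∑ (run a n) f ≡ ∑ (upTo n) (λ i → f (+ (a ℕ.+ suc i)))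
  ∑-run a n f = ∑-map _ (upTo n) f

  length-run : ∀ a n → length (run a n) ≡ n
  length-run a n = trans (length-map _ (upTo n)) (length-upTo n)

  run-+ : ∀ a m n (f : ℤ → ℝ) → ∑ (run a (m ℕ.+ n)) f ≡ ∑ (run a m) f + ∑ (run (a ℕ.+ m) n) f
  run-+ a m n f = begin
    ∑ (run a (m ℕ.+ n)) f                                                ≡⟨ ∑-run a (m ℕ.+ n) f ⟩
    ∑ (upTo (m ℕ.+ n)) g                                                 ≡⟨ ∑-upTo-+ m n g ⟩
    ∑ (upTo m) g + ∑ (upTo n) (λ i → g (m ℕ.+ i))                        ≡⟨ cong₂ _+_ (sym (∑-run a m f))
       (trans (∑-cong (upTo n) λ i → cong (λ j → f (+ j)) (trans (cong (a ℕ.+_) (sym (ℕ.+-suc m i))) (sym (ℕ.+-assoc a m (suc i)))))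
              (sym (∑-run (a ℕ.+ m) n f))) ⟩
    ∑ (run a m) f + ∑ (run (a ℕ.+ m) n) f ∎
    where
    open ≡-Reasoning
    g : ℕ → ℝ
    g i = f (+ (a ℕ.+ suc i))

  NonEmpty : List X → Set
  NonEmpty xs = 1 ℕ.≤ length xs

  run-nonEmpty : ∀ {a n} → 1 ℕ.≤ n → NonEmpty (run a n)
  run-nonEmpty {a} {n} p = subst (1 ℕ.≤_) (sym (length-run a n)) p

  0≤1/length : ∀ (xs : List X) → NonEmpty xs → 0# ≤ fromℕ (length xs) ⁻¹
  0≤1/length xs ne = proj₁ (⁻¹-pos (fromℕ-pos ne))

  𝔼-mono-∈ : ∀ (xs : List X) {f g : X → ℝ} → (∀ x → x ∈ xs → f x ≤ g x) → 𝔼 xs f ≤ 𝔼 xs g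
  -- Both averages are the same term `0# / 0#`, so the unspecified inverse of zero does no harm.
  𝔼-mono-∈ []         p = ≤-refl
  𝔼-mono-∈ (x ∷ xs) p = *-monoˡ-≤ (0≤1/length (x ∷ xs) (ℕ.s≤s ℕ.z≤n)) (∑-mono-∈ (x ∷ xs) p)

  𝔼-mono : ∀ (xs : List X) {f g : X → ℝ} → (∀ x → f x ≤ g x) → 𝔼 xs f ≤ 𝔼 xs g
  𝔼-mono xs p = 𝔼-mono-∈ xs λ x _ → p x

  𝔼-cong-∈ : ∀ (xs : List X) {f g : X → ℝ} → (∀ x → x ∈ xs → f x ≡ g x) → 𝔼 xs f ≡ 𝔼 xs g
  𝔼-cong-∈ xs p = cong (_/ fromℕ (length xs)) (∑-cong-∈ xs p)

  𝔼-cong : ∀ (xs : List X) {f g : X → ℝ} → (∀ x → f x ≡ g x) → 𝔼 xs f ≡ 𝔼 xs g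
  𝔼-cong xs p = cong (_/ fromℕ (length xs)) (∑-cong xs p)

  𝔼-+ : ∀ (xs : List X) (f g : X → ℝ) → 𝔼 xs (λ x → f x + g x) ≡ 𝔼 xs f + 𝔼 xs g
  𝔼-+ xs f g = trans (cong (_/ fromℕ (length xs)) (∑-+ xs f g)) (R.distribʳ _ _ _)

  𝔼-*ˡ : ∀ (xs : List X) c (f : X → ℝ) → 𝔼 xs (λ x → c * f x) ≡ c * 𝔼 xs f
  𝔼-*ˡ xs c f = trans (cong (_/ fromℕ (length xs)) (∑-*ˡ xs c f)) (R.*-assoc _ _ _)

  𝔼-*ʳ : ∀ (xs : List X) c (f : X → ℝ) → 𝔼 xs (λ x → f x * c) ≡ 𝔼 xs f * c
  𝔼-*ʳ xs c f = trans (𝔼-cong xs λ x → R.*-comm (f x) c) (trans (𝔼-*ˡ xs c f) (R.*-comm c _))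

  𝔼-- : ∀ (xs : List X) (f g : X → ℝ) → 𝔼 xs (λ x → f x - g x) ≡ 𝔼 xs f - 𝔼 xs g
  𝔼-- xs f g = trans (𝔼-+ xs f (λ x → - g x)) (cong (λ z → 𝔼 xs f + z)
    (trans (𝔼-cong xs λ x → sym (RP.-1*x≈-x (g x))) (trans (𝔼-*ˡ xs (- 1#) g) (RP.-1*x≈-x _))))

  𝔼-const : ∀ (xs : List X) → NonEmpty xs → ∀ c → 𝔼 xs (λ _ → c) ≡ c
  𝔼-const xs ne c = trans (cong (_/ fromℕ (length xs)) (trans (∑-const xs c) (R.*-comm _ c))) (*/-cancel (fromℕ-pos ne))

  𝔼-nonNegative : ∀ (xs : List X) {f : X → ℝ} → (∀ x → 0# ≤ f x) → 0# ≤ 𝔼 xs f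
  𝔼-nonNegative xs p = ≤-trans (≤-reflexive (sym (trans (cong (_/ fromℕ (length xs)) (∑-0 xs)) (R.zeroˡ _)))) (𝔼-mono xs p)

  𝔼-≤ : ∀ (xs : List X) → NonEmpty xs → ∀ {f : X → ℝ} {c} → (∀ x → x ∈ xs → f x ≤ c) → 𝔼 xs f ≤ c
  𝔼-≤ xs ne p = ≤-trans (𝔼-mono-∈ xs p) (≤-reflexive (𝔼-const xs ne _))

  ∣𝔼∣≤𝔼∣∣ : ∀ (xs : List X) (f : X → ℝ) → ∣ 𝔼 xs f ∣ ≤ 𝔼 xs (λ x → ∣ f x ∣)
  ∣𝔼∣≤𝔼∣∣ xs f = ∣∣-lub (𝔼-mono xs λ x → x≤∣x∣ (f x))
    (≤-trans (≤-reflexive (trans (sym (RP.-1*x≈-x _)) (sym (𝔼-*ˡ xs (- 1#) f))))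
             (𝔼-mono xs λ x → ≤-trans (≤-reflexive (RP.-1*x≈-x (f x))) (-x≤∣x∣ (f x))))

  ∣𝔼∣≤ : ∀ (xs : List X) → NonEmpty xs → ∀ {f : X → ℝ} {c} → (∀ x → x ∈ xs → ∣ f x ∣ ≤ c) → ∣ 𝔼 xs f ∣ ≤ c
  ∣𝔼∣≤ xs ne p = ≤-trans (∣𝔼∣≤𝔼∣∣ xs _) (𝔼-≤ xs ne p)

  𝔼-swap : ∀ (xs : List X) (ys : List Y) (f : X → Y → ℝ) →
           𝔼 xs (λ x → 𝔼 ys (f x)) ≡ 𝔼 ys (λ y → 𝔼 xs λ x → f x y)
  𝔼-swap xs ys f = begin
    ∑ xs (λ x → ∑ ys (f x) * b) * a            ≡⟨ cong (_* a) (∑-*ʳ xs b (λ x → ∑ ys (f x))) ⟩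
    ∑ xs (λ x → ∑ ys (f x)) * b * a            ≡⟨ cong (λ z → z * b * a) (∑-swap xs ys f) ⟩
    ∑ ys (λ y → ∑ xs λ x → f x y) * b * a      ≡⟨ solve 3 (λ s a b → s :* b :* a := s :* a :* b) refl _ a b ⟩
    ∑ ys (λ y → ∑ xs λ x → f x y) * a * b      ≡⟨ cong (_* b) (sym (∑-*ʳ ys a _)) ⟩
    ∑ ys (λ y → ∑ xs (λ x → f x y) * a) * b    ∎
    where
    open ≡-Reasoning
    a = fromℕ (length xs) ⁻¹
    b = fromℕ (length ys) ⁻¹

  ⁻¹-unique : ∀ {x y} → x * y ≡ 1# → y ≡ x ⁻¹
  ⁻¹-unique {x} {y} e = begin
    y                ≡⟨ sym (R.*-identityʳ y) ⟩
    y * 1#           ≡⟨ cong (y *_) (sym (⁻¹-inverseʳ x λ { refl → 0≢1 (trans (sym (R.zeroˡ y)) e) })) ⟩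
    y * (x * x ⁻¹)   ≡⟨ solve 3 (λ x y z → y :* (x :* z) := (x :* y) :* z) refl x y (x ⁻¹) ⟩
    x * y * x ⁻¹     ≡⟨ cong (_* x ⁻¹) e ⟩
    1# * x ⁻¹        ≡⟨ R.*-identityˡ _ ⟩
    x ⁻¹             ∎
    where open ≡-Reasoning

  ⁻¹-* : ∀ {x y} → Positive x → Positive y → x ⁻¹ * y ⁻¹ ≡ (x * y) ⁻¹
  ⁻¹-* {x} {y} x>0 y>0 = ⁻¹-unique (trans
    (solve 4 (λ x y u v → x :* y :* (u :* v) := (x :* u) :* (y :* v)) refl x y (x ⁻¹) (y ⁻¹))
    (trans (cong₂ _*_ (x*x⁻¹ x>0) (x*x⁻¹ y>0)) (R.*-identityˡ 1#)))

  length-cpw : ∀ {C : Set} (h : X → Y → C) xs ys → length (cartesianProductWith h xs ys) ≡ length xs ℕ.* length ys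
  length-cpw h []       ys = refl
  length-cpw h (x ∷ xs) ys = trans (length-++ (List.map (h x) ys)) (cong₂ ℕ._+_ (length-map (h x) ys) (length-cpw h xs ys))

  cpw-nonEmpty : ∀ {C : Set} (h : X → Y → C) xs ys → NonEmpty xs → NonEmpty ys → NonEmpty (cartesianProductWith h xs ys)
  cpw-nonEmpty h xs ys p q = subst (1 ℕ.≤_) (sym (length-cpw h xs ys)) (ℕ.*-mono-≤ p q)

  𝔼-cartesianProductWith : ∀ {C : Set} (h : X → Y → C) (xs : List X) (ys : List Y) → NonEmpty xs → NonEmpty ys → ∀ (f : C → ℝ) →
                           𝔼 (cartesianProductWith h xs ys) f ≡ 𝔼 xs (λ x → 𝔼 ys λ y → f (h x y))
  𝔼-cartesianProductWith h xs ys p q f = begin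
    ∑ (cartesianProductWith h xs ys) f / fromℕ (length (cartesianProductWith h xs ys))
      ≡⟨ cong₂ _/_ (∑-cartesianProductWith h xs ys f) (trans (cong fromℕ (length-cpw h xs ys)) (fromℕ-* (length xs) (length ys))) ⟩
    S / (fromℕ (length xs) * fromℕ (length ys))
      ≡⟨ cong (S *_) (sym (⁻¹-* (fromℕ-pos p) (fromℕ-pos q))) ⟩
    S * (a * b)
      ≡⟨ solve 3 (λ s a b → s :* (a :* b) := s :* b :* a) refl S a b ⟩
    S * b * a
      ≡⟨ cong (_* a) (sym (∑-*ʳ xs b _)) ⟩
    𝔼 xs (λ x → 𝔼 ys λ y → f (h x y)) ∎
    where
    open ≡-Reasoning
    S = ∑ xs (λ x → ∑ ys λ y → f (h x y))
    a = fromℕ (length xs) ⁻¹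
    b = fromℕ (length ys) ⁻¹

  tuples-nonEmpty : ∀ {n} (xss : Vec (List X) n) → (∀ i → NonEmpty (lookup xss i)) → NonEmpty (tuples xss)
  tuples-nonEmpty []         p = ℕ.s≤s ℕ.z≤n
  tuples-nonEmpty (xs ∷ xss) p = cpw-nonEmpty _∷_ xs (tuples xss) (p zero) (tuples-nonEmpty xss (p ∘ suc))

  𝔼-*-𝔼 : ∀ (xs : List X) (ys : List Y) (f : X → ℝ) (g : Y → ℝ) →
           𝔼 xs f * 𝔼 ys g ≡ 𝔼 xs (λ x → 𝔼 ys λ y → f x * g y)
  𝔼-*-𝔼 xs ys f g = trans (sym (𝔼-*ʳ xs _ f)) (𝔼-cong xs λ x → sym (𝔼-*ˡ ys (f x) g))

  -- The discriminant argument, with a in place of 𝔼 ν so that 𝔼 ν = 0 needs no separate treatment.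
  𝔼-cauchySchwarz : ∀ (xs : List X) (f g ν : X → ℝ) {a} → Positive a → (∀ x → ∣ f x ∣ ≤ ν x) → 𝔼 xs ν ≤ a →
                     𝔼 xs (λ x → f x * g x) * 𝔼 xs (λ x → f x * g x) ≤ a * 𝔼 xs (λ x → ν x * (g x * g x))
  𝔼-cauchySchwarz xs f g ν {a} a>0 f≤ν Eν≤a = *-cancelˡ-≤-pos a>0 (≤-by key (solve 3 (λ a b q → a :* (a :* q) :- a :* (b :* b) := a :* (a :* q) :- a :* (b :* b)) refl a b q))
    where
    b = 𝔼 xs (λ x → f x * g x)
    q = 𝔼 xs (λ x → ν x * (g x * g x))
    -- Twice this expression is (ν - f)(ag + b)² + (ν + f)(ag - b)². The bound |f| ≤ ν enters with
    -- both signs, and no square root of ν has to be taken.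
    pointwise : ∀ x → 0# ≤ a * a * (ν x * (g x * g x)) + ((- (2# * a * b)) * (f x * g x) + b * b * ν x)
    pointwise x = x+x≥0⇒x≥0 (subst (0# ≤_)
      (solve 5 (λ n f g a b → (n :- f) :* ((a :* g :+ b) :* (a :* g :+ b)) :+ (n :- :- f) :* ((a :* g :- b) :* (a :* g :- b))
         := (a :* a :* (n :* (g :* g)) :+ ((:- (:2 :* a :* b)) :* (f :* g) :+ b :* b :* n)) :+ (a :* a :* (n :* (g :* g)) :+ ((:- (:2 :* a :* b)) :* (f :* g) :+ b :* b :* n)))
         refl (ν x) (f x) (g x) a b)
      (+-nonNegative (*-nonNegative (x≤y⇒0≤y-x (proj₁ (∣∣-bounds (f≤ν x)))) (0≤x*x _))
                     (*-nonNegative (x≤y⇒0≤y-x (proj₂ (∣∣-bounds (f≤ν x)))) (0≤x*x _))))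
    averaged : 0# ≤ a * a * q + ((- (2# * a * b)) * b + b * b * 𝔼 xs ν)
    averaged = subst (0# ≤_)
      (trans (𝔼-+ xs _ _) (cong₂ _+_ (𝔼-*ˡ xs _ _) (trans (𝔼-+ xs _ _) (cong₂ _+_ (𝔼-*ˡ xs _ _) (𝔼-*ˡ xs _ _)))))
      (𝔼-nonNegative xs pointwise)
    key : 0# ≤ a * (a * q) - a * (b * b)
    key = ≤-trans averaged (≤-by (*-nonNegative (0≤x*x b) (x≤y⇒0≤y-x Eν≤a))
      (solve 4 (λ a b q e → a :* (a :* q) :- a :* (b :* b) :- (a :* a :* q :+ ((:- (:2 :* a :* b)) :* b :+ b :* b :* e)) := b :* b :* (a :- e)) refl a b q (𝔼 xs ν)))

  ∏-cong : ∀ (xs : List X) {f g : X → ℝ} → (∀ x → f x ≡ g x) → ∏ xs f ≡ ∏ xs g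
  ∏-cong []       p = refl
  ∏-cong (x ∷ xs) p = cong₂ _*_ (p x) (∏-cong xs p)

  ∏-++ : ∀ (xs ys : List X) (f : X → ℝ) → ∏ (xs ++ ys) f ≡ ∏ xs f * ∏ ys f
  ∏-++ []       ys f = sym (R.*-identityˡ _)
  ∏-++ (x ∷ xs) ys f = trans (cong (λ z → f x * z) (∏-++ xs ys f)) (sym (R.*-assoc _ _ _))

  ∏-map : ∀ (g : X → Y) (xs : List X) (f : Y → ℝ) → ∏ (List.map g xs) f ≡ ∏ xs (f ∘ g)
  ∏-map g []       f = refl
  ∏-map g (x ∷ xs) f = cong (λ z → f (g x) * z) (∏-map g xs f)

  ∏-* : ∀ (xs : List X) (f g : X → ℝ) → ∏ xs (λ x → f x * g x) ≡ ∏ xs f * ∏ xs g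
  ∏-* []       f g = sym (R.*-identityʳ 1#)
  ∏-* (x ∷ xs) f g = trans (cong (λ z → f x * g x * z) (∏-* xs f g))
    (solve 4 (λ a b c d → a :* b :* (c :* d) := a :* c :* (b :* d)) refl (f x) (g x) (∏ xs f) (∏ xs g))

  ∣∏∣≤ : ∀ (xs : List X) {f g : X → ℝ} → (∀ x → ∣ f x ∣ ≤ g x) → ∣ ∏ xs f ∣ ≤ ∏ xs g
  ∣∏∣≤ []       p = ≤-reflexive (∣x∣≡x 0≤1)
  ∣∏∣≤ (x ∷ xs) p = ∣x*y∣≤ (p x) (∣∏∣≤ xs p)

  ∏-nonNegative : ∀ (xs : List X) {f : X → ℝ} → (∀ x → 0# ≤ f x) → 0# ≤ ∏ xs f
  ∏-nonNegative []       p = 0≤1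
  ∏-nonNegative (x ∷ xs) p = *-nonNegative (p x) (∏-nonNegative xs p)

  ∏-const : ∀ (xs : List X) c → ∏ xs (λ _ → c) ≡ c ^ length xs
  ∏-const []       c = refl
  ∏-const (x ∷ xs) c = cong (c *_) (∏-const xs c)

  ∏-mono : ∀ (xs : List X) {f g : X → ℝ} → (∀ x → 0# ≤ f x) → (∀ x → f x ≤ g x) → ∏ xs f ≤ ∏ xs g
  ∏-mono xs 0≤f f≤g = ≤-trans (x≤∣x∣ _) (∣∏∣≤ xs λ x → ≤-trans (≤-reflexive (∣x∣≡x (0≤f x))) (f≤g x))

  -- Used to peel off the first index: the tail of `allFin (suc n)` is `tabulate suc`, not the image
  -- of `allFin n` under `map`.
  bigOp-tabulate : ∀ (M : RawMonoid 0ℓ 0ℓ) {n} (f : Fin n → X) (g : X → RawMonoid.Carrier M) (f′ : Fin n → Y) (g′ : Y → RawMonoid.Carrier M) →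
                   (∀ i → g (f i) ≡ g′ (f′ i)) → bigOp M (tabulate f) g ≡ bigOp M (tabulate f′) g′
  bigOp-tabulate M {zero}  f g f′ g′ e = refl
  bigOp-tabulate M {suc n} f g f′ g′ e = cong₂ (RawMonoid._∙_ M) (e zero) (bigOp-tabulate M (f ∘ suc) g (f′ ∘ suc) g′ (e ∘ suc))

  ∏-allFin-suc : ∀ {n} (f : Fin (suc n) → ℝ) → ∏ (allFin (suc n)) f ≡ f zero * ∏ (allFin n) (f ∘ suc)
  ∏-allFin-suc f = cong (λ z → f zero * z) (bigOp-tabulate *-rawMonoid suc f (λ i → i) (f ∘ suc) λ _ → refl)

  -- The generalised von Neumann inequality

  module ℤS = Data.Integer.Solver.+-*-Solver

  -- The affine form x + shift + todo · t + done · h.  The variables t still await an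
  -- application of the Cauchy–Schwarz inequality; each one already treated has left two
  -- entries in h.
  record Form (s n : ℕ) : Set where
    constructor form
    field
      shift : ℤ
      done  : Vec ℤ s
      todo  : Vec ℤ n
  open Form

  value : ∀ {s n} → Form s n → ℤ → Vec ℤ s → Vec ℤ n → ℤ
  value (form a c l) x h t = x ℤ.+ a ℤ.+ (dot l t ℤ.+ dot c h)

  _#_ : ∀ {s n} → Form s n → Form s n → Set
  φ # ψ = ¬ (done φ ≡ done ψ × todo φ ≡ todo ψ)

  -- The fate of a form when its first variable is doubled into y₀ and y₁. A form without that
  -- variable becomes `drop` before the doubling and `keep` after it; any other form gives the two
  -- copies `dbl₀` and `dbl₁`.
  drop keep dbl₀ dbl₁ : ∀ {s n} → Form s (suc n) → _
  drop {s} {n} (form a c (_ ∷ l)) = form {s} {n} a c l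
  keep {s} {n} (form a c (_ ∷ l)) = form {suc (suc s)} {n} a (+ 0 ∷ + 0 ∷ c) l
  dbl₀ {s} {n} (form a c (k ∷ l)) = form {suc (suc s)} {n} a (k ∷ + 0 ∷ c) l
  dbl₁ {s} {n} (form a c (k ∷ l)) = form {suc (suc s)} {n} a (+ 0 ∷ k ∷ c) l

  -- The zero in place i lets the i-th factor leave the average over t_i. The other entries are
  -- nonzero so that doubling any earlier variable produces distinct copies.
  Hollow : ∀ {n} → Fin n → Vec ℤ n → Set
  Hollow zero    (k ∷ l) = k ≡ + 0 × VecAll.All (_≢ + 0) l
  Hollow (suc i) (k ∷ l) = k ≢ + 0 × Hollow i l

  module _ {s n : ℕ} where

    value-drop : ∀ (φ : Form s (suc n)) → Vec.head (todo φ) ≡ + 0 → ∀ x h y t →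
                 value φ x h (y ∷ t) ≡ value (drop φ) x h t
    value-drop (form a c (_ ∷ l)) refl x h y t = cong (λ z → x ℤ.+ a ℤ.+ (z ℤ.+ dot c h))
      (trans (cong (ℤ._+ dot l t) (ℤ.*-zeroˡ y)) (ℤ.+-identityˡ (dot l t)))

    value-keep : ∀ (φ : Form s (suc n)) x h y₀ y₁ t → value (keep φ) x (y₀ ∷ y₁ ∷ h) t ≡ value (drop φ) x h t
    value-keep (form a c (_ ∷ l)) x h y₀ y₁ t = cong (λ z → x ℤ.+ a ℤ.+ (dot l t ℤ.+ z))
      (ℤS.solve 3 (λ d y₀ y₁ → ℤS.con (+ 0) ℤS.:* y₀ ℤS.:+ (ℤS.con (+ 0) ℤS.:* y₁ ℤS.:+ d) ℤS.:= d) refl (dot c h) y₀ y₁)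

    value-dbl₀ : ∀ (φ : Form s (suc n)) x h y₀ y₁ t → value (dbl₀ φ) x (y₀ ∷ y₁ ∷ h) t ≡ value φ x h (y₀ ∷ t)
    value-dbl₀ (form a c (k ∷ l)) x h y₀ y₁ t = cong (λ z → x ℤ.+ a ℤ.+ z)
      (ℤS.solve 5 (λ d e k y₀ y₁ → e ℤS.:+ (k ℤS.:* y₀ ℤS.:+ (ℤS.con (+ 0) ℤS.:* y₁ ℤS.:+ d)) ℤS.:= k ℤS.:* y₀ ℤS.:+ e ℤS.:+ d)
        refl (dot c h) (dot l t) k y₀ y₁)

    value-dbl₁ : ∀ (φ : Form s (suc n)) x h y₀ y₁ t → value (dbl₁ φ) x (y₀ ∷ y₁ ∷ h) t ≡ value φ x h (y₁ ∷ t)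
    value-dbl₁ (form a c (k ∷ l)) x h y₀ y₁ t = cong (λ z → x ℤ.+ a ℤ.+ z)
      (ℤS.solve 5 (λ d e k y₀ y₁ → e ℤS.:+ (ℤS.con (+ 0) ℤS.:* y₀ ℤS.:+ (k ℤS.:* y₁ ℤS.:+ d)) ℤS.:= k ℤS.:* y₁ ℤS.:+ e ℤS.:+ d)
        refl (dot c h) (dot l t) k y₀ y₁)

    drop-# : ∀ {φ ψ : Form s (suc n)} → Vec.head (todo φ) ≡ + 0 → Vec.head (todo ψ) ≡ + 0 → φ # ψ → drop φ # drop ψ
    drop-# {form _ _ (_ ∷ _)} {form _ _ (_ ∷ _)} refl refl φ#ψ (refl , refl) = φ#ψ (refl , refl)

    keep-# : ∀ {φ ψ : Form s (suc n)} → Vec.head (todo φ) ≡ + 0 → Vec.head (todo ψ) ≡ + 0 → φ # ψ → keep φ # keep ψ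
    keep-# {form _ _ (_ ∷ _)} {form _ _ (_ ∷ _)} refl refl φ#ψ (refl , refl) = φ#ψ (refl , refl)

    dbl₀-# : ∀ {φ ψ : Form s (suc n)} → φ # ψ → dbl₀ φ # dbl₀ ψ
    dbl₀-# {form _ _ (_ ∷ _)} {form _ _ (_ ∷ _)} φ#ψ (refl , refl) = φ#ψ (refl , refl)

    dbl₁-# : ∀ {φ ψ : Form s (suc n)} → φ # ψ → dbl₁ φ # dbl₁ ψ
    dbl₁-# {form _ _ (_ ∷ _)} {form _ _ (_ ∷ _)} φ#ψ (refl , refl) = φ#ψ (refl , refl)

    dbl₀-#-dbl₁ : ∀ {φ : Form s (suc n)} (ψ : Form s (suc n)) → Vec.head (todo φ) ≢ + 0 → dbl₀ φ # dbl₁ ψ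
    dbl₀-#-dbl₁ {form _ _ (_ ∷ _)} (form _ _ (_ ∷ _)) k≢0 (refl , _) = k≢0 refl

    keep-#-dbl₀ : ∀ (φ : Form s (suc n)) {ψ : Form s (suc n)} → Vec.head (todo ψ) ≢ + 0 → keep φ # dbl₀ ψ
    keep-#-dbl₀ (form _ _ (_ ∷ _)) {form _ _ (_ ∷ _)} k≢0 (refl , _) = k≢0 refl

    keep-#-dbl₁ : ∀ (φ : Form s (suc n)) {ψ : Form s (suc n)} → Vec.head (todo ψ) ≢ + 0 → keep φ # dbl₁ ψ
    keep-#-dbl₁ (form _ _ (_ ∷ _)) {form _ _ (_ ∷ _)} k≢0 (refl , _) = k≢0 refl

  -- `maj` will stand for the majorant ν and `one` for 1_[N], the two choices that the linear forms
  -- condition offers for each factor.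
  data Tag : Set where
    maj one : Tag

  -- The range `xs` of x is left abstract because it will be a union of translates of [N];
  -- admissibility of a shift then depends on all the translates. `CoeffOK-0` is for the zeros
  -- inserted by doubling.
  module GeneralisedVonNeumann
    (xs ys : List ℤ) (xs-nonEmpty : NonEmpty xs) (ys-nonEmpty : NonEmpty ys)
    (weight : Tag → ℤ → ℝ) (0≤weight : ∀ τ z → 0# ≤ weight τ z) (one≤1 : ∀ z → weight one z ≤ 1#)
    (η : ℝ) (0≤η : 0# ≤ η) (η≤1 : η ≤ 1#)
    (ShiftOK CoeffOK : ℤ → Set) (CoeffOK-0 : CoeffOK (+ 0)) (maxForms maxVars : ℕ)
    where

    grid : ∀ n → List (Vec ℤ n)
    grid n = tuples (replicate n ys)

    average : ∀ {s n} → (ℤ → Vec ℤ s → Vec ℤ n → ℝ) → ℝ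
    average {s} {n} F = 𝔼 xs λ x → 𝔼 (grid s) λ h → 𝔼 (grid n) λ t → F x h t

    OK : ∀ {s n} → Form s n → Set
    OK φ = ShiftOK (shift φ) × VecAll.All CoeffOK (done φ) × VecAll.All CoeffOK (todo φ)

    product : ∀ {s n} → List (Tag × Form s n) → ℤ → Vec ℤ s → Vec ℤ n → ℝ
    product F x h t = ∏ F λ (τ , φ) → weight τ (value φ x h t)

    product₁ : ∀ {s n} → List (Form s n) → ℤ → Vec ℤ s → Vec ℤ n → ℝ
    product₁ F x h t = ∏ F λ φ → weight one (value φ x h t)

    module _
      (linearForms : ∀ {s n} (F : List (Tag × Form s n)) →
         1 ℕ.≤ length F → length F ℕ.≤ maxForms → n ℕ.+ s ℕ.≤ maxVars →
         All OK (List.map proj₂ F) → AllPairs _#_ (List.map proj₂ F) →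
         ∣ average (product F) - average (product₁ (List.map proj₂ F)) ∣ ≤ η)
      where

      grid-nonEmpty : ∀ n → NonEmpty (grid n)
      grid-nonEmpty n = tuples-nonEmpty (replicate n ys) λ i → subst NonEmpty (sym (Vec.lookup-replicate i ys)) ys-nonEmpty

      𝔼-grid-suc : ∀ n (F : Vec ℤ (suc n) → ℝ) → 𝔼 (grid (suc n)) F ≡ 𝔼 ys (λ y → 𝔼 (grid n) λ t → F (y ∷ t))
      𝔼-grid-suc n F = 𝔼-cartesianProductWith _∷_ ys (grid n) ys-nonEmpty (grid-nonEmpty n) F

      average-cong : ∀ {s n} {F G : ℤ → Vec ℤ s → Vec ℤ n → ℝ} → (∀ x h t → F x h t ≡ G x h t) → average F ≡ average G
      average-cong {s} {n} p = 𝔼-cong xs λ x → 𝔼-cong (grid s) λ h → 𝔼-cong (grid n) λ t → p x h t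

      average-- : ∀ {s n} (F G : ℤ → Vec ℤ s → Vec ℤ n → ℝ) → average (λ x h t → F x h t - G x h t) ≡ average F - average G
      average-- {s} {n} F G = trans
        (𝔼-cong xs λ x → trans (𝔼-cong (grid s) λ h → 𝔼-- (grid n) _ _) (𝔼-- (grid s) _ _))
        (𝔼-- xs _ _)

      average-≤ : ∀ {s n} {F : ℤ → Vec ℤ s → Vec ℤ n → ℝ} {c} → (∀ x h t → F x h t ≤ c) → average F ≤ c
      average-≤ {s} {n} p = 𝔼-≤ xs xs-nonEmpty λ x _ → 𝔼-≤ (grid s) (grid-nonEmpty s) λ h _ → 𝔼-≤ (grid n) (grid-nonEmpty n) λ t _ → p x h t

      average-product₁≤1 : ∀ {s n} (F : List (Form s n)) → average (product₁ F) ≤ 1#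
      average-product₁≤1 F = average-≤ λ x h t → ≤-trans (∏-mono F (λ φ → 0≤weight one (value φ x h t)) (λ φ → one≤1 (value φ x h t)))
        (≤-reflexive (trans (∏-const F 1#) (1^ (length F))))
        where
        1^ : ∀ n → 1# ^ n ≡ 1#
        1^ zero    = refl
        1^ (suc n) = trans (R.*-identityˡ _) (1^ n)

      -- The main term is a mean of numbers in [0, 1], and the error η is at most 1. This is the
      -- constant lost in each Cauchy-Schwarz step.
      average-product≤2 : ∀ {s n} (F : List (Tag × Form s n)) →
         1 ℕ.≤ length F → length F ℕ.≤ maxForms → n ℕ.+ s ℕ.≤ maxVars →
         All OK (List.map proj₂ F) → AllPairs _#_ (List.map proj₂ F) → average (product F) ≤ 2#
      average-product≤2 F p₁ p₂ p₃ p₄ p₅ = ≤-trans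
        (≤-by (x≤y⇒0≤y-x (proj₁ (∣∣-bounds (linearForms F p₁ p₂ p₃ p₄ p₅))))
              (solve 3 (λ a b η → η :+ b :- a := η :- (a :- b)) refl (average (product F)) (average (product₁ (List.map proj₂ F))) η))
        (+-mono-≤ η≤1 (average-product₁≤1 (List.map proj₂ F)))

      weight± : Maybe Tag → ℤ → ℝ
      weight± (just τ) z = weight τ z
      weight± nothing  z = weight maj z - weight one z

      product± : ∀ {s n} → List (Maybe Tag × Form s n) → ℤ → Vec ℤ s → Vec ℤ n → ℝ
      product± F x h t = ∏ F λ (τ , φ) → weight± τ (value φ x h t)

      hasDifference : ∀ {s n} → List (Maybe Tag × Form s n) → Bool
      hasDifference []                  = false
      hasDifference ((nothing , _) ∷ F) = true
      hasDifference ((just _ , _) ∷ F)  = hasDifference F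

      Small : Bool → ℕ → ℝ → ℝ → Set
      Small true  m c v = ∣ v ∣ ≤ 2# ^ m * η
      Small false m c v = ∣ v - c ∣ ≤ η

      -- Expanding every difference leaves signed products over the same list of forms. Each is
      -- within η of the same main term c, and c cancels as soon as one difference is present. The
      -- list `P` holds the factors whose tag has already been chosen; the remaining m factors
      -- branch at most 2^m times.
      product±-small : ∀ {s n} c (P : List (Tag × Form s n)) (F : List (Maybe Tag × Form s n)) →
        (∀ Q → List.map proj₂ Q ≡ List.map proj₂ P ++ List.map proj₂ F → ∣ average (product Q) - c ∣ ≤ η) →
        Small (hasDifference F) (length F) c (average λ x h t → product P x h t * product± F x h t)
      product±-small {s} {n} c P [] hyp = subst (λ v → ∣ v - c ∣ ≤ η)
        (average-cong {s} {n} λ x h t → sym (R.*-identityʳ (product P x h t))) (hyp P (sym (List.++-identityʳ _)))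
      product±-small {s} {n} c P ((just τ , φ) ∷ F) hyp = weaken (hasDifference F) (subst (Small (hasDifference F) (length F) c)
        (average-cong λ x h t → trans (cong (_* product± F x h t) (∏-++ P ((τ , φ) ∷ []) _))
          (solve 3 (λ a b c → a :* (b :* :1) :* c := a :* (b :* c)) refl (product P x h t) (weight τ (value φ x h t)) (product± F x h t)))
        (product±-small c (P ++ (τ , φ) ∷ []) F λ Q e → hyp Q (trans e (trans (cong (_++ List.map proj₂ F) (List.map-++ proj₂ P _)) (List.++-assoc (List.map proj₂ P) _ _)))))
        where
        weaken : ∀ b {v} → Small b (length F) c v → Small b (suc (length F)) c v
        weaken true  p = ≤-trans p (*-monoˡ-≤ 0≤η (≤-by (0≤^ (length F) 0≤2) (solve 1 (λ z → :2 :* z :- z := z) refl (2# ^ length F))))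
        weaken false p = p
      product±-small {s} {n} c P ((nothing , φ) ∷ F) hyp = subst (λ v → ∣ v ∣ ≤ 2# ^ suc (length F) * η) (sym eq)
        (combine (hasDifference F) (branch maj) (branch one))
        where
        v : Tag → ℝ
        v τ = average λ x h t → product P x h t * (weight τ (value φ x h t) * product± F x h t)
        branch : ∀ τ → Small (hasDifference F) (length F) c (v τ)
        branch τ = subst (Small (hasDifference F) (length F) c)
          (average-cong λ x h t → trans (cong (_* product± F x h t) (∏-++ P ((τ , φ) ∷ []) _))
            (solve 3 (λ a b c → a :* (b :* :1) :* c := a :* (b :* c)) refl (product P x h t) (weight τ (value φ x h t)) (product± F x h t)))
          (product±-small c (P ++ (τ , φ) ∷ []) F λ Q e → hyp Q (trans e (trans (cong (_++ List.map proj₂ F) (List.map-++ proj₂ P _)) (List.++-assoc (List.map proj₂ P) _ _))))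
        eq : average (λ x h t → product P x h t * product± ((nothing , φ) ∷ F) x h t) ≡ v maj - v one
        eq = trans (average-cong λ x h t →
            solve 4 (λ p a b f → p :* ((a :- b) :* f) := p :* (a :* f) :- p :* (b :* f)) refl (product P x h t) (weight maj (value φ x h t)) (weight one (value φ x h t)) (product± F x h t))
          (average-- {s} {n} _ _)
        1≤2^ : 1# ≤ 2# ^ length F
        1≤2^ = 1≤^ (length F) 1≤2
        combine : ∀ b → Small b (length F) c (v maj) → Small b (length F) c (v one) → ∣ v maj - v one ∣ ≤ 2# ^ suc (length F) * η
        combine true p q = ≤-trans (∣x+y∣≤ _ _) (≤-trans (+-mono-≤ p (≤-trans (≤-reflexive (∣-x∣≡∣x∣ _)) q))
          (≤-reflexive (solve 2 (λ z η → z :* η :+ z :* η := :2 :* z :* η) refl (2# ^ length F) η)))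
        combine false p q = ≤-trans (≤-reflexive (cong ∣_∣ (solve 3 (λ a b c → a :- b := (a :- c) :+ :- (b :- c)) refl (v maj) (v one) c)))
          (≤-trans (∣x+y∣≤ _ _) (≤-trans (+-mono-≤ p (≤-trans (≤-reflexive (∣-x∣≡∣x∣ _)) q))
            (≤-by (*-nonNegative (x≤y⇒0≤y-x 1≤2^) (+-nonNegative 0≤η 0≤η)) (solve 2 (λ z η → :2 :* z :* η :- (η :+ η) := (z :- :1) :* (η :+ η)) refl (2# ^ length F) η))))

      -- Every variable still to be doubled occurs, so that the two copies of the form differ after
      -- each later step.
      Full : ∀ {s n} → Form s n → Set
      Full φ = OK φ × VecAll.All (_≢ + 0) (todo φ)

      HollowAt : ∀ {s n} → Fin n → Form s n → Set
      HollowAt i φ = OK φ × Hollow i (todo φ)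

      module _ {s n : ℕ} where

        Full-head : ∀ {φ : Form s (suc n)} → Full φ → Vec.head (todo φ) ≢ + 0
        Full-head {form _ _ (_ ∷ _)} (_ , k≢0 ∷ _) = k≢0

        HollowAt-zero-head : ∀ {φ : Form s (suc n)} → HollowAt zero φ → Vec.head (todo φ) ≡ + 0
        HollowAt-zero-head {form _ _ (_ ∷ _)} (_ , k≡0 , _) = k≡0

        HollowAt-suc-head : ∀ {i} {φ : Form s (suc n)} → HollowAt (suc i) φ → Vec.head (todo φ) ≢ + 0
        HollowAt-suc-head {φ = form _ _ (_ ∷ _)} (_ , k≢0 , _) = k≢0

        drop-OK : ∀ {φ : Form s (suc n)} → HollowAt zero φ → OK (drop φ)
        drop-OK {form _ _ (_ ∷ _)} ((a , c , _ ∷ l) , _) = a , c , l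

        keep-Full : ∀ {φ : Form s (suc n)} → HollowAt zero φ → Full (keep φ)
        keep-Full {form _ _ (_ ∷ _)} ((a , c , _ ∷ l) , _ , l≢0) = (a , CoeffOK-0 ∷ CoeffOK-0 ∷ c , l) , l≢0

        dbl₀-Full : ∀ {φ : Form s (suc n)} → Full φ → Full (dbl₀ φ)
        dbl₀-Full {form _ _ (_ ∷ _)} ((a , c , k ∷ l) , _ ∷ l≢0) = (a , k ∷ CoeffOK-0 ∷ c , l) , l≢0

        dbl₁-Full : ∀ {φ : Form s (suc n)} → Full φ → Full (dbl₁ φ)
        dbl₁-Full {form _ _ (_ ∷ _)} ((a , c , k ∷ l) , _ ∷ l≢0) = (a , CoeffOK-0 ∷ k ∷ c , l) , l≢0

        dbl₀-HollowAt : ∀ {i} {φ : Form s (suc n)} → HollowAt (suc i) φ → HollowAt i (dbl₀ φ)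
        dbl₀-HollowAt {φ = form _ _ (_ ∷ _)} ((a , c , k ∷ l) , _ , hollow) = (a , k ∷ CoeffOK-0 ∷ c , l) , hollow

        dbl₁-HollowAt : ∀ {i} {φ : Form s (suc n)} → HollowAt (suc i) φ → HollowAt i (dbl₁ φ)
        dbl₁-HollowAt {φ = form _ _ (_ ∷ _)} ((a , c , k ∷ l) , _ , hollow) = (a , CoeffOK-0 ∷ k ∷ c , l) , hollow

        double : List (Form s (suc n)) → List (Form (suc (suc s)) n)
        double L = List.map dbl₀ L ++ List.map dbl₁ L

        double-AllPairs : ∀ {L} → All (λ φ → Vec.head (todo φ) ≢ + 0) L → AllPairs _#_ L → AllPairs _#_ (double L)
        double-AllPairs {L} L≢0 L# = AllPairs.++⁺
          (AllPairs.map⁺ (AllPairs.map dbl₀-# L#)) (AllPairs.map⁺ (AllPairs.map dbl₁-# L#))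
          (All.map⁺ (All.map (λ {φ} k≢0 → All.map⁺ (All.universal (λ ψ → dbl₀-#-dbl₁ {φ = φ} ψ k≢0) L)) L≢0))

        double-All : ∀ {P : Form s (suc n) → Set} {Q : Form (suc (suc s)) n → Set} {L} →
                     (∀ {φ} → P φ → Q (dbl₀ φ)) → (∀ {φ} → P φ → Q (dbl₁ φ)) → All P L → All Q (double L)
        double-All p q L = All.++⁺ (All.map⁺ (All.map p L)) (All.map⁺ (All.map q L))

        length-double : ∀ L → length (double L) ≡ length L ℕ.+ length L
        length-double L = trans (length-++ (List.map dbl₀ L)) (cong₂ ℕ._+_ (length-map dbl₀ L) (length-map dbl₁ L))

        -- In the two new coordinates the kept forms have (0, 0), while the copies have (k, 0) and
        -- (0, k) with k nonzero. Hence only forms within one block, or within `G`, ever have to be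
        -- compared with each other beforehand.
        keep-double-AllPairs : ∀ {K L} → All (HollowAt zero) K → All Full L → AllPairs _#_ K → AllPairs _#_ L →
                               AllPairs _#_ (List.map keep K ++ double L)
        keep-double-AllPairs {K} {L} hollow full K# L# = AllPairs.++⁺
          (AllPairs.map⁺ (allPairs hollow K#)) (double-AllPairs (All.map Full-head full) L#)
          (All.map⁺ (All.universal (λ φ → double-All (λ {ψ} p → keep-#-dbl₀ φ {ψ} (Full-head {ψ} p)) (λ {ψ} p → keep-#-dbl₁ φ {ψ} (Full-head {ψ} p)) full) K))
          where
          allPairs : ∀ {K} → All (HollowAt zero) K → AllPairs _#_ K → AllPairs (λ φ ψ → keep φ # keep ψ) K
          allPairs []       []       = []
          allPairs (p ∷ ps) (q ∷ qs) =
            All.zipWith (λ (r , φ#ψ) → keep-# (HollowAt-zero-head p) (HollowAt-zero-head r) φ#ψ) (ps , q) ∷ allPairs ps qs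

        drop-AllPairs : ∀ {K} → All (HollowAt zero) K → AllPairs _#_ K → AllPairs _#_ (List.map drop K)
        drop-AllPairs hollow K# = AllPairs.map⁺ (allPairs hollow K#)
          where
          allPairs : ∀ {K} → All (HollowAt zero) K → AllPairs _#_ K → AllPairs (λ φ ψ → drop φ # drop ψ) K
          allPairs []       []       = []
          allPairs (p ∷ ps) (q ∷ qs) =
            All.zipWith (λ (r , φ#ψ) → drop-# (HollowAt-zero-head p) (HollowAt-zero-head r) φ#ψ) (ps , q) ∷ allPairs ps qs

      blocks : ∀ {s n} → (Fin n → ℤ → ℝ) → (Fin n → List (Form s n)) → ℤ → Vec ℤ s → Vec ℤ n → ℝ
      blocks {n = n} f L x h t = ∏ (allFin n) λ i → ∏ (L i) λ φ → f i (value φ x h t)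

      doubleG : ∀ {s n} → Tag → List (Form s (suc n)) → List (Maybe Tag × Form s (suc n)) → List (Maybe Tag × Form (suc (suc s)) n)
      doubleG τ K G = List.map (λ φ → just τ , keep φ) K ++ (List.map (map₂ dbl₀) G ++ List.map (map₂ dbl₁) G)

      -- The block `L zero` is free of the first variable, so its product is the factor to be
      -- majorised in the Cauchy-Schwarz inequality. All other factors are averaged over that
      -- variable and squared, which creates y₀ and y₁.
      module Step {s n : ℕ} (G : List (Maybe Tag × Form s (suc n)))
                  (f : Fin (suc n) → ℤ → ℝ) (τ : Fin (suc n) → Tag) (L : Fin (suc n) → List (Form s (suc n)))
                  (f≤weight : ∀ i z → ∣ f i z ∣ ≤ weight (τ i) z)
                  (K-nonEmpty : 1 ℕ.≤ length (L zero)) (K-bounded : length (L zero) ℕ.≤ maxForms) (vars : n ℕ.+ s ℕ.≤ maxVars)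
                  (K-hollow : All (HollowAt zero) (L zero)) (K# : AllPairs _#_ (L zero)) where

        K = L zero
        f′ = f ∘ suc
        L′ = double ∘ L ∘ suc
        G′ = doubleG (τ zero) K G

        u ν-u : ℤ → Vec ℤ s → Vec ℤ n → ℝ
        u x h t   = ∏ K λ φ → f zero (value (drop φ) x h t)
        ν-u x h t = ∏ K λ φ → weight (τ zero) (value (drop φ) x h t)

        r : ℤ → Vec ℤ s → Vec ℤ n → ℤ → ℝ
        r x h t y = product± G x h (y ∷ t) * ∏ (allFin n) λ i → ∏ (L (suc i)) λ φ → f′ i (value φ x h (y ∷ t))

        integrand : ∀ x h t y → product± G x h (y ∷ t) * blocks f L x h (y ∷ t) ≡ u x h t * r x h t y
        integrand x h t y = trans
          (cong (product± G x h (y ∷ t) *_) (trans (∏-allFin-suc (λ i → ∏ (L i) λ φ → f i (value φ x h (y ∷ t)))) (cong (_* rest) (∏-cong-All K-hollow))))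
          (solve 3 (λ a b c → a :* (b :* c) := b :* (a :* c)) refl (product± G x h (y ∷ t)) (u x h t) rest)
          where
          rest = ∏ (allFin n) λ i → ∏ (L (suc i)) λ φ → f′ i (value φ x h (y ∷ t))
          ∏-cong-All : ∀ {K} → All (HollowAt zero) K →
                       ∏ K (λ φ → f zero (value φ x h (y ∷ t))) ≡ ∏ K (λ φ → f zero (value (drop φ) x h t))
          ∏-cong-All []                = refl
          ∏-cong-All {φ ∷ _} (p ∷ ps) = cong₂ _*_ (cong (f zero) (value-drop φ (HollowAt-zero-head p) x h y t)) (∏-cong-All ps)

        doubled : ∀ x h t y₀ y₁ → ν-u x h t * (r x h t y₀ * r x h t y₁) ≡
                  product± G′ x (y₀ ∷ y₁ ∷ h) t * blocks f′ L′ x (y₀ ∷ y₁ ∷ h) t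
        doubled x h t y₀ y₁ = sym (trans (cong₂ _*_ eqG eqL)
          (solve 5 (λ v g₀ g₁ b₀ b₁ → v :* (g₀ :* g₁) :* (b₀ :* b₁) := v :* (g₀ :* b₀ :* (g₁ :* b₁))) refl
            (ν-u x h t) (product± G x h (y₀ ∷ t)) (product± G x h (y₁ ∷ t)) (bl y₀) (bl y₁)))
          where
          h′ = y₀ ∷ y₁ ∷ h
          bl : ℤ → ℝ
          bl y = ∏ (allFin n) λ i → ∏ (L (suc i)) λ φ → f′ i (value φ x h (y ∷ t))
          val : Maybe Tag × Form (suc (suc s)) n → ℝ
          val (σ , φ) = weight± σ (value φ x h′ t)
          eqG : product± G′ x h′ t ≡ ν-u x h t * (product± G x h (y₀ ∷ t) * product± G x h (y₁ ∷ t))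
          eqG = trans (∏-++ (List.map (λ φ → just (τ zero) , keep φ) K) _ val) (cong₂ _*_
            (trans (∏-map _ K val) (∏-cong K λ φ → cong (weight (τ zero)) (value-keep φ x h y₀ y₁ t)))
            (trans (∏-++ (List.map (map₂ dbl₀) G) _ val) (cong₂ _*_
              (trans (∏-map (map₂ dbl₀) G val) (∏-cong G λ (σ , φ) → cong (weight± σ) (value-dbl₀ φ x h y₀ y₁ t)))
              (trans (∏-map (map₂ dbl₁) G val) (∏-cong G λ (σ , φ) → cong (weight± σ) (value-dbl₁ φ x h y₀ y₁ t))))))
          eqL : blocks f′ L′ x h′ t ≡ bl y₀ * bl y₁
          eqL = trans (∏-cong (allFin n) λ i → trans (∏-++ (List.map dbl₀ (L (suc i))) _ _) (cong₂ _*_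
              (trans (∏-map dbl₀ (L (suc i)) _) (∏-cong (L (suc i)) λ φ → cong (f′ i) (value-dbl₀ φ x h y₀ y₁ t)))
              (trans (∏-map dbl₁ (L (suc i)) _) (∏-cong (L (suc i)) λ φ → cong (f′ i) (value-dbl₁ φ x h y₀ y₁ t)))))
            (∏-* (allFin n) _ _)

        hs : List (Vec ℤ s × Vec ℤ n)
        hs = cartesianProductWith _,_ (grid s) (grid n)

        hs-nonEmpty : NonEmpty hs
        hs-nonEmpty = cpw-nonEmpty _,_ (grid s) (grid n) (grid-nonEmpty s) (grid-nonEmpty n)

        Ω : List (ℤ × Vec ℤ s × Vec ℤ n)
        Ω = cartesianProductWith _,_ xs hs

        𝔼-Ω : (F : ℤ → Vec ℤ s → Vec ℤ n → ℝ) → 𝔼 Ω (λ (x , h , t) → F x h t) ≡ average F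
        𝔼-Ω F = trans (𝔼-cartesianProductWith _,_ xs hs xs-nonEmpty hs-nonEmpty _)
          (𝔼-cong xs λ x → 𝔼-cartesianProductWith _,_ (grid s) (grid n) (grid-nonEmpty s) (grid-nonEmpty n) _)

        before : ℝ
        before = average λ x h t → product± G x h t * blocks f L x h t

        after : ℝ
        after = average λ x h t → product± G′ x h t * blocks f′ L′ x h t

        before-eq : before ≡ 𝔼 Ω (λ (x , h , t) → u x h t * 𝔼 ys (r x h t))
        before-eq = trans (𝔼-cong xs λ x → 𝔼-cong (grid s) λ h →
            trans (𝔼-grid-suc n _) (trans (𝔼-swap ys (grid n) _) (𝔼-cong (grid n) λ t →
              trans (𝔼-cong ys λ y → integrand x h t y) (𝔼-*ˡ ys (u x h t) (r x h t)))))
          (sym (𝔼-Ω _))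

        after-eq : 𝔼 Ω (λ (x , h , t) → ν-u x h t * (𝔼 ys (r x h t) * 𝔼 ys (r x h t))) ≡ after
        after-eq = trans (𝔼-cartesianProductWith _,_ xs hs xs-nonEmpty hs-nonEmpty _) (𝔼-cong xs λ x → begin
          𝔼 hs (λ (h , t) → ν-u x h t * (𝔼 ys (r x h t) * 𝔼 ys (r x h t)))
            ≡⟨ 𝔼-cong hs (λ (h , t) → trans (cong (ν-u x h t *_) (𝔼-*-𝔼 ys ys _ _))
                 (trans (sym (𝔼-*ˡ ys _ _)) (𝔼-cong ys λ y₀ → sym (𝔼-*ˡ ys _ _)))) ⟩
          𝔼 hs (λ (h , t) → 𝔼 ys λ y₀ → 𝔼 ys λ y₁ → ν-u x h t * (r x h t y₀ * r x h t y₁))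
            ≡⟨ 𝔼-swap hs ys _ ⟩
          𝔼 ys (λ y₀ → 𝔼 hs λ (h , t) → 𝔼 ys λ y₁ → ν-u x h t * (r x h t y₀ * r x h t y₁))
            ≡⟨ 𝔼-cong ys (λ y₀ → 𝔼-swap hs ys _) ⟩
          𝔼 ys (λ y₀ → 𝔼 ys λ y₁ → 𝔼 hs λ (h , t) → ν-u x h t * (r x h t y₀ * r x h t y₁))
            ≡⟨ 𝔼-cong ys (λ y₀ → 𝔼-cong ys λ y₁ → 𝔼-cong hs λ (h , t) → doubled x h t y₀ y₁) ⟩
          𝔼 ys (λ y₀ → 𝔼 ys λ y₁ → 𝔼 hs λ (h , t) → F x (y₀ ∷ y₁ ∷ h) t)
            ≡⟨ 𝔼-cong ys (λ y₀ → 𝔼-cong ys λ y₁ → 𝔼-cartesianProductWith _,_ (grid s) (grid n) (grid-nonEmpty s) (grid-nonEmpty n) _) ⟩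
          𝔼 ys (λ y₀ → 𝔼 ys λ y₁ → 𝔼 (grid s) λ h → 𝔼 (grid n) λ t → F x (y₀ ∷ y₁ ∷ h) t)
            ≡⟨ sym (trans (𝔼-grid-suc (suc s) _) (𝔼-cong ys λ y₀ → 𝔼-grid-suc s _)) ⟩
          𝔼 (grid (suc (suc s))) (λ h → 𝔼 (grid n) λ t → F x h t) ∎)
          where
          open ≡-Reasoning
          F : ℤ → Vec ℤ (suc (suc s)) → Vec ℤ n → ℝ
          F x h t = product± G′ x h t * blocks f′ L′ x h t

        average-ν-u≤2 : average ν-u ≤ 2#
        average-ν-u≤2 = ≤-trans (≤-reflexive (average-cong {s} {n} λ x h t → sym (∏-map _ K _)))
          (average-product≤2 F (subst (1 ℕ.≤_) (sym len) K-nonEmpty) (subst (ℕ._≤ maxForms) (sym len) K-bounded) vars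
            (subst (All OK) (sym forms) (All.map⁺ (All.map drop-OK K-hollow)))
            (subst (AllPairs _#_) (sym forms) (drop-AllPairs K-hollow K#)))
          where
          F = List.map (λ φ → τ zero , drop φ) K
          len = length-map (λ φ → τ zero , drop φ) K
          forms : List.map proj₂ F ≡ List.map drop K
          forms = sym (List.map-∘ K)

        cauchySchwarz : before * before ≤ 2# * after
        cauchySchwarz = subst₂ (λ a b → a * a ≤ 2# * b) (sym before-eq) after-eq
          (𝔼-cauchySchwarz Ω (λ (x , h , t) → u x h t) (λ (x , h , t) → 𝔼 ys (r x h t)) (λ (x , h , t) → ν-u x h t) (1≤⇒pos 1≤2)
            (λ (x , h , t) → ∣∏∣≤ K λ φ → f≤weight zero (value (drop φ) x h t))
            (≤-trans (≤-reflexive (𝔼-Ω ν-u)) average-ν-u≤2))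

      hasDifference-doubleG : ∀ {s n} τ K (G : List (Maybe Tag × Form s (suc n))) → hasDifference G ≡ true → hasDifference (doubleG τ K G) ≡ true
      hasDifference-doubleG τ K G p = left K
        where
        right : ∀ G → hasDifference G ≡ true → ∀ {X} → hasDifference (List.map (map₂ dbl₀) G ++ X) ≡ true
        right ((nothing , _) ∷ G) p = refl
        right ((just _ , _) ∷ G)  p = right G p
        left : ∀ K → hasDifference (List.map (λ φ → just τ , keep φ) K ++ (List.map (map₂ dbl₀) G ++ List.map (map₂ dbl₁) G)) ≡ true
        left []      = right G p
        left (_ ∷ K) = left K

      forms-doubleG : ∀ {s n} τ K (G : List (Maybe Tag × Form s (suc n))) →
        List.map proj₂ (doubleG τ K G) ≡ List.map keep K ++ double (List.map proj₂ G)
      forms-doubleG τ K G = trans (List.map-++ proj₂ (List.map (λ φ → just τ , keep φ) K) _) (cong₂ _++_ (sym (List.map-∘ K))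
        (trans (List.map-++ proj₂ (List.map (map₂ dbl₀) G) _) (cong₂ _++_ (commute dbl₀) (commute dbl₁))))
        where
        commute : ∀ d → List.map proj₂ (List.map (map₂ d) G) ≡ List.map d (List.map proj₂ G)
        commute d = trans (sym (List.map-∘ G)) (List.map-∘ G)

      hasDifference⇒nonEmpty : ∀ {s n} (G : List (Maybe Tag × Form s n)) → hasDifference G ≡ true → 1 ℕ.≤ length G
      hasDifference⇒nonEmpty (_ ∷ _) _ = ℕ.s≤s ℕ.z≤n

      -- `G` collects the factors that are already ν, 1_[N] or their difference; block i carries the
      -- copies of the unknown f_i. If all these lists have at most q entries, a step produces at
      -- most q + 2q in `G` and 2q in each remaining block, whence 3^n, and it trades one variable
      -- for two, whence n * 2 + s.
      generalisedVonNeumann : ∀ n {s} (G : List (Maybe Tag × Form s n)) (f : Fin n → ℤ → ℝ) (τ : Fin n → Tag) (L : Fin n → List (Form s n)) →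
        (∀ i z → ∣ f i z ∣ ≤ weight (τ i) z) →
        ∀ q → q ℕ.* 3 ℕ.^ n ℕ.≤ maxForms → n ℕ.* 2 ℕ.+ s ℕ.≤ maxVars →
        length G ℕ.≤ q → hasDifference G ≡ true → All Full (List.map proj₂ G) → AllPairs _#_ (List.map proj₂ G) →
        (∀ i → 1 ℕ.≤ length (L i)) → (∀ i → length (L i) ℕ.≤ q) → (∀ i → All (HollowAt i) (L i)) → (∀ i → AllPairs _#_ (L i)) →
        average (λ x h t → product± G x h t * blocks f L x h t) ^ (2 ℕ.^ n) ≤ 2# ^ (2 ℕ.^ n) * (2# ^ maxForms * η)
      generalisedVonNeumann zero {s} G f τ L f≤ q q≤ vars G≤q diff full G# _ _ _ _ = begin
        v * 1#                       ≈⟨ R.*-identityʳ v ⟩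
        v                            ≤⟨ x≤∣x∣ v ⟩
        ∣ v ∣                        ≤⟨ small ⟩
        2# ^ length G * η            ≤⟨ *-monoˡ-≤ 0≤η (^-monoʳ-≤ 1≤2 G≤max) ⟩
        -- The spare factor 2 gives the constant the shape 2^(2^n), which the inductive step
        -- reproduces: its own factor contributes another 2^(2^n).
        2# ^ maxForms * η            ≤⟨ ≤-by (*-nonNegative (0≤^ maxForms 0≤2) 0≤η)
                                         (solve 2 (λ z η → :2 :* :1 :* (z :* η) :- z :* η := z :* η) refl (2# ^ maxForms) η) ⟩
        2# ^ 1 * (2# ^ maxForms * η) ∎
        where
        open ≤-Reasoning
        v = average λ x h t → product± G x h t * blocks f L x h t
        G≤max : length G ℕ.≤ maxForms
        G≤max = ℕ.≤-trans G≤q (ℕ.≤-trans (ℕ.≤-reflexive (sym (ℕ.*-identityʳ q))) q≤)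
        ^-monoʳ-≤ : ∀ {x m n} → 1# ≤ x → m ℕ.≤ n → x ^ m ≤ x ^ n
        ^-monoʳ-≤ {x} {n = n} 1≤x ℕ.z≤n     = 1≤^ n 1≤x
        ^-monoʳ-≤ {x} 1≤x (ℕ.s≤s m≤n) = *-monoʳ-≤ (≤-trans 0≤1 1≤x) (^-monoʳ-≤ 1≤x m≤n)
        small : ∣ v ∣ ≤ 2# ^ length G * η
        small = subst₂ (λ b w → Small b (length G) c w) diff
          (average-cong {s} {0} λ x h t → R.*-comm 1# (product± G x h t))
          (product±-small c [] G λ Q e → subst (λ Φ → ∣ average (product Q) - average (product₁ Φ) ∣ ≤ η) e
            (linearForms Q (subst (1 ℕ.≤_) (sym (len Q e)) (hasDifference⇒nonEmpty G diff)) (subst (ℕ._≤ maxForms) (sym (len Q e)) G≤max)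
              vars (subst (All OK) (sym e) (All.map proj₁ full)) (subst (AllPairs _#_) (sym e) G#)))
          where
          c = average (product₁ (List.map proj₂ G))
          len : ∀ Q → List.map proj₂ Q ≡ List.map proj₂ G → length Q ≡ length G
          len Q e = trans (sym (length-map proj₂ Q)) (trans (cong length e) (length-map proj₂ G))
      generalisedVonNeumann (suc n) {s} G f τ L f≤ q q≤ vars G≤q diff full G# L≥1 L≤q hollow L# = begin
        before ^ (2 ℕ.* 2 ℕ.^ n)                             ≈⟨ sym (Exp.^-assocʳ before 2 (2 ℕ.^ n)) ⟩
        (before ^ 2) ^ (2 ℕ.^ n)                             ≈⟨ cong (_^ (2 ℕ.^ n)) (cong (before *_) (R.*-identityʳ before)) ⟩
        (before * before) ^ (2 ℕ.^ n)                        ≤⟨ ^-monoˡ-≤ (2 ℕ.^ n) (0≤x*x before) cauchySchwarz ⟩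
        (2# * after) ^ (2 ℕ.^ n)                             ≈⟨ Exp.^-distrib-* 2# after (2 ℕ.^ n) ⟩
        2# ^ (2 ℕ.^ n) * after ^ (2 ℕ.^ n)                   ≤⟨ *-monoʳ-≤ (0≤^ (2 ℕ.^ n) 0≤2) ih ⟩
        2# ^ (2 ℕ.^ n) * (2# ^ (2 ℕ.^ n) * Z)                ≈⟨ trans (sym (R.*-assoc _ _ _)) (cong (_* Z) (trans (sym (Exp.^-homo-* 2# (2 ℕ.^ n) (2 ℕ.^ n))) (cong (λ m → 2# ^ (2 ℕ.^ n ℕ.+ m)) (sym (ℕ.+-identityʳ (2 ℕ.^ n)))))) ⟩
        2# ^ (2 ℕ.* 2 ℕ.^ n) * Z                             ∎
        where
        open ≤-Reasoning
        Z = 2# ^ maxForms * η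
        q′≤ : q ℕ.* 3 ℕ.* 3 ℕ.^ n ℕ.≤ maxForms
        q′≤ = ℕ.≤-trans (ℕ.≤-reflexive (ℕ.*-assoc q 3 (3 ℕ.^ n))) q≤
        K≤max : length (L zero) ℕ.≤ maxForms
        K≤max = ℕ.≤-trans (L≤q zero) (ℕ.≤-trans (ℕ.m≤m*n q (3 ℕ.^ suc n) {{ℕ.m^n≢0 3 (suc n)}}) q≤)
        vars′ : n ℕ.* 2 ℕ.+ suc (suc s) ℕ.≤ maxVars
        vars′ = ℕ.≤-trans (ℕ.≤-reflexive (trans (ℕ.+-suc (n ℕ.* 2) (suc s)) (cong suc (ℕ.+-suc (n ℕ.* 2) s)))) vars
        n+s≤ : n ℕ.+ s ℕ.≤ maxVars
        n+s≤ = ℕ.≤-trans (ℕ.+-monoˡ-≤ s (ℕ.≤-trans (ℕ.m≤m*n n 2) (ℕ.≤-trans (ℕ.n≤1+n _) (ℕ.n≤1+n _)))) vars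
        open Step G f τ L f≤ (L≥1 zero) K≤max n+s≤ (hollow zero) (L# zero)
        G′≤ : length G′ ℕ.≤ q ℕ.* 3
        G′≤ = ℕ.≤-trans (ℕ.≤-reflexive (trans (length-++ (List.map (λ φ → just (τ zero) , keep φ) K))
            (cong₂ ℕ._+_ (length-map _ K) (trans (length-++ (List.map (map₂ dbl₀) G)) (cong₂ ℕ._+_ (length-map _ G) (length-map _ G))))))
          (ℕ.≤-trans (ℕ.+-mono-≤ (L≤q zero) (ℕ.+-mono-≤ G≤q G≤q)) (ℕ.≤-reflexive (trans (cong (λ z → q ℕ.+ (q ℕ.+ z)) (sym (ℕ.+-identityʳ q))) (ℕ.*-comm 3 q))))
        L′≥1 : ∀ i → 1 ℕ.≤ length (L′ i)
        L′≥1 i = ℕ.≤-trans (L≥1 (suc i)) (ℕ.≤-trans (ℕ.m≤m+n _ _) (ℕ.≤-reflexive (sym (length-double (L (suc i))))))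
        L′≤ : ∀ i → length (L′ i) ℕ.≤ q ℕ.* 3
        L′≤ i = ℕ.≤-trans (ℕ.≤-reflexive (length-double (L (suc i)))) (ℕ.≤-trans (ℕ.+-mono-≤ (L≤q (suc i)) (L≤q (suc i)))
          (ℕ.≤-trans (ℕ.+-monoʳ-≤ q (ℕ.m≤m+n q (q ℕ.+ 0))) (ℕ.≤-reflexive (ℕ.*-comm 3 q))))
        ih : after ^ (2 ℕ.^ n) ≤ 2# ^ (2 ℕ.^ n) * Z
        ih = generalisedVonNeumann n G′ f′ (τ ∘ suc) L′ (f≤ ∘ suc) (q ℕ.* 3) q′≤ vars′ G′≤
          (hasDifference-doubleG (τ zero) K G diff)
          (subst (All Full) (sym (forms-doubleG (τ zero) K G)) (All.++⁺ (All.map⁺ (All.map keep-Full (hollow zero))) (double-All dbl₀-Full dbl₁-Full full)))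
          (subst (AllPairs _#_) (sym (forms-doubleG (τ zero) K G)) (keep-double-AllPairs (hollow zero) full (L# zero) G#))
          L′≥1 L′≤
          (λ i → double-All dbl₀-HollowAt dbl₁-HollowAt (hollow (suc i)))
          (λ i → double-AllPairs (All.map HollowAt-suc-head (hollow (suc i))) (L# (suc i)))

  -- Integer parts and translation

  floorUpTo-≤ : ∀ {x} n → 0# ≤ x → fromℕ (floorUpTo x n) ≤ x
  floorUpTo-≤ zero 0≤x = 0≤x
  floorUpTo-≤ {x} (suc n) 0≤x with fromℕ (suc n) O.≤? x
  ... | yes p = p
  ... | no  _ = floorUpTo-≤ n 0≤x

  ≤-suc-floorUpTo : ∀ {x} n → x ≤ fromℕ (suc n) → x ≤ fromℕ (suc (floorUpTo x n))
  ≤-suc-floorUpTo zero p = p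
  ≤-suc-floorUpTo {x} (suc n) p with fromℕ (suc n) O.≤? x
  ... | yes _ = p
  ... | no  q = ≤-suc-floorUpTo n (≰⇒≥ q)

  floorUpTo-greatest : ∀ {x} n {m} → m ℕ.≤ n → fromℕ m ≤ x → m ℕ.≤ floorUpTo x n
  floorUpTo-greatest zero p q = p
  floorUpTo-greatest {x} (suc n) p q with fromℕ (suc n) O.≤? x
  ... | yes _ = p
  ... | no  r with ℕ.m≤n⇒m<n∨m≡n p
  ...   | inj₁ m<1+n = floorUpTo-greatest n (ℕ.s≤s⁻¹ m<1+n) q
  ...   | inj₂ refl  = ⊥-elim (r q)

  ⌊⌋-≤ : ∀ {x} → 0# ≤ x → fromℕ ⌊ x ⌋ ≤ x
  ⌊⌋-≤ {x} = floorUpTo-≤ (proj₁ (archimedean x))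

  ≤-suc-⌊⌋ : ∀ x → x ≤ fromℕ (suc ⌊ x ⌋)
  ≤-suc-⌊⌋ x = ≤-suc-floorUpTo n (≤-trans (proj₂ (archimedean x)) (fromℕ-mono (ℕ.n≤1+n n)))
    where n = proj₁ (archimedean x)

  ⌊⌋-greatest : ∀ {x m} → fromℕ m ≤ x → m ℕ.≤ ⌊ x ⌋
  ⌊⌋-greatest {x} p = floorUpTo-greatest (proj₁ (archimedean x)) (fromℕ-cancel-≤ (≤-trans p (proj₂ (archimedean x)))) p

  1≤⌊⌋ : ∀ {x} → 1# ≤ x → 1 ℕ.≤ ⌊ x ⌋
  1≤⌊⌋ p = ⌊⌋-greatest (≤-trans (≤-reflexive (R.+-identityʳ 1#)) p)

  x≤2⌊x⌋ : ∀ {x} → 1# ≤ x → x ≤ 2# * fromℕ ⌊ x ⌋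
  x≤2⌊x⌋ {x} p = ≤-trans (≤-suc-⌊⌋ x) (≤-by (x≤y⇒0≤y-x (proj₁-fromℕ (1≤⌊⌋ p)))
    (solve 1 (λ n → :2 :* n :- (:1 :+ n) := n :- :1) refl (fromℕ ⌊ x ⌋)))
    where
    proj₁-fromℕ : ∀ {n} → 1 ℕ.≤ n → 1# ≤ fromℕ n
    proj₁-fromℕ {suc n} _ = 1≤fromℕ-suc n

  allPairs-lookup : ∀ {A : Set} {_~_ : A → A → Set} → (∀ {x y} → x ~ y → y ~ x) → ∀ {xs} → AllPairs _~_ xs →
                    ∀ i j → i ≢ j → List.lookup xs i ~ List.lookup xs j
  allPairs-lookup s (p ∷ ps) zero    zero    i≢j = ⊥-elim (i≢j refl)
  allPairs-lookup s {_ ∷ xs} (p ∷ ps) zero (suc j) _ = All.lookup p (∈-lookup j)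
  allPairs-lookup s {_ ∷ xs} (p ∷ ps) (suc i) zero _ = s (All.lookup p (∈-lookup i))
  allPairs-lookup s (p ∷ ps) (suc i) (suc j) i≢j = allPairs-lookup s ps i j (i≢j ∘ cong suc)

  ∏-lookup : ∀ {A : Set} (xs : List A) (f : A → ℝ) → ∏ (allFin (length xs)) (f ∘ List.lookup xs) ≡ ∏ xs f
  ∏-lookup xs f = trans (bigOp-tabulate *-rawMonoid (λ i → i) _ (List.lookup xs) f λ _ → refl) (cong (λ z → ∏ z f) (List.tabulate-lookup xs))

  dot-++ : ∀ {m n} (l : Vec ℤ m) (c : Vec ℤ n) t h → dot (l Vec.++ c) (t Vec.++ h) ≡ dot l t ℤ.+ dot c h
  dot-++ []      c []      h = sym (ℤ.+-identityˡ _)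
  dot-++ (k ∷ l) c (y ∷ t) h = trans (cong (λ z → k ℤ.* y ℤ.+ z) (dot-++ l c t h)) (sym (ℤ.+-assoc (k ℤ.* y) (dot l t) (dot c h)))

  𝔼-singleton : ∀ {A : Set} (x : A) (f : A → ℝ) → 𝔼 (x ∷ []) f ≡ f x
  𝔼-singleton x f = 𝔼-const (x ∷ []) (ℕ.s≤s ℕ.z≤n) (f x)

  𝔼-tuples-++ : ∀ {A : Set} (ys : List A) → NonEmpty ys → ∀ m n (F : Vec A (m ℕ.+ n) → ℝ) →
    𝔼 (tuples (replicate (m ℕ.+ n) ys)) F ≡ 𝔼 (tuples (replicate m ys)) λ t → 𝔼 (tuples (replicate n ys)) λ h → F (t Vec.++ h)
  𝔼-tuples-++ {A} ys ne zero n F = sym (𝔼-singleton {Vec A 0} [] (λ t → 𝔼 (tuples (replicate n ys)) λ h → F (t Vec.++ h)))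
  𝔼-tuples-++ {A} ys ne (suc m) n F = trans (𝔼-cpw (m ℕ.+ n) F) (trans
    (𝔼-cong ys λ y → 𝔼-tuples-++ ys ne m n (F ∘ (y ∷_)))
    (sym (𝔼-cpw m _)))
    where
    𝔼-cpw : ∀ k (G : Vec A (suc k) → ℝ) → 𝔼 (tuples (replicate (suc k) ys)) G ≡ 𝔼 ys λ y → 𝔼 (tuples (replicate k ys)) λ t → G (y ∷ t)
    𝔼-cpw k G = 𝔼-cartesianProductWith _∷_ ys _ ne (tuples-nonEmpty (replicate k ys) λ i → subst NonEmpty (sym (Vec.lookup-replicate i ys)) ne) G

  -- The translates of {1, …, P} by these offsets tile {1 − A P, …, (A + 1) P}.
  offsets : (A P : ℕ) → List ℤ
  offsets A P = List.map (λ i → + (i ℕ.* P) ℤ.- + (A ℕ.* P)) (upTo (suc (A ℕ.+ A)))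

  ∑-blocks : ∀ U P (G : ℕ → ℝ) → ∑ (upTo U) (λ i → ∑ (upTo P) λ j → G (i ℕ.* P ℕ.+ j)) ≡ ∑ (upTo (U ℕ.* P)) G
  ∑-blocks zero    P G = refl
  ∑-blocks (suc U) P G = trans (∑-upTo-suc U _) (trans
    (cong (λ z → ∑ (upTo P) G + z) (trans
      (∑-cong (upTo U) λ i → ∑-cong (upTo P) λ j → cong G (ℕ.+-assoc P (i ℕ.* P) j))
      (∑-blocks U P (λ j → G (P ℕ.+ j)))))
    (sym (∑-upTo-+ P (U ℕ.* P) G)))

  module Translation (N : ℝ) (F : ℤ → ℝ) (supp : SupportedOn 0# (_∈[ N ]) F) where

    private P = ⌊ N ⌋

    -- The translates tile an interval of (2A + 1)⌊N⌋ integers. Moved by δ it still contains {1,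
    -- ..., ⌊N⌋}, outside of which F vanishes.
    ∑-translate : ∀ A (δ : ℤ) → ℤ.∣ δ ∣ ℕ.≤ A ℕ.* P →
                  ∑ (offsets A P) (λ u → ∑ [1⋯ N ] λ x → F (x ℤ.+ u ℤ.+ δ)) ≡ ∑ [1⋯ N ] F
    ∑-translate A δ δ≤ = begin
      ∑ (offsets A P) (λ u → ∑ [1⋯ N ] λ x → F (x ℤ.+ u ℤ.+ δ))
        ≡⟨ ∑-map _ (upTo (suc (A ℕ.+ A))) _ ⟩
      ∑ (upTo (suc (A ℕ.+ A))) (λ i → ∑ [1⋯ N ] λ x → F (x ℤ.+ (+ (i ℕ.* P) ℤ.- + (A ℕ.* P)) ℤ.+ δ))
        ≡⟨ ∑-cong (upTo (suc (A ℕ.+ A))) (λ i → trans (∑-run 0 P _) (∑-cong (upTo P) λ j → cong F (index i j))) ⟩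
      ∑ (upTo (suc (A ℕ.+ A))) (λ i → ∑ (upTo P) λ j → G (i ℕ.* P ℕ.+ j))
        ≡⟨ ∑-blocks (suc (A ℕ.+ A)) P G ⟩
      ∑ (upTo (suc (A ℕ.+ A) ℕ.* P)) G
        ≡⟨ cong (λ m → ∑ (upTo m) G) split ⟩
      ∑ (upTo (e ℕ.+ (P ℕ.+ r))) G
        ≡⟨ trans (∑-upTo-+ e (P ℕ.+ r) G) (cong₂ _+_ (trans (∑-cong-∈ (upTo e) below) (∑-0 (upTo e)))
             (trans (∑-cong (upTo (P ℕ.+ r)) middle) (∑-upTo-+ P r (λ i → F (+ suc i))))) ⟩
      0# + (∑ (upTo P) (λ i → F (+ suc i)) + ∑ (upTo r) (λ i → F (+ suc (P ℕ.+ i))))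
        ≡⟨ cong (λ z → 0# + (∑ (upTo P) (λ i → F (+ suc i)) + z)) (trans (∑-cong (upTo r) above) (∑-0 (upTo r))) ⟩
      0# + (∑ (upTo P) (λ i → F (+ suc i)) + 0#)
        ≡⟨ solve 1 (λ s → con (+ 0) :+ (s :+ con (+ 0)) := s) refl _ ⟩
      ∑ (upTo P) (λ i → F (+ suc i))
        ≡⟨ sym (∑-run 0 P F) ⟩
      ∑ [1⋯ N ] F ∎
      where
      open ≡-Reasoning
      AP = A ℕ.* P
      e≥0 : + 0 ℤ.≤ + AP ℤ.- δ
      e≥0 = ℤ.i≤j⇒0≤j-i (ℤ.≤-trans (i≤∣i∣ δ) (ℤ.+≤+ δ≤))
        where
        i≤∣i∣ : ∀ i → i ℤ.≤ + ℤ.∣ i ∣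
        i≤∣i∣ (+ n)    = ℤ.≤-refl
        i≤∣i∣ -[1+ n ] = ℤ.-≤+
      -- The number of places of the moved interval that precede 1; `r` places remain after ⌊N⌋.
      e = ℤ.∣ + AP ℤ.- δ ∣
      +e : + e ≡ + AP ℤ.- δ
      +e = ℤ.0≤i⇒+∣i∣≡i e≥0
      e≤ : e ℕ.≤ AP ℕ.+ AP
      e≤ = ℕ.≤-trans (ℤ.∣i-j∣≤∣i∣+∣j∣ (+ AP) δ) (ℕ.+-monoʳ-≤ AP δ≤)
      r = AP ℕ.+ AP ℕ.∸ e
      G : ℕ → ℝ
      G j = F (+ suc j ℤ.- + e)
      split : suc (A ℕ.+ A) ℕ.* P ≡ e ℕ.+ (P ℕ.+ r)
      split = trans (cong (P ℕ.+_) (ℕ.*-distribʳ-+ P A A)) (trans (cong (P ℕ.+_) (sym (ℕ.m+[n∸m]≡n e≤)))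
        (trans (sym (ℕ.+-assoc P e r)) (trans (cong (ℕ._+ r) (ℕ.+-comm P e)) (ℕ.+-assoc e P r))))
      index : ∀ i j → + suc j ℤ.+ (+ (i ℕ.* P) ℤ.- + AP) ℤ.+ δ ≡ + suc (i ℕ.* P ℕ.+ j) ℤ.- + e
      index i j = trans (ℤS.solve 4 (λ j i a d → j ℤS.:+ (i ℤS.:- a) ℤS.:+ d ℤS.:= i ℤS.:+ j ℤS.:- (a ℤS.:- d)) refl (+ suc j) (+ (i ℕ.* P)) (+ AP) δ)
        (cong₂ ℤ._-_ (cong +_ (ℕ.+-suc (i ℕ.* P) j)) (sym +e))
      below : ∀ j → j ∈ upTo e → G j ≡ 0#
      below j j∈ = supp _ λ (1≤ , _) → ℕ.<-irrefl refl (ℕ.≤-trans (lemma 1≤) (∈-upTo⁻ j∈))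
        where
        lemma : + 1 ℤ.≤ + suc j ℤ.- + e → suc e ℕ.≤ suc j
        lemma p = ℤ.drop‿+≤+ (ℤ.≤-trans (ℤ.+-monoˡ-≤ (+ e) p) (ℤ.≤-reflexive (ℤS.solve 2 (λ a b → a ℤS.:- b ℤS.:+ b ℤS.:= a) refl (+ suc j) (+ e))))
      middle : ∀ i → G (e ℕ.+ i) ≡ F (+ suc i)
      middle i = cong F (trans (cong (λ z → + z ℤ.- + e) (sym (ℕ.+-suc e i)))
        (ℤS.solve 2 (λ a b → a ℤS.:+ b ℤS.:- a ℤS.:= b) refl (+ e) (+ suc i)))
      above : ∀ i → F (+ suc (P ℕ.+ i)) ≡ 0#
      above i = supp _ λ (_ , ≤P) → ℕ.<-irrefl refl (ℕ.≤-trans (ℕ.s≤s (ℕ.m≤m+n P i)) (ℤ.drop‿+≤+ ≤P))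

    window : ℕ → List ℤ
    window A = cartesianProductWith (λ u x → x ℤ.+ u) (offsets A P) [1⋯ N ]

    -- The window does not depend on δ. Thus δ may later vary with the variables t, and the averages
    -- over t and over the window can be interchanged.
    𝔼-translate : 1 ℕ.≤ P → ∀ A (δ : ℤ) → ℤ.∣ δ ∣ ℕ.≤ A ℕ.* P →
                  𝔼 [1⋯ N ] F ≡ fromℕ (suc (A ℕ.+ A)) * 𝔼 (window A) (λ x → F (x ℤ.+ δ))
    𝔼-translate 1≤P A δ δ≤ = sym (begin
      U * 𝔼 (window A) (λ x → F (x ℤ.+ δ))
        ≡⟨ cong (U *_) (𝔼-cartesianProductWith _ us [1⋯ N ] us-nonEmpty (run-nonEmpty {0} 1≤P) _) ⟩
      U * (∑ us (λ u → ∑ [1⋯ N ] (λ x → F (x ℤ.+ u ℤ.+ δ)) / len) / fromℕ (length us))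
        ≡⟨ cong (λ z → U * (z / fromℕ (length us))) (trans (∑-*ʳ us _ _) (cong (_/ len) (∑-translate A δ δ≤))) ⟩
      U * (∑ [1⋯ N ] F / len / fromℕ (length us))
        ≡⟨ cong (λ n → U * (∑ [1⋯ N ] F / len / fromℕ n)) length-us ⟩
      U * (∑ [1⋯ N ] F / len / U)
        ≡⟨ trans (R.*-comm U _) (/-cancel (fromℕ-pos {suc (A ℕ.+ A)} (ℕ.s≤s ℕ.z≤n))) ⟩
      𝔼 [1⋯ N ] F ∎)
      where
      open ≡-Reasoning
      us = offsets A P
      U = fromℕ (suc (A ℕ.+ A))
      len = fromℕ (length [1⋯ N ])
      length-us : length us ≡ suc (A ℕ.+ A)
      length-us = trans (length-map _ (upTo (suc (A ℕ.+ A)))) (length-upTo (suc (A ℕ.+ A)))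
      us-nonEmpty : NonEmpty us
      us-nonEmpty = subst (1 ℕ.≤_) (sym length-us) (ℕ.s≤s ℕ.z≤n)

  -- Smoothing an average over an interval

  𝟙-values : ∀ N z → (z ∈[ N ] × 𝟙[ N ] z ≡ 1#) ⊎ (¬ z ∈[ N ] × 𝟙[ N ] z ≡ 0#)
  𝟙-values N z with + 1 ℤ.≤? z | z ℤ.≤? + ⌊ N ⌋
  ... | yes p | yes q = inj₁ ((p , q) , refl)
  ... | yes _ | no q  = inj₂ (q ∘ proj₂ , refl)
  ... | no p  | yes _ = inj₂ (p ∘ proj₁ , refl)
  ... | no p  | no _  = inj₂ (p ∘ proj₁ , refl)

  0≤𝟙 : ∀ N z → 0# ≤ 𝟙[ N ] z
  0≤𝟙 N z with 𝟙-values N z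
  ... | inj₁ (_ , e) = ≤-trans 0≤1 (≤-reflexive (sym e))
  ... | inj₂ (_ , e) = ≤-reflexive (sym e)

  𝟙≤1 : ∀ N z → 𝟙[ N ] z ≤ 1#
  𝟙≤1 N z with 𝟙-values N z
  ... | inj₁ (_ , e) = ≤-reflexive e
  ... | inj₂ (_ , e) = ≤-trans (≤-reflexive e) 0≤1

  𝟙-supp : ∀ N → SupportedOn 0# (_∈[ N ]) 𝟙[ N ]
  𝟙-supp N z z∉ with 𝟙-values N z
  ... | inj₁ (z∈ , _) = ⊥-elim (z∉ z∈)
  ... | inj₂ (_ , e)  = e

  ∣∣-fromℕ-+ : ∀ i j {a b} → fromℕ ℤ.∣ i ∣ ≤ a → fromℕ ℤ.∣ j ∣ ≤ b → fromℕ ℤ.∣ i ℤ.+ j ∣ ≤ a + b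
  ∣∣-fromℕ-+ i j p q = ≤-trans (fromℕ-mono (ℤ.∣i+j∣≤∣i∣+∣j∣ i j)) (≤-trans (≤-reflexive (fromℕ-+ ℤ.∣ i ∣ ℤ.∣ j ∣)) (+-mono-≤ p q))

  ∣∣-fromℕ-* : ∀ i j {a b} → fromℕ ℤ.∣ i ∣ ≤ a → fromℕ ℤ.∣ j ∣ ≤ b → fromℕ ℤ.∣ i ℤ.* j ∣ ≤ a * b
  ∣∣-fromℕ-* i j p q = ≤-trans (≤-reflexive (trans (cong fromℕ (ℤ.abs-* i j)) (fromℕ-* ℤ.∣ i ∣ ℤ.∣ j ∣)))
    (*-mono-≤ (≤-trans (0≤fromℕ ℤ.∣ i ∣) p) (0≤fromℕ ℤ.∣ j ∣) p q)

  ∣dot∣≤ : ∀ {n r m} (c h : Vec ℤ n) → VecAll.All (λ z → fromℕ ℤ.∣ z ∣ ≤ r) c → VecAll.All (λ z → fromℕ ℤ.∣ z ∣ ≤ m) h →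
           fromℕ ℤ.∣ dot c h ∣ ≤ fromℕ n * (r * m)
  ∣dot∣≤ []      []      []       []       = ≤-reflexive (sym (R.zeroˡ _))
  ∣dot∣≤ {suc n} {r} {m} (k ∷ c) (y ∷ h) (p ∷ ps) (q ∷ qs) = ≤-trans
    (∣∣-fromℕ-+ (k ℤ.* y) (dot c h) (∣∣-fromℕ-* k y p q) (∣dot∣≤ c h ps qs))
    (≤-reflexive (solve 2 (λ n z → z :+ n :* z := (:1 :+ n) :* z) refl (fromℕ n) (r * m)))

  _⊕_ : ∀ {n} → Vec ℤ n → Vec ℤ n → Vec ℤ n
  _⊕_ = Vec.zipWith ℤ._+_

  dot-⊕ : ∀ {n} (c e h : Vec ℤ n) → dot (c ⊕ e) h ≡ dot c h ℤ.+ dot e h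
  dot-⊕ []      []      []      = refl
  dot-⊕ (k ∷ c) (j ∷ e) (y ∷ h) = trans (cong (λ z → (k ℤ.+ j) ℤ.* y ℤ.+ z) (dot-⊕ c e h))
    (ℤS.solve 5 (λ k j y u v → (k ℤS.:+ j) ℤS.:* y ℤS.:+ (u ℤS.:+ v) ℤS.:= k ℤS.:* y ℤS.:+ u ℤS.:+ (j ℤS.:* y ℤS.:+ v)) refl k j y (dot c h) (dot e h))

  tuples-∈ : ∀ {A : Set} {P : A → Set} {n} (xs : List A) → (∀ x → x ∈ xs → P x) → ∀ t → t ∈ tuples (replicate n xs) → VecAll.All P t
  tuples-∈ {n = zero} xs p [] _ = []
  tuples-∈ {n = suc n} xs p t t∈ with ∈-cartesianProductWith⁻ _∷_ xs (tuples (replicate n xs)) t∈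
  ... | y , t′ , y∈ , t′∈ , refl = p y y∈ ∷ tuples-∈ xs p t′ t′∈

  ∈-run : ∀ {a n z} → z ∈ run a n → ∃ λ i → i ℕ.< n × z ≡ + (a ℕ.+ suc i)
  ∈-run {a} {n} z∈ with ∈-map⁻ _ z∈
  ... | i , i∈ , refl = i , ∈-upTo⁻ i∈ , refl

  ^-abs : ∀ v n → ∣ v ∣ ^ (2 ℕ.^ suc n) ≡ v ^ (2 ℕ.^ suc n)
  ^-abs v n = trans (sym (Exp.^-assocʳ ∣ v ∣ 2 (2 ℕ.^ n))) (trans (cong (_^ (2 ℕ.^ n)) square) (Exp.^-assocʳ v 2 (2 ℕ.^ n)))
    where
    square : ∣ v ∣ ^ 2 ≡ v ^ 2
    square with ⊔-sel v (- v)
    ... | inj₁ e = cong (_^ 2) e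
    ... | inj₂ e = trans (cong (_^ 2) e) (solve 1 (λ v → (:- v) :^ 2 := v :^ 2) refl v)

  𝔼-grid-∷ : ∀ {A : Set} (ys : List A) → NonEmpty ys → ∀ n (F : Vec A (suc n) → ℝ) →
             𝔼 (tuples (replicate (suc n) ys)) F ≡ 𝔼 ys λ y → 𝔼 (tuples (replicate n ys)) λ t → F (y ∷ t)
  𝔼-grid-∷ ys ne n F = 𝔼-cartesianProductWith _∷_ ys _ ne (tuples-nonEmpty (replicate n ys) λ i → subst NonEmpty (sym (Vec.lookup-replicate i ys)) ne) F

  total : ∀ {n} → Vec ℤ n → ℤ
  total = Vec.foldr _ ℤ._+_ (+ 0)

  dot-replicate : ∀ {n} c (t : Vec ℤ n) → dot (replicate n c) t ≡ c ℤ.* total t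
  dot-replicate c []      = sym (ℤ.*-zeroʳ c)
  dot-replicate c (y ∷ t) = trans (cong (λ z → c ℤ.* y ℤ.+ z) (dot-replicate c t)) (sym (ℤ.*-distribˡ-+ c y (total t)))

  total-run : ∀ {n T} (t : Vec ℤ n) → VecAll.All (λ y → ∃ λ i → i ℕ.< T × y ≡ + suc i) t → ∃ λ m → m ℕ.≤ n ℕ.* T × total t ≡ + m
  total-run []      []                   = 0 , ℕ.z≤n , refl
  total-run (_ ∷ t) ((i , i< , refl) ∷ p) with total-run t p
  ... | m , m≤ , e = suc i ℕ.+ m , ℕ.+-mono-≤ i< m≤ , cong (λ z → + suc i ℤ.+ z) e

  -- Replacing m by m + t in an average over m changes only two boundary runs of length t.
  module Smoothing (H T : ℕ) (1≤H : 1 ℕ.≤ H) (1≤T : 1 ℕ.≤ T) (T≤H : T ℕ.≤ H) (φ φ⁺ : ℤ → ℝ) (φ≤φ⁺ : ∀ m → ∣ φ m ∣ ≤ φ⁺ m) where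

    0≤φ⁺ : ∀ m → 0# ≤ φ⁺ m
    0≤φ⁺ m = ≤-trans (0≤∣x∣ _) (φ≤φ⁺ m)

    runSum : (ℤ → ℝ) → ℕ → ℕ → ℝ
    runSum ψ c n = ∑ (run 0 n) λ m → ψ (+ c ℤ.+ m)

    runSum-split : ∀ ψ c m n → runSum ψ c (m ℕ.+ n) ≡ runSum ψ c m + runSum ψ (c ℕ.+ m) n
    runSum-split ψ c m n = trans (run-+ 0 m n _) (cong (λ z → runSum ψ c m + z)
      (trans (∑-run m n _) (trans (∑-cong (upTo n) λ i → cong (λ k → ψ (+ k)) (sym (ℕ.+-assoc c m (suc i)))) (sym (∑-run 0 n _)))))

    -- Both windows are completed to the same run of length H + j starting after c.
    runSum-shift : ∀ c j → runSum φ c H - runSum φ (c ℕ.+ j) H ≡ runSum φ c j - runSum φ (c ℕ.+ H) j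
    runSum-shift c j = trans (solve 4 (λ a b e f → a :- b := a :+ f :- (e :+ b) :+ (e :- f)) refl (runSum φ c H) (runSum φ (c ℕ.+ j) H) (runSum φ c j) (runSum φ (c ℕ.+ H) j))
      (trans (cong (λ z → z + (runSum φ c j - runSum φ (c ℕ.+ H) j)) (trans (cong (_- (runSum φ c j + runSum φ (c ℕ.+ j) H)) same) (R.-‿inverseʳ _))) (R.+-identityˡ _))
      where
      same : runSum φ c H + runSum φ (c ℕ.+ H) j ≡ runSum φ c j + runSum φ (c ℕ.+ j) H
      same = trans (sym (runSum-split φ c H j)) (trans (cong (runSum φ c) (ℕ.+-comm H j)) (runSum-split φ c j H))

    ∣runSum∣≤ : ∀ c j → j ℕ.≤ T → ∣ runSum φ c j ∣ ≤ runSum φ⁺ c T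
    ∣runSum∣≤ c j j≤T = ≤-trans (∣∑∣≤ (run 0 j) _) (≤-trans (∑-mono (run 0 j) λ m → φ≤φ⁺ _)
      (≤-trans (x≤x+y (∑-nonNegative (run 0 (T ℕ.∸ j)) λ m → 0≤φ⁺ (+ (c ℕ.+ j) ℤ.+ m))) (≤-reflexive
        (trans (sym (runSum-split φ⁺ c j (T ℕ.∸ j))) (cong (runSum φ⁺ c) (ℕ.m+[n∸m]≡n j≤T))))))

    mean : (ℤ → ℝ) → ℕ → ℝ
    mean ψ c = 𝔼 (run 0 H) λ m → ψ (+ c ℤ.+ m)

    module _ (β : ℝ) (0≤β : 0# ≤ β) where

      ε : ℝ
      ε = 2# * β * (fromℕ T / fromℕ H)

      0≤ε : 0# ≤ ε
      0≤ε = *-nonNegative (*-nonNegative 0≤2 0≤β) (*-nonNegative (0≤fromℕ T) (proj₁ (⁻¹-pos (fromℕ-pos 1≤H))))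

      -- A bound on the mean, because the majorant has no useful pointwise bound. Only runs of the
      -- full length T occur, long enough for the linear forms condition; `∣runSum∣≤` enlarges
      -- shorter runs by nonnegativity.
      Boundary : ℕ → Set
      Boundary c = 𝔼 (run 0 T) (λ m → φ⁺ (+ c ℤ.+ m)) ≤ β

      runSum-T : ∀ {c} → Boundary c → runSum φ⁺ c T ≤ fromℕ T * β
      runSum-T {c} p = ≤-trans (≤-reflexive (trans (sym (/-cancel (fromℕ-pos 1≤T)))
          (cong (_* fromℕ T) (cong (λ n → runSum φ⁺ c T / fromℕ n) (sym (length-run 0 T))))))
        (≤-trans (*-monoˡ-≤ (0≤fromℕ T) p) (≤-reflexive (R.*-comm β _)))

      mean-shift : ∀ c j → j ℕ.≤ T → Boundary c → Boundary (c ℕ.+ H) → ∣ mean φ c - mean φ (c ℕ.+ j) ∣ ≤ ε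
      mean-shift c j j≤T p q = ≤-trans (≤-reflexive (cong ∣_∣ eq)) (≤-trans (∣x*y∣≤ bound (≤-reflexive (∣x∣≡x (proj₁ (⁻¹-pos (fromℕ-pos 1≤H))))))
        (≤-reflexive (solve 3 (λ t b h → (t :* b :+ t :* b) :* h := :2 :* b :* (t :* h)) refl (fromℕ T) β (fromℕ H ⁻¹))))
        where
        eq : mean φ c - mean φ (c ℕ.+ j) ≡ (runSum φ c j - runSum φ (c ℕ.+ H) j) * fromℕ H ⁻¹
        eq = trans (cong (λ n → runSum φ c H / fromℕ n - runSum φ (c ℕ.+ j) H / fromℕ n) (length-run 0 H))
          (trans (solve 3 (λ a b h → a :* h :- b :* h := (a :- b) :* h) refl (runSum φ c H) (runSum φ (c ℕ.+ j) H) (fromℕ H ⁻¹)) (cong (_* fromℕ H ⁻¹) (runSum-shift c j)))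
        bound : ∣ runSum φ c j - runSum φ (c ℕ.+ H) j ∣ ≤ fromℕ T * β + fromℕ T * β
        bound = ≤-trans (∣x+y∣≤ _ _) (+-mono-≤ (≤-trans (∣runSum∣≤ c j j≤T) (runSum-T p))
          (≤-trans (≤-reflexive (∣-x∣≡∣x∣ _)) (≤-trans (∣runSum∣≤ (c ℕ.+ H) j j≤T) (runSum-T q))))

      -- Telescopes over the coordinates of t. Each moves the start of the window by at most T ≤ H
      -- and costs ε, looking at the runs after the current start and H further on; n shifts thus
      -- meet starts up to c + n H.
      smoothing : ∀ n c → (∀ c′ → c′ ℕ.≤ c ℕ.+ n ℕ.* H → Boundary c′) →
        ∣ mean φ c - 𝔼 (tuples (replicate n (run 0 T))) (λ t → 𝔼 (run 0 H) λ m → φ (+ c ℤ.+ total t ℤ.+ m)) ∣ ≤ fromℕ n * ε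
      smoothing zero c _ = ≤-reflexive (trans (cong (λ z → ∣ mean φ c - z ∣) (trans
          (𝔼-singleton {Vec ℤ 0} [] λ t → 𝔼 (run 0 H) λ m → φ (+ c ℤ.+ total t ℤ.+ m))
          (𝔼-cong (run 0 H) λ m → cong (λ z → φ (z ℤ.+ m)) (ℤ.+-identityʳ (+ c)))))
        (trans (cong ∣_∣ (R.-‿inverseʳ (mean φ c))) (trans (∣x∣≡x ≤-refl) (sym (R.zeroˡ ε)))))
      smoothing (suc n) c boundary = ≤-trans (≤-reflexive (cong ∣_∣ (trans (cong (λ z → mean φ c - z) split)
          (trans (cong (_- 𝔼 ys G) (sym (𝔼-const ys ys≥1 (mean φ c)))) (sym (𝔼-- ys _ _))))))
        (∣𝔼∣≤ ys ys≥1 step)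
        where
        ys = run 0 T
        ys≥1 = run-nonEmpty {0} 1≤T
        G : ℤ → ℝ
        G y = 𝔼 (tuples (replicate n ys)) λ t → 𝔼 (run 0 H) λ m → φ (+ c ℤ.+ (y ℤ.+ total t) ℤ.+ m)
        split : 𝔼 (tuples (replicate (suc n) ys)) (λ t → 𝔼 (run 0 H) λ m → φ (+ c ℤ.+ total t ℤ.+ m)) ≡ 𝔼 ys G
        split = 𝔼-grid-∷ ys ys≥1 n λ t → 𝔼 (run 0 H) λ m → φ (+ c ℤ.+ total t ℤ.+ m)
        step : ∀ y → y ∈ ys → ∣ mean φ c - G y ∣ ≤ fromℕ (suc n) * ε
        step y y∈ with ∈-run {0} y∈
        ... | i , i<T , refl = ≤-trans (≤-reflexive (cong ∣_∣ (trans
            (solve 3 (λ a b g → a :- g := (a :- b) :+ (b :- g)) refl (mean φ c) (mean φ (c ℕ.+ suc i)) (G (+ suc i)))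
            (cong (λ z → (mean φ c - mean φ (c ℕ.+ suc i)) + (mean φ (c ℕ.+ suc i) - z)) (𝔼-cong (tuples (replicate n ys)) λ t → 𝔼-cong (run 0 H) λ m →
              cong (λ z → φ (z ℤ.+ m)) (sym (ℤ.+-assoc (+ c) (+ suc i) (total t))))))))
          (≤-trans (∣x+y∣≤ _ _) (≤-trans (+-mono-≤
            (mean-shift c (suc i) i<T (boundary c (ℕ.m≤m+n c _)) (boundary (c ℕ.+ H) (ℕ.+-monoʳ-≤ c (ℕ.m≤m+n H (n ℕ.* H)))))
            (smoothing n (c ℕ.+ suc i) λ c′ c′≤ → boundary c′ (ℕ.≤-trans c′≤ (ℕ.≤-trans
              (ℕ.≤-reflexive (ℕ.+-assoc c (suc i) (n ℕ.* H))) (ℕ.+-monoʳ-≤ c (ℕ.+-monoˡ-≤ (n ℕ.* H) (ℕ.≤-trans i<T T≤H)))))))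
            (≤-reflexive (solve 2 (λ n e → e :+ n :* e := (:1 :+ n) :* e) refl (fromℕ n) ε))))

  ∏-allFin-⊎ : ∀ m n (G : Fin m ⊎ Fin n → ℝ) →
    ∏ (allFin (m ℕ.+ n)) (G ∘ Fin.splitAt m) ≡ ∏ (allFin m) (G ∘ inj₁) * ∏ (allFin n) (G ∘ inj₂)
  ∏-allFin-⊎ zero    n G = sym (R.*-identityˡ _)
  ∏-allFin-⊎ (suc m) n G = trans (∏-allFin-suc (G ∘ Fin.splitAt (suc m))) (trans
    (cong (λ z → G (inj₁ zero) * z) (trans (∏-cong (allFin (m ℕ.+ n)) λ k → eq k) (∏-allFin-⊎ m n G′)))
    (trans (sym (R.*-assoc _ _ _)) (cong (_* ∏ (allFin n) (G ∘ inj₂)) (sym (∏-allFin-suc (G ∘ inj₁))))))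
    where
    G′ : Fin m ⊎ Fin n → ℝ
    G′ (inj₁ i) = G (inj₁ (suc i))
    G′ (inj₂ j) = G (inj₂ j)
    eq : ∀ k → G (Fin.splitAt (suc m) (suc k)) ≡ G′ (Fin.splitAt m k)
    eq k with Fin.splitAt m k
    ... | inj₁ _ = refl
    ... | inj₂ _ = refl

  lookup⇒Hollow : ∀ {n} (k : Fin n) l → lookup l k ≡ + 0 → (∀ j → j ≢ k → lookup l j ≢ + 0) → Hollow k l
  lookup⇒Hollow zero    (_ ∷ l) e p = e , VecAll.lookup⁻ λ j → p (suc j) λ ()
  lookup⇒Hollow (suc k) (_ ∷ l) e p = p zero (λ ()) , lookup⇒Hollow k l e λ j j≢k → p (suc j) (j≢k ∘ Fin.suc-injective)

  -- Exactly what makes the coefficients b_i and b_i - b_j nonzero that arise from the substitution.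
  NonDegenerate : ∀ {d} → Vec ℤ d → Set
  NonDegenerate b = (∀ i → lookup b i ≢ + 0) × (∀ i j → i ≢ j → lookup b i ≢ lookup b j)

  -- Complex numbers

  x≤0⇒x≡0 : ∀ {x} → 0# ≤ x → x ≤ 0# → x ≡ 0#
  x≤0⇒x≡0 p q = ≤-antisym q p

  -- If s * s > y the set of candidates is bounded by the smaller s − (s * s − y) / (2 s);
  -- if s * s < y it contains the larger s + (y − s * s) / (2 s + 1 + y).
  √-square : ∀ y → 0# ≤ y → √ y * √ y ≡ y
  √-square y 0≤y = ≤-antisym s²≤y y≤s²
    where
    s = √ y
    y⊔0≡y : y ⊔ 0# ≡ y
    y⊔0≡y = ≤-antisym (⊔-lub ≤-refl 0≤y) (x≤x⊔y y 0#)
    0≤s : 0# ≤ s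
    0≤s = ^1/-nonNegative 2 y
    upper : ∀ t → 0# ≤ t → t * t ≤ y → t ≤ s
    upper t 0≤t p = ≤-^1/ 2 0≤t (≤-trans (≤-reflexive (cong (t *_) (R.*-identityʳ t))) p)
    least : ∀ u → (∀ t → 0# ≤ t → t * t ≤ y → t ≤ u) → s ≤ u
    least u ub = proj₂ (proj₂ (rootSet-sup 2 y)) u λ t (0≤t , p) →
      ub t 0≤t (≤-trans (≤-reflexive (cong (t *_) (sym (R.*-identityʳ t)))) (≤-trans p (≤-reflexive y⊔0≡y)))
    δ≡0⇒ : ∀ {e δ c} → e ≡ δ * c → δ ≡ 0# → e ≤ 0#
    δ≡0⇒ refl refl = ≤-reflexive (R.zeroˡ _)
    s²≤y : s * s ≤ y
    s²≤y with ≤-total (s * s) y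
    ... | inj₁ p = p
    ... | inj₂ y≤s² with s O.≟ 0#
    ...   | yes s≡0 = ≤-trans (≤-reflexive (trans (cong₂ _*_ s≡0 s≡0) (R.zeroˡ 0#))) 0≤y
    ...   | no s≢0 = ≤-by (x≤y⇒0≤y-x (δ≡0⇒ (sym cancel) δ≡0)) (solve 2 (λ a b → b :- a := con (+ 0) :- (a :- b)) refl (s * s) y)
      where
      c = 2# * s
      c>0 : Positive c
      c>0 = *-pos (1≤⇒pos 1≤2) (0≤s , s≢0)
      δ = (s * s - y) / c
      0≤δ : 0# ≤ δ
      0≤δ = *-nonNegative (x≤y⇒0≤y-x y≤s²) (proj₁ (⁻¹-pos c>0))
      cancel : δ * c ≡ s * s - y
      cancel = /-cancel c>0
      u = s - δ
      δ≤s : δ ≤ s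
      δ≤s = x≤a*y⇒x/y≤a c>0 (≤-by (+-nonNegative 0≤y (0≤x*x s)) (solve 2 (λ s y → s :* (:2 :* s) :- (s :* s :- y) := y :+ s :* s) refl s y))
      y≤u² : y ≤ u * u
      y≤u² = ≤-by (0≤x*x δ) (trans (solve 3 (λ s δ y → (s :- δ) :* (s :- δ) :- y := (s :* s :- y) :- δ :* (:2 :* s) :+ δ :* δ) refl s δ y)
        (trans (cong (λ z → (s * s - y) - z + δ * δ) cancel) (solve 2 (λ a d → a :- a :+ d :* d := d :* d) refl (s * s - y) δ)))
      δ≡0 : δ ≡ 0#
      δ≡0 = x≤0⇒x≡0 0≤δ (≤-by (x≤y⇒0≤y-x (least u λ t 0≤t t²≤y → x*x≤y*y⇒x≤y (x≤y⇒0≤y-x δ≤s) (≤-trans t²≤y y≤u²)))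
        (solve 2 (λ s δ → con (+ 0) :- δ := s :- δ :- s) refl s δ))
    y≤s² : y ≤ s * s
    y≤s² with ≤-total y (s * s)
    ... | inj₁ p = p
    ... | inj₂ s²≤y = ≤-by (x≤y⇒0≤y-x (δ≡0⇒ (sym cancel) δ≡0)) (solve 2 (λ a b → b :- a := con (+ 0) :- (a :- b)) refl y (s * s))
      where
      c = 2# * s + 1# + y
      c>0 : Positive c
      c>0 = 1≤⇒pos (≤-by (+-nonNegative (*-nonNegative 0≤2 0≤s) 0≤y) (solve 2 (λ s y → :2 :* s :+ :1 :+ y :- :1 := :2 :* s :+ y) refl s y))
      δ = (y - s * s) / c
      0≤δ : 0# ≤ δ
      0≤δ = *-nonNegative (x≤y⇒0≤y-x s²≤y) (proj₁ (⁻¹-pos c>0))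
      cancel : δ * c ≡ y - s * s
      cancel = /-cancel c>0
      δ≤1 : δ ≤ 1#
      δ≤1 = x≤a*y⇒x/y≤a c>0 (≤-by (+-nonNegative (*-nonNegative 0≤2 0≤s) (+-nonNegative 0≤1 (0≤x*x s)))
        (solve 2 (λ s y → :1 :* (:2 :* s :+ :1 :+ y) :- (y :- s :* s) := :2 :* s :+ (:1 :+ s :* s)) refl s y))
      t²≤y : (s + δ) * (s + δ) ≤ y
      t²≤y = ≤-by (+-nonNegative (*-nonNegative 0≤δ (x≤y⇒0≤y-x δ≤1)) (*-nonNegative 0≤δ 0≤y))
        (trans (solve 3 (λ s δ y → y :- (s :+ δ) :* (s :+ δ) := (y :- s :* s) :- δ :* (:2 :* s :+ :1 :+ y) :+ (δ :* (:1 :- δ) :+ δ :* y)) refl s δ y)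
        (trans (cong (λ z → (y - s * s) - z + (δ * (1# - δ) + δ * y)) cancel) (solve 2 (λ a b → a :- a :+ b := b) refl (y - s * s) (δ * (1# - δ) + δ * y))))
      δ≡0 : δ ≡ 0#
      δ≡0 = x≤0⇒x≡0 0≤δ (≤-by (x≤y⇒0≤y-x (upper (s + δ) (+-nonNegative 0≤s 0≤δ) t²≤y)) (solve 2 (λ s δ → con (+ 0) :- δ := s :- (s :+ δ)) refl s δ))

  normSq : ℂ → ℝ
  normSq z = re z * re z + im z * im z

  0≤normSq : ∀ z → 0# ≤ normSq z
  0≤normSq z = +-nonNegative (0≤x*x (re z)) (0≤x*x (im z))

  0≤∣∣ℂ : ∀ z → 0# ≤ ∣ z ∣ℂ
  0≤∣∣ℂ z = ^1/-nonNegative 2 (normSq z)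

  ∣∣ℂ-square : ∀ z → ∣ z ∣ℂ * ∣ z ∣ℂ ≡ normSq z
  ∣∣ℂ-square z = √-square (normSq z) (0≤normSq z)

  ∣∣ℂ^2 : ∀ z → ∣ z ∣ℂ ^ 2 ≡ normSq z
  ∣∣ℂ^2 z = trans (cong (∣ z ∣ℂ *_) (R.*-identityʳ _)) (∣∣ℂ-square z)

  ∣x∣²≡x² : ∀ x → ∣ x ∣ * ∣ x ∣ ≡ x * x
  ∣x∣²≡x² x with ⊔-sel x (- x)
  ... | inj₁ e = cong₂ _*_ e e
  ... | inj₂ e = trans (cong₂ _*_ e e) (solve 1 (λ x → (:- x) :* (:- x) := x :* x) refl x)

  infix 4 _⊑_
  -- The bound |z| ≤ r in polynomial form, so that sums and products are handled by ring identities
  -- without touching the square root.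
  _⊑_ : ℂ → ℝ → Set
  z ⊑ r = 0# ≤ r × normSq z ≤ r * r

  ∣∣ℂ≤⇒⊑ : ∀ z {r} → ∣ z ∣ℂ ≤ r → z ⊑ r
  ∣∣ℂ≤⇒⊑ z p = ≤-trans (0≤∣∣ℂ z) p , ≤-trans (≤-reflexive (sym (∣∣ℂ-square z))) (*-mono-≤ (≤-trans (0≤∣∣ℂ z) p) (0≤∣∣ℂ z) p p)

  ⊑⇒∣∣ℂ≤ : ∀ z {r} → z ⊑ r → ∣ z ∣ℂ ≤ r
  ⊑⇒∣∣ℂ≤ z (0≤r , p) = x*x≤y*y⇒x≤y 0≤r (≤-trans (≤-reflexive (∣∣ℂ-square z)) p)

  ⊑⇒∣re∣≤ : ∀ z {r} → z ⊑ r → ∣ re z ∣ ≤ r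
  ⊑⇒∣re∣≤ z (0≤r , p) = x*x≤y*y⇒x≤y 0≤r (≤-trans (≤-reflexive (∣x∣²≡x² (re z))) (≤-trans (x≤x+y (0≤x*x (im z))) p))

  ⊑⇒∣im∣≤ : ∀ z {r} → z ⊑ r → ∣ im z ∣ ≤ r
  ⊑⇒∣im∣≤ z (0≤r , p) = x*x≤y*y⇒x≤y 0≤r (≤-trans (≤-reflexive (∣x∣²≡x² (im z))) (≤-trans (x≤y+x (0≤x*x (re z))) p))

  ⊑-+ : ∀ z w {r s} → z ⊑ r → w ⊑ s → z +ℂ w ⊑ r + s
  ⊑-+ z w {r} {s} (0≤r , p) (0≤s , q) = +-nonNegative 0≤r 0≤s ,
    ≤-by (+-nonNegative (x≤y⇒0≤y-x p) (+-nonNegative (x≤y⇒0≤y-x q) (*-nonNegative 0≤2 (x≤y⇒0≤y-x cross))))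
      (solve 6 (λ a b c d r s → (r :+ s) :* (r :+ s) :- ((a :+ c) :* (a :+ c) :+ (b :+ d) :* (b :+ d)) :=
        (r :* r :- (a :* a :+ b :* b)) :+ ((s :* s :- (c :* c :+ d :* d)) :+ :2 :* (r :* s :- (a :* c :+ b :* d)))) refl (re z) (im z) (re w) (im w) r s)
    where
    cross : re z * re w + im z * im w ≤ r * s
    -- Lagrange's identity: |z|²|w|² exceeds the square of the inner product by the square of the
    -- determinant.
    cross = x*x≤y*y⇒x≤y (*-nonNegative 0≤r 0≤s) (≤-trans
      (≤-by (0≤x*x (re z * im w - im z * re w)) (solve 4 (λ a b c d → (a :* a :+ b :* b) :* (c :* c :+ d :* d) :- (a :* c :+ b :* d) :* (a :* c :+ b :* d) := (a :* d :- b :* c) :* (a :* d :- b :* c)) refl (re z) (im z) (re w) (im w)))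
      (≤-trans (*-mono-≤ (*-nonNegative 0≤r 0≤r) (0≤normSq w) p q) (≤-reflexive (solve 2 (λ r s → r :* r :* (s :* s) := r :* s :* (r :* s)) refl r s))))

  ⊑-* : ∀ z w {r s} → z ⊑ r → w ⊑ s → z *ℂ w ⊑ r * s
  ⊑-* z w {r} {s} (0≤r , p) (0≤s , q) = *-nonNegative 0≤r 0≤s , ≤-trans
    (≤-reflexive (solve 4 (λ a b c d → (a :* c :- b :* d) :* (a :* c :- b :* d) :+ (a :* d :+ b :* c) :* (a :* d :+ b :* c) := (a :* a :+ b :* b) :* (c :* c :+ d :* d)) refl (re z) (im z) (re w) (im w)))
    (≤-trans (*-mono-≤ (*-nonNegative 0≤r 0≤r) (0≤normSq w) p q) (≤-reflexive (solve 2 (λ r s → r :* r :* (s :* s) := r :* s :* (r :* s)) refl r s)))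

  ⊑-• : ∀ c z {r} → 0# ≤ c → z ⊑ r → c • z ⊑ c * r
  ⊑-• c z {r} 0≤c (0≤r , p) = *-nonNegative 0≤c 0≤r ,
    ≤-by (*-nonNegative (0≤x*x c) (x≤y⇒0≤y-x p)) (solve 4 (λ c r a b → c :* r :* (c :* r) :- (c :* a :* (c :* a) :+ c :* b :* (c :* b)) := c :* c :* (r :* r :- (a :* a :+ b :* b))) refl c r (re z) (im z))

  ⊑-∑ℂ : ∀ {A : Set} (xs : List A) {f : A → ℂ} {g : A → ℝ} → (∀ x → f x ⊑ g x) → ∑ℂ xs f ⊑ ∑ xs g
  ⊑-∑ℂ []       p = ≤-refl , ≤-reflexive (solve 0 (con (+ 0) :* con (+ 0) :+ con (+ 0) :* con (+ 0) := con (+ 0) :* con (+ 0)) refl)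
  ⊑-∑ℂ (x ∷ xs) p = ⊑-+ _ _ (p x) (⊑-∑ℂ xs p)

  ⊑-∏ℂ : ∀ {A : Set} (xs : List A) {f : A → ℂ} {g : A → ℝ} → (∀ x → f x ⊑ g x) → ∏ℂ xs f ⊑ ∏ xs g
  ⊑-∏ℂ []       p = 0≤1 , ≤-reflexive (solve 0 (:1 :* :1 :+ con (+ 0) :* con (+ 0) := :1 :* :1) refl)
  ⊑-∏ℂ (x ∷ xs) p = ⊑-* _ _ (p x) (⊑-∏ℂ xs p)

  -- Beyond the threshold, clipping shortens z by |z| - K, where |z| ≤ d₂ and K ≥ d₁. The scalar
  -- `1#` is the value of 1_[N] in D♯ at points of [N].
  clip-error : ∀ {K d₁ d₂} z → 0# ≤ K → d₁ ≤ K → z ⊑ d₂ → normSq (z -ℂ 1# • clip K z) ≤ (d₂ - d₁) * (d₂ - d₁)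
  clip-error {K} {d₁} {d₂} z 0≤K d₁≤K z⊑d₂ with ∣ z ∣ℂ O.≤? K
  ... | yes _ = ≤-trans (≤-reflexive (solve 2 (λ a b → (a :- :1 :* a) :* (a :- :1 :* a) :+ (b :- :1 :* b) :* (b :- :1 :* b) := con (+ 0)) refl (re z) (im z))) (0≤x*x _)
  ... | no ρ≰K = ≤-trans (≤-reflexive eq) (x*x≤∣∣ (≤-trans (≤-reflexive (∣x∣≡x (x≤y⇒0≤y-x K≤ρ)))
        (+-mono-≤ (⊑⇒∣∣ℂ≤ z z⊑d₂) (neg-mono-≤ d₁≤K))))
    where
    ρ = ∣ z ∣ℂ
    K≤ρ : K ≤ ρ
    K≤ρ = ≰⇒≥ ρ≰K
    eq : normSq (z -ℂ 1# • ((K / ρ) • z)) ≡ (ρ - K) * (ρ - K)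
    eq with ρ O.≟ 0#
    ... | yes ρ≡0 = ⊥-elim (ρ≰K (≤-trans (≤-reflexive ρ≡0) 0≤K))
    ... | no ρ≢0 = trans
            (solve 3 (λ a b c → (a :- :1 :* (c :* a)) :* (a :- :1 :* (c :* a)) :+ (b :- :1 :* (c :* b)) :* (b :- :1 :* (c :* b)) := (:1 :- c) :* (:1 :- c) :* (a :* a :+ b :* b)) refl (re z) (im z) (K / ρ))
            (trans (cong ((1# - K / ρ) * (1# - K / ρ) *_) (sym (∣∣ℂ-square z)))
            (trans (solve 2 (λ c p → (:1 :- c) :* (:1 :- c) :* (p :* p) := (p :- c :* p) :* (p :- c :* p)) refl (K / ρ) ρ)
            (cong (λ k → (ρ - k) * (ρ - k)) (/-cancel (0≤∣∣ℂ z , ρ≢0)))))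

  part : Bool → ℂ → ℝ
  part false = re
  part true  = im

  ⊑⇒∣part∣≤ : ∀ e z {r} → z ⊑ r → ∣ part e z ∣ ≤ r
  ⊑⇒∣part∣≤ false = ⊑⇒∣re∣≤
  ⊑⇒∣part∣≤ true  = ⊑⇒∣im∣≤

  -- The power of the imaginary unit counting the imaginary parts chosen by e.
  unit : ∀ {d} → Vec Bool d → ℂ
  unit []          = 1ℂ
  unit (false ∷ e) = unit e
  unit (true ∷ e)  = (- im (unit e)) +i re (unit e)

  ∣unit∣≤1 : ∀ {d} (e : Vec Bool d) → ∣ re (unit e) ∣ ≤ 1# × ∣ im (unit e) ∣ ≤ 1#
  ∣unit∣≤1 []          = ≤-reflexive (∣x∣≡x 0≤1) , ≤-trans (≤-reflexive (∣x∣≡x ≤-refl)) 0≤1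
  ∣unit∣≤1 (false ∷ e) = ∣unit∣≤1 e
  ∣unit∣≤1 (true ∷ e)  = ≤-trans (≤-reflexive (∣-x∣≡∣x∣ _)) (proj₂ (∣unit∣≤1 e)) , proj₁ (∣unit∣≤1 e)

  choices : ∀ d → List (Vec Bool d)
  choices d = tuples (replicate d (false ∷ true ∷ []))

  monomial : ∀ {d} → Vec Bool d → (Fin d → ℂ) → ℝ
  monomial {d} e z = ∏ (allFin d) λ i → part (lookup e i) (z i)

  ∑-choices : ∀ d (F : Vec Bool (suc d) → ℝ) → ∑ (choices (suc d)) F ≡ ∑ (choices d) (F ∘ (false ∷_)) + ∑ (choices d) (F ∘ (true ∷_))
  ∑-choices d F = trans (∑-cartesianProductWith _∷_ (false ∷ true ∷ []) (choices d) F) (cong (λ z → ∑ (choices d) (F ∘ (false ∷_)) + z) (R.+-identityʳ _))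

  -- Reduces the complex case to the real one: each monomial takes the real or the imaginary part of
  -- every factor, and each part inherits the majorant of its factor.
  ∏ℂ-expand : ∀ d (z : Fin d → ℂ) →
    re (∏ℂ (allFin d) z) ≡ ∑ (choices d) (λ e → re (unit e) * monomial e z) ×
    im (∏ℂ (allFin d) z) ≡ ∑ (choices d) (λ e → im (unit e) * monomial e z)
  ∏ℂ-expand zero z = sym (trans (R.+-identityʳ _) (R.*-identityʳ 1#)) , sym (trans (R.+-identityʳ _) (R.*-identityʳ 0#))
  ∏ℂ-expand (suc d) z = trans (cong re product-suc) (trans re-eq (sym (trans (∑-choices d _) (cong₂ _+_ (term re false) (term re true))))) ,
                        trans (cong im product-suc) (trans im-eq (sym (trans (∑-choices d _) (cong₂ _+_ (term im false) (term im true)))))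
    where
    z₀ = z zero
    z′ = z ∘ suc
    tail = ∏ℂ (allFin d) z′
    product-suc : ∏ℂ (allFin (suc d)) z ≡ z₀ *ℂ tail
    product-suc = cong (z₀ *ℂ_) (bigOp-tabulate (record { Carrier = ℂ ; _≈_ = _≡_ ; _∙_ = _*ℂ_ ; ε = 1ℂ }) suc z (λ i → i) z′ λ _ → refl)
    term : ∀ (p : ℂ → ℝ) b → ∑ (choices d) (λ e → p (unit (b ∷ e)) * monomial (b ∷ e) z) ≡ part b z₀ * ∑ (choices d) (λ e → p (unit (b ∷ e)) * monomial e z′)
    term p b = trans (∑-cong (choices d) λ e → trans (cong (p (unit (b ∷ e)) *_) (∏-allFin-suc λ i → part (lookup (b ∷ e) i) (z i)))
        (solve 3 (λ u a m → u :* (a :* m) := a :* (u :* m)) refl (p (unit (b ∷ e))) (part b z₀) (monomial e z′))) (∑-*ˡ (choices d) (part b z₀) _)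
    ih = ∏ℂ-expand d z′
    re-eq : re (z₀ *ℂ tail) ≡ re z₀ * ∑ (choices d) (λ e → re (unit e) * monomial e z′) + im z₀ * ∑ (choices d) (λ e → (- im (unit e)) * monomial e z′)
    re-eq = cong₂ _+_ (cong (re z₀ *_) (proj₁ ih)) (trans (cong (λ t → - (im z₀ * t)) (proj₂ ih))
      (trans (RP.-‿distribʳ-* _ _) (cong (im z₀ *_) (trans (sym (RP.-1*x≈-x _)) (trans (sym (∑-*ˡ (choices d) (- 1#) _))
        (∑-cong (choices d) λ e → solve 2 (λ u m → (:- :1) :* (u :* m) := (:- u) :* m) refl (im (unit e)) (monomial e z′)))))))
    im-eq : im (z₀ *ℂ tail) ≡ re z₀ * ∑ (choices d) (λ e → im (unit e) * monomial e z′) + im z₀ * ∑ (choices d) (λ e → re (unit e) * monomial e z′)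
    im-eq = cong₂ _+_ (cong (re z₀ *_) (proj₂ ih)) (cong (im z₀ *_) (proj₁ ih))

  -- Counting degenerate vectors, and the supremum of ν

  δ : ℤ → ℤ → ℝ
  δ y z = if does (y ℤ.≟ z) then 1# else 0#

  0≤δ : ∀ y z → 0# ≤ δ y z
  0≤δ y z with y ℤ.≟ z
  ... | yes _ = 0≤1
  ... | no _  = ≤-refl

  ∑-δ≤1 : ∀ {xs} → Unique xs → ∀ z → ∑ xs (λ x → δ x z) ≤ 1#
  ∑-δ≤1 {[]}     []       z = 0≤1
  ∑-δ≤1 {x ∷ xs} (p ∷ ps) z with x ℤ.≟ z
  ... | no _     = ≤-trans (≤-reflexive (R.+-identityˡ _)) (∑-δ≤1 ps z)
  ... | yes refl = ≤-reflexive (trans (cong (λ t → 1# + t) (trans (∑-cong-∈ xs λ y y∈ → δ≡0 y (All.lookup p y∈ ∘ sym)) (∑-0 xs))) (R.+-identityʳ 1#))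
    where
    δ≡0 : ∀ y → y ≢ x → δ y x ≡ 0#
    δ≡0 y y≢x with y ℤ.≟ x
    ... | yes e = ⊥-elim (y≢x e)
    ... | no _  = refl

  -- Unlike the indicator of degeneracy, this count of coincidences b_i = 0 and b_i = b_j is
  -- additive, so its sum over a box is found coordinate by coordinate.
  degeneracy : ∀ {d} → Vec ℤ d → ℝ
  degeneracy []      = 0#
  degeneracy (z ∷ b) = (δ z (+ 0) + ∑ (Vec.toList b) (δ z)) + degeneracy b

  0≤degeneracy : ∀ {d} (b : Vec ℤ d) → 0# ≤ degeneracy b
  0≤degeneracy []      = ≤-refl
  0≤degeneracy (z ∷ b) = +-nonNegative (+-nonNegative (0≤δ z (+ 0)) (∑-nonNegative (Vec.toList b) (0≤δ z))) (0≤degeneracy b)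

  avoids? : ∀ {d} z (b : Vec ℤ d) → (∀ i → z ≢ lookup b i) ⊎ 1# ≤ ∑ (Vec.toList b) (δ z)
  avoids? z []      = inj₁ λ ()
  avoids? z (y ∷ b) with z ℤ.≟ y
  ... | yes _ = inj₂ (x≤x+y (∑-nonNegative (Vec.toList b) (0≤δ z)))
  ... | no z≢y with avoids? z b
  ...   | inj₁ p = inj₁ λ { zero → z≢y ; (suc i) → p i }
  ...   | inj₂ q = inj₂ (≤-trans q (≤-reflexive (sym (R.+-identityˡ _))))

  -- A degenerate vector has degeneracy at least 1, so the degeneracy can serve as the coefficient
  -- of a crude bound.
  nonDegenerate? : ∀ {d} (b : Vec ℤ d) → NonDegenerate b ⊎ 1# ≤ degeneracy b
  nonDegenerate? [] = inj₁ ((λ ()) , λ ())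
  nonDegenerate? (z ∷ b) with nonDegenerate? b
  ... | inj₂ q = inj₂ (≤-trans q (x≤y+x (+-nonNegative (0≤δ z (+ 0)) (∑-nonNegative (Vec.toList b) (0≤δ z)))))
  ... | inj₁ (b≢0 , b≢b) with avoids? z b
  ...   | inj₂ q = inj₂ (≤-trans q (≤-trans (x≤y+x (0≤δ z (+ 0))) (x≤x+y (0≤degeneracy b))))
  ...   | inj₁ p with z ℤ.≟ + 0
  ...     | yes _  = inj₂ (≤-trans (x≤x+y (∑-nonNegative (Vec.toList b) (0≤δ z))) (x≤x+y (0≤degeneracy b)))
  ...     | no z≢0 = inj₁ ((λ { zero → z≢0 ; (suc i) → b≢0 i }) , λ
              { zero    zero    i≢j → ⊥-elim (i≢j refl)
              ; zero    (suc j) _   → p j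
              ; (suc i) zero    _   → p i ∘ sym
              ; (suc i) (suc j) i≢j → b≢b i j (i≢j ∘ cong suc) })

  length-tuples : ∀ {A : Set} (xs : List A) d → fromℕ (length (tuples (replicate d xs))) ≡ fromℕ (length xs) ^ d
  length-tuples xs zero    = R.+-identityʳ 1#
  length-tuples xs (suc d) = trans (cong fromℕ (length-cpw _∷_ xs (tuples (replicate d xs)))) (trans (fromℕ-* (length xs) _) (cong (fromℕ (length xs) *_) (length-tuples xs d)))

  -- With d coordinates fixed, a new one equals zero or one of them for at most 1 + d values in
  -- total. The extra factor `length xs` on the left is the gain that later becomes 1/B.
  ∑-degeneracy : ∀ {xs} → Unique xs → ∀ d →
    fromℕ (length xs) * ∑ (tuples (replicate d xs)) degeneracy ≤ fromℕ d * fromℕ d * fromℕ (length xs) ^ d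
  ∑-degeneracy {xs} u zero = ≤-reflexive (solve 1 (λ l → l :* (con (+ 0) :+ con (+ 0)) := con (+ 0) :* con (+ 0) :* :1) refl (fromℕ (length xs)))
  ∑-degeneracy {xs} u (suc d) = begin
    l * ∑ (tuples (replicate (suc d) xs)) degeneracy
      ≈⟨ cong (l *_) (trans (∑-cartesianProductWith _∷_ xs box degeneracy) (trans (∑-cong xs λ z → ∑-+ box (new z) degeneracy) (∑-+ xs _ _))) ⟩
    l * (∑ xs (λ z → ∑ box (new z)) + ∑ xs (λ _ → S))
      ≈⟨ cong (l *_) (cong₂ _+_ (∑-swap xs box new) (∑-const xs S)) ⟩
    l * (∑ box (λ b → ∑ xs λ z → new z b) + l * S)
      ≤⟨ *-monoʳ-≤ 0≤l (+-mono-≤ (≤-trans (∑-mono box new≤) (≤-reflexive (trans (∑-const box (1# + n)) (cong (_* (1# + n)) (length-tuples xs d))))) (∑-degeneracy u d)) ⟩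
    l * (l ^ d * (1# + n) + n * n * l ^ d)
      ≤⟨ ≤-by (*-nonNegative (*-nonNegative 0≤l (0≤^ d 0≤l)) (0≤fromℕ d)) (solve 3 (λ l p n → (:1 :+ n) :* (:1 :+ n) :* (l :* p) :- l :* (p :* (:1 :+ n) :+ n :* n :* p) := l :* p :* n) refl l (l ^ d) n) ⟩
    (1# + n) * (1# + n) * (l * l ^ d) ∎
    where
    open ≤-Reasoning
    l = fromℕ (length xs)
    n = fromℕ d
    0≤l = 0≤fromℕ (length xs)
    box = tuples (replicate d xs)
    S = ∑ box degeneracy
    new : ℤ → Vec ℤ d → ℝ
    new z b = δ z (+ 0) + ∑ (Vec.toList b) (δ z)
    new≤ : ∀ b → ∑ xs (λ z → new z b) ≤ 1# + n
    new≤ b = ≤-trans (≤-reflexive (trans (∑-+ xs _ _) (cong (λ t → ∑ xs (λ z → δ z (+ 0)) + t) (∑-swap xs (Vec.toList b) δ))))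
      (+-mono-≤ (∑-δ≤1 u (+ 0)) (≤-trans (∑-mono (Vec.toList b) λ y → ∑-δ≤1 u y)
        (≤-reflexive (trans (∑-const (Vec.toList b) 1#) (trans (R.*-identityʳ _) (cong fromℕ (Vec.length-toList b)))))))

  1≤Rsup : ∀ N ν → 1# ≤ Rsup N ν
  1≤Rsup N ν = x≤x⊔y 1# _

  ≤-Rsup : ∀ N ν → SupportedOn 0# (_∈[ N ]) ν → ∀ z → ν z ≤ Rsup N ν
  ≤-Rsup N ν supp z with 𝟙-values N z
  ... | inj₂ (z∉ , _) = ≤-trans (≤-reflexive (supp z z∉)) (≤-trans 0≤1 (1≤Rsup N ν))
  ... | inj₁ ((1≤z , z≤P) , _) = ≤-trans (x≤∣x∣ (ν z)) (≤-trans (≤-max [1⋯ N ] (∈[1⋯N] z 1≤z z≤P)) (x≤y⊔x 1# _))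
    where
    ≤-max : ∀ xs → z ∈ xs → ∣ ν z ∣ ≤ List.foldr (λ x acc → ∣ ν x ∣ ⊔ acc) 0# xs
    ≤-max (x ∷ xs) (here refl) = x≤x⊔y ∣ ν x ∣ _
    ≤-max (x ∷ xs) (there z∈)  = ≤-trans (≤-max xs z∈) (x≤y⊔x ∣ ν x ∣ _)
    ∈[1⋯N] : ∀ z → + 1 ℤ.≤ z → z ℤ.≤ + ⌊ N ⌋ → z ∈ [1⋯ N ]
    ∈[1⋯N] (+ suc n) _ (ℤ.+≤+ p) = ∈-map⁺ _ (∈-upTo⁺ p)
    ∈[1⋯N] (+ zero) (ℤ.+≤+ ()) _

  re-∑ℂ : ∀ {A : Set} (xs : List A) (f : A → ℂ) → re (∑ℂ xs f) ≡ ∑ xs (re ∘ f)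
  re-∑ℂ []       f = refl
  re-∑ℂ (x ∷ xs) f = cong (λ z → re (f x) + z) (re-∑ℂ xs f)

  im-∑ℂ : ∀ {A : Set} (xs : List A) (f : A → ℂ) → im (∑ℂ xs f) ≡ ∑ xs (im ∘ f)
  im-∑ℂ []       f = refl
  im-∑ℂ (x ∷ xs) f = cong (λ z → im (f x) + z) (im-∑ℂ xs f)

  -- The summand c is the price of d shifts at 2βT/H each with β = 4, paid once for m and once for
  -- m′. The last summand is the window factor 2A + 1 times the constant of the von Neumann
  -- inequality with 3^(2d) forms.
  correlationConstant : ℕ → ℕ → ℝ
  correlationConstant d A = c + (c + fromℕ (suc (A ℕ.+ A)) * (2# * 2# ^ (3 ℕ.^ (d ℕ.+ d))))
    where c = fromℕ d * (2# * (2# + 2#))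

  -- 2 · 2 bounds the product of two coefficients, n² counts the pairs of monomials, and the powers
  -- of 2C₀ + 1 bound the normalised number of pairs (b, b′).
  gramFactor : ℕ → ℕ → ℝ → ℝ
  gramFactor n d C₀ = 2# * 2# * (fromℕ n * fromℕ n) * ((2# * C₀ + 1#) ^ d * (2# * C₀ + 1#) ^ d)

  -- In the first, the leading 2 is for the real and the imaginary part of D. In the second, 3
  -- counts the uses of the linear forms condition and 2 · 2 comes from squaring a difference
  -- bounded by 2 R_ν^d. The terms with d² are due to degenerate vectors.
  firstConstant secondConstant : ℕ → ℝ → ℕ → ℝ
  firstConstant  d C₀ A = 2# * gramFactor (length (choices d)) d C₀ * (correlationConstant d A + 2# * (fromℕ d * fromℕ d))
  secondConstant d C₀ A = gramFactor 1 d C₀ * ((2# + 1#) + 2# * (fromℕ d * fromℕ d) * (2# * 2#))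

  0≤correlationConstant : ∀ d A → 0# ≤ correlationConstant d A
  0≤correlationConstant d A = +-nonNegative 0≤c (+-nonNegative 0≤c (*-nonNegative (0≤fromℕ (suc (A ℕ.+ A))) (*-nonNegative 0≤2 (0≤^ (3 ℕ.^ (d ℕ.+ d)) 0≤2))))
    where
    0≤c : 0# ≤ fromℕ d * (2# * (2# + 2#))
    0≤c = *-nonNegative (0≤fromℕ d) (*-nonNegative 0≤2 (+-nonNegative 0≤2 0≤2))

  0≤gramFactor : ∀ n d {C₀} → 0# ≤ C₀ → 0# ≤ gramFactor n d C₀
  0≤gramFactor n d 0≤C₀ = *-nonNegative (*-nonNegative (*-nonNegative 0≤2 0≤2) (*-nonNegative (0≤fromℕ n) (0≤fromℕ n))) (*-nonNegative 0≤σ^d 0≤σ^d)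
    where 0≤σ^d = 0≤^ d (+-nonNegative (*-nonNegative 0≤2 0≤C₀) 0≤1)

  linear≤ : ∀ {a b x y} → 0# ≤ a → 0# ≤ b → 0# ≤ x → 0# ≤ y → a * x + b * y ≤ (a + b) * (x + y)
  linear≤ {a} {b} {x} {y} 0≤a 0≤b 0≤x 0≤y = ≤-by (+-nonNegative (*-nonNegative 0≤a 0≤y) (*-nonNegative 0≤b 0≤x))
    (solve 4 (λ a b x y → (a :+ b) :* (x :+ y) :- (a :* x :+ b :* y) := a :* y :+ b :* x) refl a b x y)

  -- Stated for a variable k, where the summation range does not reduce, so that comparing the two sides stays cheap.
  dual-unfold : ∀ k N B H r (μ : Vec ℤ (k ∸ 1) → ℂ) (supp : SupportedOn 0ℂ (Box r) μ) (g : Fin (k ∸ 1) → ℤ → ℂ) x →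
    dual k N B H r μ supp g x ≡ (1# / (B ^ (k ∸ 2) * N)) • ∑ℂ (tuples (replicate (k ∸ 1) [- ⌊ r ⌋ , ⌊ r ⌋ ]))
      λ b → μ b *ℂ ∑ℂ (run 0 H) λ m → ∏ℂ (allFin (k ∸ 1)) λ i → g i (x ℤ.+ lookup b i ℤ.* m)
  dual-unfold k N B H r μ supp g x = refl

  -- Consequences of the linear forms condition

  module Setting
    (N : ℝ) (1≤N : 1# ≤ N) (H : ℕ) (1≤H : 1 ℕ.≤ H) (K L η : ℝ) (2≤L : 2# ≤ L) (0≤η : 0# ≤ η) (η≤1 : η ≤ 1#)
    (ν : ℤ → ℝ) (0≤ν : ∀ z → 0# ≤ ν z) (ν-supp : SupportedOn 0# (_∈[ N ]) ν)
    (lfc : LinearFormsCondition ν K L η N (N / fromℕ H) H)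
    where

    P : ℕ
    P = ⌊ N ⌋

    1≤P : 1 ℕ.≤ P
    1≤P = 1≤⌊⌋ 1≤N

    P≤N : fromℕ P ≤ N
    P≤N = ⌊⌋-≤ (≤-trans 0≤1 1≤N)

    B : ℝ
    B = N / fromℕ H

    H>0 : Positive (fromℕ H)
    H>0 = fromℕ-pos 1≤H

    L>0 : Positive L
    L>0 = ≤-pos (1≤⇒pos 1≤2) 2≤L

    BH≡N : B * fromℕ H ≡ N
    BH≡N = /-cancel H>0

    0≤B : 0# ≤ B
    0≤B = *-nonNegative (≤-trans 0≤1 1≤N) (proj₁ (⁻¹-pos H>0))

    0≤N : 0# ≤ N
    0≤N = ≤-trans 0≤1 1≤N

    -- Rounded up so that T ≥ H/L and the linear forms condition accepts {1, ..., T}. The inequality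
    -- T ≤ H rests on L ≥ 2, and T/H ≤ 1/L + 1/H accounts for the last two terms of η*.
    T : ℕ
    T = suc ⌊ fromℕ H / L ⌋

    0≤H/L : 0# ≤ fromℕ H / L
    0≤H/L = *-nonNegative (0≤fromℕ H) (proj₁ (⁻¹-pos L>0))

    H/L≤T : fromℕ H / L ≤ fromℕ T
    H/L≤T = ≤-suc-⌊⌋ _

    T≤H/L+1 : fromℕ T ≤ fromℕ H / L + 1#
    T≤H/L+1 = ≤-trans (+-monoʳ-≤ 1# (⌊⌋-≤ 0≤H/L)) (≤-reflexive (R.+-comm _ _))

    1≤T : 1 ℕ.≤ T
    1≤T = ℕ.s≤s ℕ.z≤n

    T≤H : T ℕ.≤ H
    T≤H = ℕ.≰⇒> λ H≤ → proj₂ H>0 (≤-antisym (h≤0 (≤-trans (fromℕ-mono H≤) (⌊⌋-≤ 0≤H/L))) (0≤fromℕ H))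
      where
      h≤0 : fromℕ H ≤ fromℕ H / L → fromℕ H ≤ 0#
      h≤0 p = ≤-by (x≤y⇒0≤y-x (≤-trans (*-monoʳ-≤ (0≤fromℕ H) 2≤L) (≤-trans (*-monoˡ-≤ (proj₁ L>0) p) (≤-reflexive (/-cancel L>0)))))
        (solve 1 (λ h → con (+ 0) :- h := h :- h :* :2) refl (fromℕ H))

    weight : Tag → ℤ → ℝ
    weight maj = ν
    weight one = 𝟙[ N ]

    0≤weight : ∀ τ z → 0# ≤ weight τ z
    0≤weight maj = 0≤ν
    0≤weight one = 0≤𝟙 N

    CoeffOK : ℤ → Set
    CoeffOK z = fromℕ ℤ.∣ z ∣ ≤ K * B

    mean : ∀ {s} → Vec (Interval H) s → (ℤ → Vec ℤ s → ℝ) → ℝ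
    mean Is F = 𝔼 [1⋯ N ] λ x → 𝔼 (tuples (Vec.map elements Is)) λ h → F x h

    -- The interval for x is always all of [N]: its length ⌊N⌋ is at least N/2, hence at least N/L.
    linearForms : ∀ {s} (Is : Vec (Interval H) s) →
      (∀ t → fromℕ H / L ≤ fromℕ (Interval.size (lookup Is t))) →
      (F : List (Tag × ℤ × Vec ℤ s)) → 1 ℕ.≤ length F → fromℕ (length F) ≤ K → fromℕ s ≤ K →
      All (λ (a , c) → fromℕ ℤ.∣ a ∣ ≤ K * N × VecAll.All CoeffOK c) (List.map proj₂ F) →
      AllPairs (λ (_ , c) (_ , e) → c ≢ e) (List.map proj₂ F) →
      ∣ mean Is (λ x h → ∏ F λ (τ , a , c) → weight τ (x ℤ.+ a ℤ.+ dot c h)) -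
        mean Is (λ x h → ∏ (List.map proj₂ F) λ (a , c) → 𝟙[ N ] (x ℤ.+ a ℤ.+ dot c h)) ∣ ≤ η
    linearForms {s} Is sizes F F≥1 F≤K s≤K OK distinct = subst₂ (λ u v → ∣ u - v ∣ ≤ η)
      (𝔼-cong [1⋯ N ] λ x → 𝔼-cong (tuples (Vec.map elements Is)) λ h → ∏-lookup F λ (τ , a , c) → weight τ (x ℤ.+ a ℤ.+ dot c h))
      (𝔼-cong [1⋯ N ] λ x → 𝔼-cong (tuples (Vec.map elements Is)) λ h →
        trans (∏-lookup F λ (τ , a , c) → 𝟙[ N ] (x ℤ.+ a ℤ.+ dot c h)) (sym (∏-map proj₂ F λ (a , c) → 𝟙[ N ] (x ℤ.+ a ℤ.+ dot c h))))
      (lfc s (length F) s≤K F≥1 F≤K I Is N/L≤P sizes a c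
        (λ j → proj₁ (OK′ j)) (λ j t → VecAll.lookup⁺ (proj₂ (OK′ j)) t)
        (allPairs-lookup (λ p q → p (sym q)) (AllPairs.map⁻ distinct))
        (λ j → weight (proj₁ (List.lookup F j))) λ j → choice (proj₁ (List.lookup F j)))
      where
      I : Interval P
      I = record { offset = 0 ; size = P ; bounded = ℕ.≤-refl }
      a : Fin (length F) → ℤ
      a j = proj₁ (proj₂ (List.lookup F j))
      c : Fin (length F) → Vec ℤ s
      c j = proj₂ (proj₂ (List.lookup F j))
      OK′ : ∀ j → fromℕ ℤ.∣ a j ∣ ≤ K * N × VecAll.All CoeffOK (c j)
      OK′ j = All.lookup (All.map⁻ OK) (∈-lookup j)
      choice : ∀ τ → weight τ ≡ ν ⊎ weight τ ≡ 𝟙[ N ]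
      choice maj = inj₁ refl
      choice one = inj₂ refl
      N/L≤P : N / L ≤ fromℕ P
      N/L≤P = x≤a*y⇒x/y≤a L>0 (≤-trans (x≤2⌊x⌋ 1≤N) (≤-trans (*-monoˡ-≤ (0≤fromℕ P) 2≤L) (≤-reflexive (R.*-comm L _))))

    module Window (A : ℕ) (maxForms maxVars : ℕ) (maxForms≤K : fromℕ maxForms ≤ K) (maxVars≤K : fromℕ maxVars ≤ K) where

      ys : List ℤ
      ys = run 0 T

      ys-nonEmpty : NonEmpty ys
      ys-nonEmpty = run-nonEmpty {0} 1≤T

      xs us : List ℤ
      us = offsets A P
      xs = cartesianProductWith (λ u x → x ℤ.+ u) us [1⋯ N ]

      us-nonEmpty : NonEmpty us
      us-nonEmpty = subst (1 ℕ.≤_) (sym (trans (length-map _ (upTo (suc (A ℕ.+ A)))) (length-upTo (suc (A ℕ.+ A))))) (ℕ.s≤s ℕ.z≤n)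

      xs-nonEmpty : NonEmpty xs
      xs-nonEmpty = cpw-nonEmpty _ us [1⋯ N ] us-nonEmpty (run-nonEmpty {0} 1≤P)

      -- A translate of [N] by u need not lie in [N], so u has to be moved into the constant of each
      -- form; the size condition is therefore on u + a for every u.
      ShiftOK : ℤ → Set
      ShiftOK a = ∀ u → u ∈ us → fromℕ ℤ.∣ u ℤ.+ a ∣ ≤ K * N

      K≥0 : 0# ≤ K
      K≥0 = ≤-trans (0≤fromℕ maxForms) maxForms≤K

      open GeneralisedVonNeumann xs ys xs-nonEmpty ys-nonEmpty weight 0≤weight (𝟙≤1 N) η 0≤η η≤1 ShiftOK CoeffOK
        (*-nonNegative K≥0 0≤B) maxForms maxVars hiding (generalisedVonNeumann; weight±; product±)

      average-shift : ∀ {s n} (X : Set) (F : List X) (w : X → ℤ → ℝ) (φ : X → Form s n) →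
        average (λ x h t → ∏ F λ p → w p (value (φ p) x h t)) ≡
        𝔼 us (λ u → mean (replicate (n ℕ.+ s) (record { offset = 0 ; size = T ; bounded = T≤H }))
          λ x v → ∏ F λ p → w p (x ℤ.+ (u ℤ.+ Form.shift (φ p)) ℤ.+ dot (Form.todo (φ p) Vec.++ Form.done (φ p)) v))
      average-shift {s} {n} X F w φ = trans
        (𝔼-cartesianProductWith (λ u x → x ℤ.+ u) us [1⋯ N ] us-nonEmpty (run-nonEmpty {0} 1≤P) _)
        (𝔼-cong us λ u → 𝔼-cong [1⋯ N ] λ x → trans (𝔼-swap (grid s) (grid n) _) (sym (trans
          (cong (λ z → 𝔼 (tuples z) _) (Vec.map-replicate elements _ (n ℕ.+ s)))
          (trans (𝔼-tuples-++ ys ys-nonEmpty n s _)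
            (𝔼-cong (grid n) λ t → 𝔼-cong (grid s) λ h → ∏-cong F λ p → cong (w p) (eq x u (φ p) h t))))))
        where
        eq : ∀ x u (φ : Form s n) h t → x ℤ.+ (u ℤ.+ Form.shift φ) ℤ.+ dot (Form.todo φ Vec.++ Form.done φ) (t Vec.++ h) ≡ value φ (x ℤ.+ u) h t
        eq x u (form a c l) h t = trans (cong (λ z → x ℤ.+ (u ℤ.+ a) ℤ.+ z) (dot-++ l c t h))
          (cong (ℤ._+ (dot l t ℤ.+ dot c h)) (sym (ℤ.+-assoc x u a)))

      -- The mean over the window is a mean over u of means over [N]. The condition applies to each
      -- of these with the same error η.
      windowLinearForms : ∀ {s n} (F : List (Tag × Form s n)) →
         1 ℕ.≤ length F → length F ℕ.≤ maxForms → n ℕ.+ s ℕ.≤ maxVars →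
         All OK (List.map proj₂ F) → AllPairs _#_ (List.map proj₂ F) →
         ∣ average (product F) - average (product₁ (List.map proj₂ F)) ∣ ≤ η
      windowLinearForms {s} {n} F F≥1 F≤ vars≤ ok distinct = subst (λ z → ∣ z ∣ ≤ η)
        (trans (𝔼-- us _ _) (cong₂ _-_ (sym (average-shift _ F (λ p → weight (proj₁ p)) proj₂))
          (sym (trans (average-cong-map) (average-shift _ F (λ _ → weight one) proj₂)))))
        (∣𝔼∣≤ us us-nonEmpty bound)
        where
        average-cong-map : average (product₁ (List.map proj₂ F)) ≡ average (λ x h t → ∏ F λ p → weight one (value (proj₂ p) x h t))
        average-cong-map = 𝔼-cong xs λ x → 𝔼-cong (grid s) λ h → 𝔼-cong (grid n) λ t → ∏-map proj₂ F _
        Is = replicate (n ℕ.+ s) (record { offset = 0 ; size = T ; bounded = T≤H })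
        g : ℤ → Form s n → ℤ × Vec ℤ (n ℕ.+ s)
        g u φ = u ℤ.+ Form.shift φ , Form.todo φ Vec.++ Form.done φ
        bound : ∀ u → u ∈ us →
          ∣ mean Is (λ x v → ∏ F λ p → weight (proj₁ p) (x ℤ.+ (u ℤ.+ Form.shift (proj₂ p)) ℤ.+ dot (Form.todo (proj₂ p) Vec.++ Form.done (proj₂ p)) v)) -
            mean Is (λ x v → ∏ F λ p → 𝟙[ N ] (x ℤ.+ (u ℤ.+ Form.shift (proj₂ p)) ℤ.+ dot (Form.todo (proj₂ p) Vec.++ Form.done (proj₂ p)) v)) ∣ ≤ η
        bound u u∈ = subst₂ (λ a b → ∣ a - b ∣ ≤ η)
          (𝔼-cong [1⋯ N ] λ x → 𝔼-cong (tuples (Vec.map elements Is)) λ h → ∏-map (map₂ (g u)) F _)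
          (𝔼-cong [1⋯ N ] λ x → 𝔼-cong (tuples (Vec.map elements Is)) λ h →
            trans (cong (λ z → ∏ z _) (trans (sym (List.map-∘ {g = proj₂} {f = map₂ (g u)} F)) (List.map-∘ {g = g u} {f = proj₂} F))) (trans (∏-map (g u) (List.map proj₂ F) _) (∏-map proj₂ F _)))
          (linearForms Is (λ t → subst (λ I → fromℕ H / L ≤ fromℕ (Interval.size I)) (sym (Vec.lookup-replicate t _)) H/L≤T)
            (List.map (map₂ (g u)) F)
            (subst (1 ℕ.≤_) (sym (length-map _ F)) F≥1)
            (≤-trans (fromℕ-mono (subst (ℕ._≤ maxForms) (sym (length-map _ F)) F≤)) maxForms≤K)
            (≤-trans (fromℕ-mono vars≤) maxVars≤K)
            (subst (All _) (sym forms) (All.map⁺ (All.map (λ {φ} (a , c , l) → a u u∈ , VecAll.++⁺ l c) ok)))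
            (subst (AllPairs _) (sym forms) (AllPairs.map⁺ (AllPairs.map (λ {φ} {ψ} φ#ψ e →
              φ#ψ (Vec.++-injectiveʳ (Form.todo φ) (Form.todo ψ) e , Vec.++-injectiveˡ (Form.todo φ) (Form.todo ψ) e)) distinct))))
          where
          forms : List.map proj₂ (List.map (map₂ (g u)) F) ≡ List.map (g u) (List.map proj₂ F)
          forms = trans (sym (List.map-∘ {g = proj₂} {f = map₂ (g u)} F)) (List.map-∘ {g = g u} {f = proj₂} F)

      -- Here γ is the shear of x, and κ_i · t is what the substitution adds inside f_i. After the
      -- shear f_i sees (γ + κ_i) · t, which misses t_i by hollowness, while ν - 1_[N] sees γ · t
      -- with all coefficients nonzero.
      module _
        (n : ℕ) (3^≤maxForms : 3 ℕ.^ suc n ℕ.≤ maxForms) (2*≤maxVars : suc n ℕ.* 2 ℕ.≤ maxVars)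
        (γ : Vec ℤ (suc n)) (κ : Fin (suc n) → Vec ℤ (suc n)) (a : Fin (suc n) → ℤ)
        (γ≢0 : VecAll.All (_≢ + 0) γ) (γ-OK : VecAll.All CoeffOK γ)
        (hollow : ∀ i → Hollow i (γ ⊕ κ i)) (κ-OK : ∀ i → VecAll.All CoeffOK (γ ⊕ κ i))
        (0-OK : ShiftOK (+ 0)) (a-OK : ∀ i → ShiftOK (a i))
        (γ-small : ∀ t → t ∈ grid (suc n) → ℤ.∣ dot γ t ∣ ℕ.≤ A ℕ.* P)
        (f : Fin (suc n) → ℤ → ℝ) (τ : Fin (suc n) → Tag) (f≤ : ∀ i z → ∣ f i z ∣ ≤ weight (τ i) z)
        where

        integrand : Vec ℤ (suc n) → ℤ → ℝ
        integrand t x = (ν x - 𝟙[ N ] x) * ∏ (allFin (suc n)) λ i → f i (x ℤ.+ (a i ℤ.+ dot (κ i) t))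

        forms± : List (Maybe Tag × Form 0 (suc n))
        forms± = (nothing , form (+ 0) [] γ) ∷ []

        blockForms : Fin (suc n) → List (Form 0 (suc n))
        blockForms i = form (a i) [] (γ ⊕ κ i) ∷ []

        open GeneralisedVonNeumann xs ys xs-nonEmpty ys-nonEmpty weight 0≤weight (𝟙≤1 N) η 0≤η η≤1 ShiftOK CoeffOK
          (*-nonNegative K≥0 0≤B) maxForms maxVars using ()
          renaming (generalisedVonNeumann to gvn; weight± to w±; product± to p±; blocks to bl)

        centred : ℝ
        centred = average λ x h t → p± windowLinearForms forms± x h t * bl windowLinearForms f blockForms x h t

        U : ℝ
        U = fromℕ (suc (A ℕ.+ A))

        translated : 𝔼 (grid (suc n)) (λ t → 𝔼 [1⋯ N ] (integrand t)) ≡ U * centred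
        translated = trans
          (𝔼-cong-∈ (grid (suc n)) λ t t∈ → Translation.𝔼-translate N (integrand t) (supp t) 1≤P A (dot γ t) (γ-small t t∈))
          (trans (𝔼-*ˡ (grid (suc n)) U _) (cong (U *_) (trans (𝔼-swap (grid (suc n)) xs _)
            (𝔼-cong xs λ x → trans (𝔼-cong (grid (suc n)) λ t → eq x t) (sym (𝔼-singleton {Vec ℤ 0} [] λ h → 𝔼 (grid (suc n)) λ t → p± windowLinearForms forms± x h t * bl windowLinearForms f blockForms x h t))))))
          where
          supp : ∀ t → SupportedOn 0# (_∈[ N ]) (integrand t)
          supp t x x∉ = trans (cong (_* (∏ (allFin (suc n)) λ i → f i (x ℤ.+ (a i ℤ.+ dot (κ i) t)))) (trans (cong₂ _-_ (ν-supp x x∉) (𝟙-supp N x x∉)) (R.-‿inverseʳ 0#))) (R.zeroˡ _)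
          eq : ∀ x t → integrand t (x ℤ.+ dot γ t) ≡ p± windowLinearForms forms± x [] t * bl windowLinearForms f blockForms x [] t
          eq x t = cong₂ _*_
            (trans (cong (λ z → ν z - 𝟙[ N ] z) (ℤS.solve 2 (λ x g → x ℤS.:+ g ℤS.:= x ℤS.:+ ℤS.con (+ 0) ℤS.:+ (g ℤS.:+ ℤS.con (+ 0))) refl x (dot γ t))) (sym (R.*-identityʳ _)))
            (∏-cong (allFin (suc n)) λ i → trans (cong (f i) (trans
                (ℤS.solve 4 (λ x g a k → x ℤS.:+ g ℤS.:+ (a ℤS.:+ k) ℤS.:= x ℤS.:+ a ℤS.:+ (g ℤS.:+ k ℤS.:+ ℤS.con (+ 0))) refl x (dot γ t) (a i) (dot (κ i) t))
                (cong (λ z → x ℤ.+ a i ℤ.+ (z ℤ.+ + 0)) (sym (dot-⊕ γ (κ i) t))))) (sym (R.*-identityʳ _)))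

        centred-bound : centred ^ (2 ℕ.^ suc n) ≤ 2# ^ (2 ℕ.^ suc n) * (2# ^ maxForms * η)
        centred-bound = gvn windowLinearForms (suc n) forms± f τ blockForms f≤ 1
          (ℕ.≤-trans (ℕ.≤-reflexive (ℕ.*-identityˡ (3 ℕ.^ suc n))) 3^≤maxForms)
          (ℕ.≤-trans (ℕ.≤-reflexive (ℕ.+-identityʳ _)) 2*≤maxVars)
          ℕ.≤-refl refl (((0-OK , [] , γ-OK) , γ≢0) ∷ []) ([] ∷ [])
          (λ _ → ℕ.≤-refl) (λ _ → ℕ.≤-refl) (λ i → ((a-OK i , [] , κ-OK i) , hollow i) ∷ []) (λ _ → [] ∷ [])

        shiftedAverage-bound : ∀ {ρ} → (∀ t → 0# ≤ t → t ^ (2 ℕ.^ suc n) ≤ η → t ≤ ρ) →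
          ∣ 𝔼 (grid (suc n)) (λ t → 𝔼 [1⋯ N ] (integrand t)) ∣ ≤ U * (2# * 2# ^ maxForms * ρ)
        shiftedAverage-bound {ρ} root = ≤-trans (≤-reflexive (cong ∣_∣ translated))
          (∣x*y∣≤ (≤-reflexive (∣x∣≡x (0≤fromℕ (suc (A ℕ.+ A))))) (≤-trans (≤-reflexive (sym (/-cancel c>0)))
            (≤-trans (≤-reflexive (R.*-comm _ c)) (*-monoʳ-≤ (proj₁ c>0) (root s 0≤s s^q≤η)))))
          where
          q = 2 ℕ.^ suc n
          J = 2# ^ maxForms
          c = 2# * J
          J>0 : Positive J
          J>0 = ^-pos maxForms (1≤⇒pos 1≤2)
          c>0 : Positive c
          c>0 = *-pos (1≤⇒pos 1≤2) J>0
          -- Dividing before the root is taken keeps the root away from the constant: since J ≥ 1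
          -- one has J ≤ J^q, so c^q absorbs the constant of `centred-bound` and leaves s^q ≤ η.
          s = ∣ centred ∣ / c
          0≤s : 0# ≤ s
          0≤s = *-nonNegative (0≤∣x∣ _) (proj₁ (⁻¹-pos c>0))
          J≤J^q : J ≤ J ^ q
          J≤J^q = ≤-trans (≤-reflexive (sym (R.*-identityʳ J))) (≤-trans (*-monoʳ-≤ (proj₁ J>0) (1≤^ (ℕ.pred q) (1≤^ maxForms 1≤2)))
            (≤-reflexive (cong (J ^_) (ℕ.suc-pred q {{ℕ.m^n≢0 2 (suc n)}}))))
          s^q≤η : s ^ q ≤ η
          s^q≤η = *-cancelˡ-≤-pos (^-pos q c>0) (begin
            c ^ q * s ^ q                 ≈⟨ sym (Exp.^-distrib-* c s q) ⟩
            (c * s) ^ q                   ≈⟨ cong (_^ q) (trans (R.*-comm c s) (/-cancel c>0)) ⟩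
            ∣ centred ∣ ^ q               ≈⟨ ^-abs centred n ⟩
            centred ^ q                   ≤⟨ centred-bound ⟩
            2# ^ q * (J * η)              ≤⟨ *-monoʳ-≤ (0≤^ q 0≤2) (*-monoˡ-≤ 0≤η J≤J^q) ⟩
            2# ^ q * (J ^ q * η)          ≈⟨ sym (R.*-assoc _ _ _) ⟩
            2# ^ q * J ^ q * η            ≈⟨ cong (_* η) (sym (Exp.^-distrib-* 2# J q)) ⟩
            c ^ q * η                     ∎)
            where open ≤-Reasoning

    mean₂ : ∀ (I I′ : Interval H) (F : ℤ → Vec ℤ 2 → ℝ) → NonEmpty (elements I) → NonEmpty (elements I′) →
            mean (I ∷ I′ ∷ []) F ≡ 𝔼 [1⋯ N ] (λ x → 𝔼 (elements I) λ m → 𝔼 (elements I′) λ m′ → F x (m ∷ m′ ∷ []))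
    mean₂ I I′ F p p′ = 𝔼-cong [1⋯ N ] λ x → trans (𝔼-cartesianProductWith _∷_ (elements I) _ p (cpw-nonEmpty _∷_ (elements I′) ([] ∷ []) p′ (ℕ.s≤s ℕ.z≤n)) (F x))
      (𝔼-cong (elements I) λ m → trans (𝔼-cartesianProductWith _∷_ (elements I′) ([] ∷ []) p′ (ℕ.s≤s ℕ.z≤n) (F x ∘ (m ∷_)))
        (𝔼-cong (elements I′) λ m′ → 𝔼-singleton {Vec ℤ 0} [] λ t → F x (m ∷ m′ ∷ t)))

    short long : Interval H
    short = record { offset = 0 ; size = T ; bounded = T≤H }
    long  = record { offset = 0 ; size = H ; bounded = ℕ.≤-refl }

    H/L≤H : fromℕ H / L ≤ fromℕ H
    H/L≤H = ≤-trans H/L≤T (fromℕ-mono T≤H)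

    -- `K-forms` and `K-vars` allow for the forms and variables present after 2d Cauchy-Schwarz
    -- steps, `K-list` for the 2d factors of a pair together with a factor at x, `K-two` for m and
    -- m′. `K-coeff` covers differences such as b_i - b_j, and `K-shift` a translate, of size at
    -- most 3A⌊N⌋, plus a product b_i c with c ≤ d H. `A-large` keeps the shear within A⌊N⌋; its
    -- factor 2 pays for N ≤ 2⌊N⌋.
    module Pair
      (d′ : ℕ) (C₀ : ℝ) (1≤C₀ : 1# ≤ C₀) (A : ℕ) (A-large : 2# * fromℕ (suc d′ ℕ.+ suc d′) * C₀ ≤ fromℕ A)
      (K-forms : fromℕ (3 ℕ.^ (suc d′ ℕ.+ suc d′)) ≤ K) (K-vars : fromℕ ((suc d′ ℕ.+ suc d′) ℕ.* 2) ≤ K)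
      (K-list : fromℕ (suc (suc d′ ℕ.+ suc d′)) ≤ K) (K-two : fromℕ 2 ≤ K)
      (K-coeff : 2# * C₀ ≤ K) (K-shift : (2# + 1#) * fromℕ A + fromℕ (suc d′) * C₀ ≤ K)
      where

      d : ℕ
      d = suc d′

      r : ℝ
      r = C₀ * B

      0≤C₀ : 0# ≤ C₀
      0≤C₀ = ≤-trans 0≤1 1≤C₀

      0≤r : 0# ≤ r
      0≤r = *-nonNegative 0≤C₀ 0≤B

      OKvec : Vec ℤ d → Set
      OKvec = VecAll.All (λ z → fromℕ ℤ.∣ z ∣ ≤ r)

      d*C₀≤K : fromℕ d * C₀ ≤ K
      d*C₀≤K = ≤-trans (x≤y+x (*-nonNegative (+-nonNegative 0≤2 0≤1) (0≤fromℕ A))) K-shift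

      0≤K : 0# ≤ K
      0≤K = ≤-trans (0≤fromℕ 2) K-two

      coeffOK : ∀ z → fromℕ ℤ.∣ z ∣ ≤ r + r → CoeffOK z
      coeffOK z p = ≤-trans p (≤-trans (≤-reflexive (solve 2 (λ c b → c :* b :+ c :* b := :2 :* c :* b) refl C₀ B)) (*-monoˡ-≤ 0≤B K-coeff))

      coeffOK₁ : ∀ z → fromℕ ℤ.∣ z ∣ ≤ r → CoeffOK z
      coeffOK₁ z p = coeffOK z (≤-trans p (x≤x+y 0≤r))

      0-coeffOK : CoeffOK (+ 0)
      0-coeffOK = coeffOK₁ (+ 0) 0≤r

      product-bound : ∀ z c → fromℕ ℤ.∣ z ∣ ≤ r → c ℕ.≤ d ℕ.* H → fromℕ ℤ.∣ z ℤ.* + c ∣ ≤ fromℕ d * C₀ * N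
      product-bound z c p c≤ = ≤-trans (∣∣-fromℕ-* z (+ c) p (≤-trans (fromℕ-mono c≤) (≤-reflexive (fromℕ-* d H))))
        (≤-reflexive (trans (solve 4 (λ c b d h → c :* b :* (d :* h) := d :* c :* (b :* h)) refl C₀ B (fromℕ d) (fromℕ H)) (cong (fromℕ d * C₀ *_) BH≡N)))

      module _ (b b′ : Vec ℤ d) (nd : NonDegenerate b) (nd′ : NonDegenerate b′) (b≤ : OKvec b) (b′≤ : OKvec b′) where

        -- A run of m starting after c may leave [H], where the linear forms condition has no
        -- interval for it. So m keeps its range and c enters through the constant b_i c.
        leftForm rightForm : (Fin d → Tag) → ℕ → Fin d → Tag × ℤ × Vec ℤ 2
        leftForm  τ c i = τ i , lookup b i ℤ.* + c , lookup b i ∷ + 0 ∷ []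
        rightForm τ c i = τ i , lookup b′ i ℤ.* + c , + 0 ∷ lookup b′ i ∷ []

        pairForms : (τ τ′ : Fin d → Tag) → ℕ → ℕ → List (Tag × ℤ × Vec ℤ 2)
        pairForms τ τ′ c c′ = tabulate (leftForm τ c) ++ tabulate (rightForm τ′ c′)

        pairProduct : (f f′ : Fin d → ℤ → ℝ) → ℤ → ℤ → ℤ → ℝ
        pairProduct f f′ x m m′ = (∏ (allFin d) λ i → f i (x ℤ.+ lookup b i ℤ.* m)) * (∏ (allFin d) λ i → f′ i (x ℤ.+ lookup b′ i ℤ.* m′))

        ∏-pairForms : ∀ (w : Tag → ℤ → ℝ) τ τ′ c c′ x m m′ →
          ∏ (pairForms τ τ′ c c′) (λ (σ , a , e) → w σ (x ℤ.+ a ℤ.+ dot e (m ∷ m′ ∷ []))) ≡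
          pairProduct (w ∘ τ) (w ∘ τ′) x (+ c ℤ.+ m) (+ c′ ℤ.+ m′)
        ∏-pairForms w τ τ′ c c′ x m m′ = trans (∏-++ (tabulate (leftForm τ c)) (tabulate (rightForm τ′ c′)) _) (cong₂ _*_
          (bigOp-tabulate *-rawMonoid (leftForm τ c) _ (λ i → i) _ λ i → cong (w (τ i))
            (ℤS.solve 5 (λ x b c m m′ → x ℤS.:+ b ℤS.:* c ℤS.:+ (b ℤS.:* m ℤS.:+ (ℤS.con (+ 0) ℤS.:* m′ ℤS.:+ ℤS.con (+ 0))) ℤS.:= x ℤS.:+ b ℤS.:* (c ℤS.:+ m)) refl x (lookup b i) (+ c) m m′))
          (bigOp-tabulate *-rawMonoid (rightForm τ′ c′) _ (λ i → i) _ λ i → cong (w (τ′ i))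
            (ℤS.solve 5 (λ x b c m m′ → x ℤS.:+ b ℤS.:* c ℤS.:+ (ℤS.con (+ 0) ℤS.:* m ℤS.:+ (b ℤS.:* m′ ℤS.:+ ℤS.con (+ 0))) ℤS.:= x ℤS.:+ b ℤS.:* (c ℤS.:+ m′)) refl x (lookup b′ i) (+ c′) m m′)))

        length-pairForms : ∀ τ τ′ c c′ → length (pairForms τ τ′ c c′) ≡ d ℕ.+ d
        length-pairForms τ τ′ c c′ = trans (length-++ (tabulate (leftForm τ c))) (cong₂ ℕ._+_ (List.length-tabulate (leftForm τ c)) (List.length-tabulate (rightForm τ′ c′)))

        pairForms-OK : ∀ τ τ′ c c′ → c ℕ.≤ d ℕ.* H → c′ ℕ.≤ d ℕ.* H →
          All (λ (_ , a , e) → fromℕ ℤ.∣ a ∣ ≤ K * N × VecAll.All CoeffOK e) (pairForms τ τ′ c c′)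
        pairForms-OK τ τ′ c c′ c≤ c′≤ = All.++⁺
          (All.tabulate⁺ {f = leftForm τ c} λ i → small (lookup b i) c (VecAll.lookup⁺ b≤ i) c≤ , coeffOK₁ (lookup b i) (VecAll.lookup⁺ b≤ i) ∷ 0-coeffOK ∷ [])
          (All.tabulate⁺ {f = rightForm τ′ c′} λ i → small (lookup b′ i) c′ (VecAll.lookup⁺ b′≤ i) c′≤ , 0-coeffOK ∷ coeffOK₁ (lookup b′ i) (VecAll.lookup⁺ b′≤ i) ∷ [])
          where
          small : ∀ z c → fromℕ ℤ.∣ z ∣ ≤ r → c ℕ.≤ d ℕ.* H → fromℕ ℤ.∣ z ℤ.* + c ∣ ≤ K * N
          small z c p q = ≤-trans (product-bound z c p q) (*-monoˡ-≤ 0≤N d*C₀≤K)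

        Distinct : (p q : Tag × ℤ × Vec ℤ 2) → Set
        Distinct (_ , _ , e) (_ , _ , e′) = e ≢ e′

        pairForms-distinct : ∀ τ τ′ c c′ → AllPairs Distinct (pairForms τ τ′ c c′)
        pairForms-distinct τ τ′ c c′ = AllPairs.++⁺
          (AllPairs.tabulate⁺ {R = Distinct} {f = leftForm τ c} λ {i} {j} i≢j e → proj₂ nd i j i≢j (cong Vec.head e))
          (AllPairs.tabulate⁺ {R = Distinct} {f = rightForm τ′ c′} λ {i} {j} i≢j e → proj₂ nd′ i j i≢j (cong (Vec.head ∘ Vec.tail) e))
          (All.tabulate⁺ {f = leftForm τ c} λ i → All.tabulate⁺ {f = rightForm τ′ c′} λ j e → proj₁ nd i (cong Vec.head e))

        pairForms-nonZero : ∀ τ τ′ c c′ → All (Distinct (one , + 0 , + 0 ∷ + 0 ∷ [])) (pairForms τ τ′ c c′)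
        pairForms-nonZero τ τ′ c c′ = All.++⁺
          (All.tabulate⁺ {f = leftForm τ c} λ i e → proj₁ nd i (sym (cong Vec.head e)))
          (All.tabulate⁺ {f = rightForm τ′ c′} λ i e → proj₁ nd′ i (sym (cong (Vec.head ∘ Vec.tail) e)))

        longs : ∀ t → fromℕ H / L ≤ fromℕ (Interval.size (lookup (long ∷ long ∷ []) t))
        longs zero           = H/L≤H
        longs (suc zero) = H/L≤H

        long-nonEmpty : NonEmpty (elements long)
        long-nonEmpty = run-nonEmpty {0} 1≤H

        pair-linearForms : ∀ τ τ′ →
          ∣ (𝔼 [1⋯ N ] λ x → 𝔼 (run 0 H) λ m → 𝔼 (run 0 H) λ m′ → pairProduct (weight ∘ τ) (weight ∘ τ′) x m m′) -
            (𝔼 [1⋯ N ] λ x → 𝔼 (run 0 H) λ m → 𝔼 (run 0 H) λ m′ → pairProduct (λ _ → 𝟙[ N ]) (λ _ → 𝟙[ N ]) x m m′) ∣ ≤ η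
        pair-linearForms τ τ′ = subst₂ (λ u v → ∣ u - v ∣ ≤ η) (eq weight refl) (trans
            (𝔼-cong [1⋯ N ] λ x → 𝔼-cong (tuples (Vec.map elements (long ∷ long ∷ []))) λ h → ∏-map proj₂ F _)
            (eq (λ _ → 𝟙[ N ]) refl))
          (linearForms (long ∷ long ∷ []) longs F
            (subst (1 ℕ.≤_) (sym len) (ℕ.s≤s ℕ.z≤n)) (≤-trans (fromℕ-mono (ℕ.≤-trans (ℕ.≤-reflexive len) (ℕ.n≤1+n _))) K-list) K-two
            (All.map⁺ (pairForms-OK τ τ′ 0 0 ℕ.z≤n ℕ.z≤n)) (AllPairs.map⁺ (pairForms-distinct τ τ′ 0 0)))
          where
          F = pairForms τ τ′ 0 0
          len = length-pairForms τ τ′ 0 0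
          eq : ∀ w {w₁} → w₁ ≡ w → mean (long ∷ long ∷ []) (λ x h → ∏ F λ (σ , a , e) → w₁ σ (x ℤ.+ a ℤ.+ dot e h)) ≡
               𝔼 [1⋯ N ] λ x → 𝔼 (run 0 H) λ m → 𝔼 (run 0 H) λ m′ → pairProduct (w ∘ τ) (w ∘ τ′) x m m′
          eq w refl = trans (mean₂ long long _ long-nonEmpty long-nonEmpty)
            (𝔼-cong [1⋯ N ] λ x → 𝔼-cong (run 0 H) λ m → 𝔼-cong (run 0 H) λ m′ →
              trans (∏-pairForms w τ τ′ 0 0 x m m′) (cong₂ (pairProduct (w ∘ τ) (w ∘ τ′) x) (ℤ.+-identityˡ m) (ℤ.+-identityˡ m′)))

        module _ (τ τ′ : Fin d → Tag) where

          majorant : ℤ → ℤ → ℝ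
          majorant m m′ = 𝔼 [1⋯ N ] λ x → (ν x + 𝟙[ N ] x) * pairProduct (weight ∘ τ) (weight ∘ τ′) x m m′

          module _ (I I′ : Interval H) (I≥ : fromℕ H / L ≤ fromℕ (Interval.size I)) (I′≥ : fromℕ H / L ≤ fromℕ (Interval.size I′))
                   (I-nonEmpty : NonEmpty (elements I)) (I′-nonEmpty : NonEmpty (elements I′))
                   (c c′ : ℕ) (c≤ : c ℕ.≤ d ℕ.* H) (c′≤ : c′ ℕ.≤ d ℕ.* H) where

            sizes : ∀ t → fromℕ H / L ≤ fromℕ (Interval.size (lookup (I ∷ I′ ∷ []) t))
            sizes zero           = I≥
            sizes (suc zero) = I′≥

            headed : Tag → List (Tag × ℤ × Vec ℤ 2)
            headed σ = (σ , + 0 , + 0 ∷ + 0 ∷ []) ∷ pairForms τ τ′ c c′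

            headed-mean≤2 : ∀ σ → mean (I ∷ I′ ∷ []) (λ x h → ∏ (headed σ) λ (σ , a , e) → weight σ (x ℤ.+ a ℤ.+ dot e h)) ≤ 2#
            headed-mean≤2 σ = ≤-trans (≤-by (x≤y⇒0≤y-x (proj₁ (∣∣-bounds lf))) (solve 3 (λ a b e → e :+ b :- a := e :- (a :- b)) refl (mean (I ∷ I′ ∷ []) _) (mean (I ∷ I′ ∷ []) _) η))
              (+-mono-≤ η≤1 (𝔼-≤ [1⋯ N ] (run-nonEmpty {0} 1≤P) λ x _ → 𝔼-≤ (tuples (elements I ∷ elements I′ ∷ []))
                  (cpw-nonEmpty _∷_ (elements I) _ I-nonEmpty (cpw-nonEmpty _∷_ (elements I′) ([] ∷ []) I′-nonEmpty (ℕ.s≤s ℕ.z≤n))) λ h _ →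
                ≤-trans (∏-mono (List.map proj₂ (headed σ)) (λ (a , e) → 0≤𝟙 N (x ℤ.+ a ℤ.+ dot e h)) (λ (a , e) → 𝟙≤1 N (x ℤ.+ a ℤ.+ dot e h)))
                  (≤-trans (≤-reflexive (∏-const (List.map proj₂ (headed σ)) 1#)) (^-≤1 (length (List.map proj₂ (headed σ))) 0≤1 ≤-refl))))
              where
              len = length-pairForms τ τ′ c c′
              lf = linearForms (I ∷ I′ ∷ []) sizes (headed σ) (ℕ.s≤s ℕ.z≤n) (≤-trans (≤-reflexive (cong (fromℕ ∘ suc) len)) K-list) K-two
                (All.map⁺ {xs = headed σ} {f = proj₂} ((*-nonNegative 0≤K 0≤N , 0-coeffOK ∷ 0-coeffOK ∷ []) ∷ pairForms-OK τ τ′ c c′ c≤ c′≤))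
                (AllPairs.map⁺ {f = proj₂} {xs = headed σ} (pairForms-nonZero τ τ′ c c′ ∷ pairForms-distinct τ τ′ c c′))

            -- The weight ν + 1_[N] splits the mean into two, each at most 2. The extra factor at x
            -- has zero coefficients and is thus distinct from the others, since no b_i or b′_i
            -- vanishes. With one of the intervals short this is the boundary bound needed for
            -- smoothing.
            majorant-mean≤4 : 𝔼 (elements I) (λ m → 𝔼 (elements I′) λ m′ → majorant (+ c ℤ.+ m) (+ c′ ℤ.+ m′)) ≤ 2# + 2#
            majorant-mean≤4 = ≤-trans (≤-reflexive eq) (+-mono-≤ (headed-mean≤2 maj) (headed-mean≤2 one))
              where
              pp : ℤ → ℤ → ℤ → ℝ
              pp x m m′ = pairProduct (weight ∘ τ) (weight ∘ τ′) x (+ c ℤ.+ m) (+ c′ ℤ.+ m′)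
              headed-mean : ∀ σ → 𝔼 (elements I) (λ m → 𝔼 (elements I′) λ m′ → 𝔼 [1⋯ N ] λ x → weight σ x * pp x m m′) ≡
                     mean (I ∷ I′ ∷ []) (λ x h → ∏ (headed σ) λ (σ , a , e) → weight σ (x ℤ.+ a ℤ.+ dot e h))
              headed-mean σ = sym (trans (mean₂ I I′ _ I-nonEmpty I′-nonEmpty) (trans (𝔼-swap [1⋯ N ] (elements I) _)
                (𝔼-cong (elements I) λ m → trans (𝔼-swap [1⋯ N ] (elements I′) _) (𝔼-cong (elements I′) λ m′ → 𝔼-cong [1⋯ N ] λ x →
                  cong₂ _*_ (cong (weight σ) (ℤS.solve 3 (λ x m m′ → x ℤS.:+ ℤS.con (+ 0) ℤS.:+ (ℤS.con (+ 0) ℤS.:* m ℤS.:+ (ℤS.con (+ 0) ℤS.:* m′ ℤS.:+ ℤS.con (+ 0))) ℤS.:= x) refl x m m′))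
                    (∏-pairForms weight τ τ′ c c′ x m m′)))))
              eq : 𝔼 (elements I) (λ m → 𝔼 (elements I′) λ m′ → majorant (+ c ℤ.+ m) (+ c′ ℤ.+ m′)) ≡ _ + _
              eq = trans (𝔼-cong (elements I) λ m → trans (𝔼-cong (elements I′) λ m′ →
                     trans (𝔼-cong [1⋯ N ] λ x → R.distribʳ (pp x m m′) (ν x) (𝟙[ N ] x)) (𝔼-+ [1⋯ N ] _ _)) (𝔼-+ (elements I′) _ _))
                   (trans (𝔼-+ (elements I) _ _) (cong₂ _+_ (headed-mean maj) (headed-mean one)))

        module Correlation (τ τ′ : Fin d → Tag) (f f′ : Fin d → ℤ → ℝ)
          (f≤ : ∀ i z → ∣ f i z ∣ ≤ weight (τ i) z) (f′≤ : ∀ i z → ∣ f′ i z ∣ ≤ weight (τ′ i) z) where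

          correlation : ℤ → ℤ → ℝ
          correlation m m′ = 𝔼 [1⋯ N ] λ x → (ν x - 𝟙[ N ] x) * pairProduct f f′ x m m′

          ∣correlation∣≤ : ∀ m m′ → ∣ correlation m m′ ∣ ≤ majorant τ τ′ m m′
          ∣correlation∣≤ m m′ = ≤-trans (∣𝔼∣≤𝔼∣∣ [1⋯ N ] _) (𝔼-mono [1⋯ N ] λ x → ∣x*y∣≤
            (≤-trans (∣x+y∣≤ (ν x) (- 𝟙[ N ] x)) (+-mono-≤ (≤-reflexive (∣x∣≡x (0≤ν x))) (≤-reflexive (trans (∣-x∣≡∣x∣ _) (∣x∣≡x (0≤𝟙 N x))))))
            (∣x*y∣≤ (∣∏∣≤ (allFin d) λ i → f≤ i _) (∣∏∣≤ (allFin d) λ i → f′≤ i _)))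

          open Window A (3 ℕ.^ (d ℕ.+ d)) ((d ℕ.+ d) ℕ.* 2) K-forms K-vars using (ShiftOK; shiftedAverage-bound; integrand)

          Index : Set
          Index = Fin d ⊎ Fin d

          slope : Index → ℤ
          slope (inj₁ i) = lookup b i
          slope (inj₂ i) = lookup b′ i

          entry : Index → Index → ℤ
          entry (inj₁ i) (inj₁ _) = lookup b i
          entry (inj₁ _) (inj₂ _) = + 0
          entry (inj₂ _) (inj₁ _) = + 0
          entry (inj₂ i) (inj₂ _) = lookup b′ i

          -- Replacing m by m plus the total of t gives every t_j the same coefficient b_i in the
          -- i-th factor, and likewise for m′ and t′.
          row : Index → Vec ℤ (d ℕ.+ d)
          row (inj₁ i) = replicate d (lookup b i) Vec.++ replicate d (+ 0)
          row (inj₂ i) = replicate d (+ 0) Vec.++ replicate d (lookup b′ i)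

          -- The shear x ↦ x + γ · t cancels the coefficient of t_k in the k-th factor only.
          γ : Vec ℤ (d ℕ.+ d)
          γ = Vec.tabulate λ k → ℤ.- slope (Fin.splitAt d k)

          slope≢0 : ∀ s → slope s ≢ + 0
          slope≢0 (inj₁ i) = proj₁ nd i
          slope≢0 (inj₂ i) = proj₁ nd′ i

          slope≤ : ∀ s → fromℕ ℤ.∣ ℤ.- slope s ∣ ≤ r
          slope≤ s = ≤-trans (≤-reflexive (cong fromℕ (ℤ.∣-i∣≡∣i∣ (slope s)))) (bound s)
            where
            bound : ∀ s → fromℕ ℤ.∣ slope s ∣ ≤ r
            bound (inj₁ i) = VecAll.lookup⁺ b≤ i
            bound (inj₂ i) = VecAll.lookup⁺ b′≤ i

          entry≤ : ∀ s s′ → fromℕ ℤ.∣ entry s s′ ∣ ≤ r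
          entry≤ (inj₁ i) (inj₁ _) = VecAll.lookup⁺ b≤ i
          entry≤ (inj₁ _) (inj₂ _) = 0≤r
          entry≤ (inj₂ _) (inj₁ _) = 0≤r
          entry≤ (inj₂ i) (inj₂ _) = VecAll.lookup⁺ b′≤ i

          lookup-row : ∀ s j → lookup (row s) j ≡ entry s (Fin.splitAt d j)
          lookup-row (inj₁ i) j = trans (Vec.lookup-splitAt d (replicate d (lookup b i)) (replicate d (+ 0)) j) (go (Fin.splitAt d j))
            where
            go : ∀ s → [ lookup (replicate d (lookup b i)) , lookup (replicate d (+ 0)) ]′ s ≡ entry (inj₁ i) s
            go (inj₁ j) = Vec.lookup-replicate j _
            go (inj₂ j) = Vec.lookup-replicate j _
          lookup-row (inj₂ i) j = trans (Vec.lookup-splitAt d (replicate d (+ 0)) (replicate d (lookup b′ i)) j) (go (Fin.splitAt d j))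
            where
            go : ∀ s → [ lookup (replicate d (+ 0)) , lookup (replicate d (lookup b′ i)) ]′ s ≡ entry (inj₂ i) s
            go (inj₁ j) = Vec.lookup-replicate j _
            go (inj₂ j) = Vec.lookup-replicate j _

          lookup-γ : ∀ j → lookup γ j ≡ ℤ.- slope (Fin.splitAt d j)
          lookup-γ = Vec.lookup∘tabulate _

          lookup-γ⊕row : ∀ s j → lookup (γ ⊕ row s) j ≡ ℤ.- slope (Fin.splitAt d j) ℤ.+ entry s (Fin.splitAt d j)
          lookup-γ⊕row s j = trans (Vec.lookup-zipWith ℤ._+_ j γ (row s)) (cong₂ ℤ._+_ (lookup-γ j) (lookup-row s j))

          entry-diagonal : ∀ s → ℤ.- slope s ℤ.+ entry s s ≡ + 0
          entry-diagonal (inj₁ i) = ℤ.+-inverseˡ (lookup b i)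
          entry-diagonal (inj₂ i) = ℤ.+-inverseˡ (lookup b′ i)

          -- On the same side the sum is a difference of two entries of b or of two entries of b′;
          -- across the sides it is the negative of a single entry.
          entry-offDiagonal : ∀ s s′ → s′ ≢ s → ℤ.- slope s′ ℤ.+ entry s s′ ≢ + 0
          entry-offDiagonal s s′ s′≢s e = go s s′ s′≢s (ℤ.i-j≡0⇒i≡j (entry s s′) (slope s′) (trans (ℤ.+-comm (entry s s′) (ℤ.- slope s′)) e))
            where
            go : ∀ s s′ → s′ ≢ s → entry s s′ ≢ slope s′
            go (inj₁ i) (inj₁ j) s′≢s = proj₂ nd i j λ { refl → s′≢s refl }
            go (inj₁ i) (inj₂ j) _    = proj₁ nd′ j ∘ sym
            go (inj₂ i) (inj₁ j) _    = proj₁ nd j ∘ sym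
            go (inj₂ i) (inj₂ j) s′≢s = proj₂ nd′ i j λ { refl → s′≢s refl }

          splitAt-injective : ∀ (j k : Fin (d ℕ.+ d)) → Fin.splitAt d j ≡ Fin.splitAt d k → j ≡ k
          splitAt-injective j k e = trans (sym (Fin.join-splitAt d d j)) (trans (cong (Fin.join d d) e) (Fin.join-splitAt d d k))

          hollow : ∀ k → Hollow k (γ ⊕ row (Fin.splitAt d k))
          hollow k = lookup⇒Hollow k _ (trans (lookup-γ⊕row (Fin.splitAt d k) k) (entry-diagonal (Fin.splitAt d k)))
            λ j j≢k e → entry-offDiagonal (Fin.splitAt d k) (Fin.splitAt d j) (j≢k ∘ splitAt-injective j k) (trans (sym (lookup-γ⊕row (Fin.splitAt d k) j)) e)

          row-OK : ∀ s → VecAll.All CoeffOK (γ ⊕ row s)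
          row-OK s = VecAll.lookup⁻ λ j → subst CoeffOK (sym (lookup-γ⊕row s j))
            (coeffOK (ℤ.- slope (Fin.splitAt d j) ℤ.+ entry s (Fin.splitAt d j)) (∣∣-fromℕ-+ (ℤ.- slope (Fin.splitAt d j)) (entry s (Fin.splitAt d j)) (slope≤ (Fin.splitAt d j)) (entry≤ s (Fin.splitAt d j))))

          γ-OK : VecAll.All (λ z → fromℕ ℤ.∣ z ∣ ≤ r) γ
          γ-OK = VecAll.lookup⁻ λ j → subst (λ z → fromℕ ℤ.∣ z ∣ ≤ r) (sym (lookup-γ j)) (slope≤ (Fin.splitAt d j))

          shiftOK : ∀ a → fromℕ ℤ.∣ a ∣ ≤ fromℕ d * C₀ * N → ShiftOK a
          shiftOK a a≤ u u∈ with ∈-map⁻ _ u∈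
          ... | i , i∈ , refl = ≤-trans (∣∣-fromℕ-+ (+ (i ℕ.* P) ℤ.- + (A ℕ.* P)) a bound a≤)
                (≤-trans (≤-reflexive (sym (R.distribʳ N _ _))) (*-monoˡ-≤ 0≤N K-shift))
            where
            bound : fromℕ ℤ.∣ + (i ℕ.* P) ℤ.- + (A ℕ.* P) ∣ ≤ (2# + 1#) * fromℕ A * N
            bound = ≤-trans (fromℕ-mono (ℕ.≤-trans (ℤ.∣i-j∣≤∣i∣+∣j∣ (+ (i ℕ.* P)) (+ (A ℕ.* P)))
                  (ℕ.+-monoˡ-≤ (A ℕ.* P) (ℕ.*-monoˡ-≤ P (ℕ.s≤s⁻¹ (∈-upTo⁻ i∈))))))
              (≤-trans (≤-reflexive (trans (fromℕ-+ ((A ℕ.+ A) ℕ.* P) (A ℕ.* P)) (trans (cong₂ _+_ (trans (fromℕ-* (A ℕ.+ A) P) (cong (_* fromℕ P) (fromℕ-+ A A))) (fromℕ-* A P))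
                  (solve 2 (λ a p → (a :+ a) :* p :+ a :* p := (:2 :+ :1) :* a :* p) refl (fromℕ A) (fromℕ P)))))
                (*-monoʳ-≤ (*-nonNegative (+-nonNegative 0≤2 0≤1) (0≤fromℕ A)) P≤N))

          grid : ∀ n → List (Vec ℤ n)
          grid n = tuples (replicate n (run 0 T))

          γ-small : ∀ t → t ∈ grid (d ℕ.+ d) → ℤ.∣ dot γ t ∣ ℕ.≤ A ℕ.* P
          γ-small t t∈ = fromℕ-cancel-≤ (≤-trans (∣dot∣≤ γ t γ-OK (tuples-∈ (run 0 T) ≤T t t∈)) (begin
            fromℕ (d ℕ.+ d) * (r * fromℕ T)              ≤⟨ *-monoʳ-≤ (0≤fromℕ (d ℕ.+ d)) (*-monoʳ-≤ 0≤r (fromℕ-mono T≤H)) ⟩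
            fromℕ (d ℕ.+ d) * (C₀ * B * fromℕ H)         ≈⟨ cong (fromℕ (d ℕ.+ d) *_) (trans (R.*-assoc C₀ B _) (cong (C₀ *_) BH≡N)) ⟩
            fromℕ (d ℕ.+ d) * (C₀ * N)                   ≤⟨ *-monoʳ-≤ (0≤fromℕ (d ℕ.+ d)) (*-monoʳ-≤ 0≤C₀ (x≤2⌊x⌋ 1≤N)) ⟩
            fromℕ (d ℕ.+ d) * (C₀ * (2# * fromℕ P))      ≈⟨ solve 3 (λ n c p → n :* (c :* (:2 :* p)) := :2 :* n :* c :* p) refl (fromℕ (d ℕ.+ d)) C₀ (fromℕ P) ⟩
            2# * fromℕ (d ℕ.+ d) * C₀ * fromℕ P          ≤⟨ *-monoˡ-≤ (0≤fromℕ P) A-large ⟩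
            fromℕ A * fromℕ P                            ≈⟨ sym (fromℕ-* A P) ⟩
            fromℕ (A ℕ.* P)                              ∎))
            where
            open ≤-Reasoning
            ≤T : ∀ y → y ∈ run 0 T → fromℕ ℤ.∣ y ∣ ≤ fromℕ T
            ≤T y y∈ with ∈-run {0} y∈
            ... | i , i<T , refl = fromℕ-mono i<T

          weights : Index → ℤ → ℝ
          weights (inj₁ i) = f i
          weights (inj₂ i) = f′ i

          tags : Index → Tag
          tags (inj₁ i) = τ i
          tags (inj₂ i) = τ′ i

          weights≤ : ∀ s z → ∣ weights s z ∣ ≤ weight (tags s) z
          weights≤ (inj₁ i) = f≤ i
          weights≤ (inj₂ i) = f′≤ i

          U : ℝ
          U = fromℕ (suc (A ℕ.+ A))

          module _ {ρ : ℝ} (root : ∀ t → 0# ≤ t → t ^ (2 ℕ.^ (d ℕ.+ d)) ≤ η → t ≤ ρ) where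

            module _ (m m′ : ℤ) (m∈ : m ∈ run 0 H) (m′∈ : m′ ∈ run 0 H) where

              start : Index → ℤ
              start (inj₁ i) = lookup b i ℤ.* m
              start (inj₂ i) = lookup b′ i ℤ.* m′

              start-OK : ∀ s → ShiftOK (start s)
              start-OK (inj₁ i) with ∈-run {0} m∈
              ... | j , j<H , refl = shiftOK (lookup b i ℤ.* m) (product-bound (lookup b i) (suc j) (VecAll.lookup⁺ b≤ i) (ℕ.≤-trans j<H (ℕ.m≤m+n H _)))
              start-OK (inj₂ i) with ∈-run {0} m′∈
              ... | j , j<H , refl = shiftOK (lookup b′ i ℤ.* m′) (product-bound (lookup b′ i) (suc j) (VecAll.lookup⁺ b′≤ i) (ℕ.≤-trans j<H (ℕ.m≤m+n H _)))

              0-OK : ShiftOK (+ 0)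
              0-OK = shiftOK (+ 0) (*-nonNegative (*-nonNegative (0≤fromℕ d) 0≤C₀) 0≤N)

              shifted-eq : 𝔼 (grid (d ℕ.+ d)) (λ t → 𝔼 [1⋯ N ] λ x → (ν x - 𝟙[ N ] x) * ∏ (allFin (d ℕ.+ d)) λ k →
                             weights (Fin.splitAt d k) (x ℤ.+ (start (Fin.splitAt d k) ℤ.+ dot (row (Fin.splitAt d k)) t))) ≡
                           𝔼 (grid d) (λ t → 𝔼 (grid d) λ t′ → correlation (total t ℤ.+ m) (total t′ ℤ.+ m′))
              shifted-eq = trans (𝔼-tuples-++ (run 0 T) (run-nonEmpty {0} 1≤T) d d _)
                (𝔼-cong (grid d) λ t → 𝔼-cong (grid d) λ t′ → 𝔼-cong [1⋯ N ] λ x → cong ((ν x - 𝟙[ N ] x) *_)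
                  (trans (∏-allFin-⊎ d d λ s → weights s (x ℤ.+ (start s ℤ.+ dot (row s) (t Vec.++ t′)))) (cong₂ _*_
                    (∏-cong (allFin d) λ i → cong (f i) (trans
                      (cong (λ z → x ℤ.+ (lookup b i ℤ.* m ℤ.+ z)) (trans (dot-++ (replicate d (lookup b i)) (replicate d (+ 0)) t t′) (cong₂ ℤ._+_ (dot-replicate (lookup b i) t) (dot-replicate (+ 0) t′))))
                      (ℤS.solve 5 (λ x b m s s′ → x ℤS.:+ (b ℤS.:* m ℤS.:+ (b ℤS.:* s ℤS.:+ ℤS.con (+ 0) ℤS.:* s′)) ℤS.:= x ℤS.:+ b ℤS.:* (s ℤS.:+ m)) refl x (lookup b i) m (total t) (total t′))))
                    (∏-cong (allFin d) λ i → cong (f′ i) (trans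
                      (cong (λ z → x ℤ.+ (lookup b′ i ℤ.* m′ ℤ.+ z)) (trans (dot-++ (replicate d (+ 0)) (replicate d (lookup b′ i)) t t′) (cong₂ ℤ._+_ (dot-replicate (+ 0) t) (dot-replicate (lookup b′ i) t′))))
                      (ℤS.solve 5 (λ x b m s s′ → x ℤS.:+ (b ℤS.:* m ℤS.:+ (ℤS.con (+ 0) ℤS.:* s ℤS.:+ b ℤS.:* s′)) ℤS.:= x ℤS.:+ b ℤS.:* (s′ ℤS.:+ m)) refl x (lookup b′ i) m′ (total t) (total t′)))))))

              shifted-bound : ∣ 𝔼 (grid d) (λ t → 𝔼 (grid d) λ t′ → correlation (total t ℤ.+ m) (total t′ ℤ.+ m′)) ∣ ≤
                              U * (2# * 2# ^ (3 ℕ.^ (d ℕ.+ d)) * ρ)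
              shifted-bound = subst (λ z → ∣ z ∣ ≤ U * (2# * 2# ^ (3 ℕ.^ (d ℕ.+ d)) * ρ)) shifted-eq
                (shiftedAverage-bound (d′ ℕ.+ suc d′) ℕ.≤-refl ℕ.≤-refl γ (row ∘ Fin.splitAt d) (start ∘ Fin.splitAt d)
                  (VecAll.lookup⁻ λ j e → slope≢0 (Fin.splitAt d j) (neg≡0 _ (trans (sym (lookup-γ j)) e)))
                  (VecAll.map (λ {z} → coeffOK₁ z) γ-OK) hollow (row-OK ∘ Fin.splitAt d) 0-OK (start-OK ∘ Fin.splitAt d)
                  γ-small (weights ∘ Fin.splitAt d) (tags ∘ Fin.splitAt d) (weights≤ ∘ Fin.splitAt d) root)
                where
                neg≡0 : ∀ i → ℤ.- i ≡ + 0 → i ≡ + 0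
                neg≡0 i e = trans (sym (ℤ.neg-involutive i)) (cong ℤ.-_ e)

            boundary-error main-error : ℝ
            boundary-error = fromℕ d * (2# * (2# + 2#) * (fromℕ T / fromℕ H))
            main-error     = U * (2# * 2# ^ (3 ℕ.^ (d ℕ.+ d)) * ρ)

            0≤4 : 0# ≤ 2# + 2#
            0≤4 = +-nonNegative 0≤2 0≤2

            hs-nonEmpty : NonEmpty (run 0 H)
            hs-nonEmpty = run-nonEmpty {0} 1≤H

            ts-nonEmpty : NonEmpty (run 0 T)
            ts-nonEmpty = run-nonEmpty {0} 1≤T

            grid-nonEmpty : ∀ n → NonEmpty (grid n)
            grid-nonEmpty n = tuples-nonEmpty (replicate n (run 0 T)) λ i → subst NonEmpty (sym (Vec.lookup-replicate i (run 0 T))) ts-nonEmpty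

            dT≤dH : d ℕ.* T ℕ.≤ d ℕ.* H
            dT≤dH = ℕ.*-monoʳ-≤ d T≤H

            average₁ average₁⁺ : ℤ → ℝ
            average₁  m = 𝔼 (run 0 H) λ m′ → correlation m m′
            average₁⁺ m = 𝔼 (run 0 H) λ m′ → majorant τ τ′ m m′

            average₂ average₂⁺ : ℤ → ℤ → ℝ
            average₂  s m′ = 𝔼 (run 0 H) λ m → correlation (s ℤ.+ m) m′
            average₂⁺ s m′ = 𝔼 (run 0 H) λ m → majorant τ τ′ (s ℤ.+ m) m′

            module S₁ = Smoothing H T 1≤H 1≤T T≤H average₁ average₁⁺
              (λ m → ≤-trans (∣𝔼∣≤𝔼∣∣ (run 0 H) _) (𝔼-mono (run 0 H) λ m′ → ∣correlation∣≤ m m′))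
            module S₂ (s : ℤ) = Smoothing H T 1≤H 1≤T T≤H (average₂ s) (average₂⁺ s)
              (λ m′ → ≤-trans (∣𝔼∣≤𝔼∣∣ (run 0 H) _) (𝔼-mono (run 0 H) λ m → ∣correlation∣≤ (s ℤ.+ m) m′))

            inner outer : Vec ℤ d → ℝ
            inner t = 𝔼 (run 0 H) λ m → average₁ (+ 0 ℤ.+ total t ℤ.+ m)
            outer t = 𝔼 (grid d) λ t′ → 𝔼 (run 0 H) λ m′ → average₂ (total t) (+ 0 ℤ.+ total t′ ℤ.+ m′)

            whole : ℝ
            whole = 𝔼 (run 0 H) λ m → 𝔼 (run 0 H) λ m′ → correlation m m′

            first : ∣ whole - 𝔼 (grid d) inner ∣ ≤ boundary-error
            first = subst (λ z → ∣ z - 𝔼 (grid d) inner ∣ ≤ boundary-error)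
              (𝔼-cong (run 0 H) λ m → 𝔼-cong (run 0 H) λ m′ → cong (λ z → correlation z m′) (ℤ.+-identityˡ m))
              (S₁.smoothing (2# + 2#) 0≤4 d 0 λ c c≤ → ≤-trans
                (≤-reflexive (𝔼-cong (run 0 T) λ m → 𝔼-cong (run 0 H) λ m′ → cong (majorant τ τ′ (+ c ℤ.+ m)) (sym (ℤ.+-identityˡ m′))))
                (majorant-mean≤4 τ τ′ short long H/L≤T H/L≤H ts-nonEmpty hs-nonEmpty c 0 c≤ ℕ.z≤n))

            -- By now m has been moved by the total of t, at most d T ≤ d H, so the boundary bound
            -- in m′ is needed for an m-run with that later start.
            second : ∀ t → t ∈ grid d → ∣ inner t - outer t ∣ ≤ boundary-error
            second t t∈ = subst (λ z → ∣ z - outer t ∣ ≤ boundary-error)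
              (trans (𝔼-swap (run 0 H) (run 0 H) _) (𝔼-cong (run 0 H) λ m → 𝔼-cong (run 0 H) λ m′ →
                cong₂ correlation (cong (ℤ._+ m) (sym (ℤ.+-identityˡ (total t)))) (ℤ.+-identityˡ m′)))
              (S₂.smoothing (total t) (2# + 2#) 0≤4 d 0 boundary)
              where
              total-t : ∃ λ c → c ℕ.≤ d ℕ.* T × total t ≡ + c
              total-t = total-run t (tuples-∈ (run 0 T) (λ y → ∈-run {0}) t t∈)
              boundary : ∀ c → c ℕ.≤ d ℕ.* H → 𝔼 (run 0 T) (λ m′ → average₂⁺ (total t) (+ c ℤ.+ m′)) ≤ 2# + 2#
              boundary c c≤ with total-t
              ... | e , e≤ , eq = ≤-trans (≤-reflexive (trans (𝔼-swap (run 0 T) (run 0 H) _)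
                  (𝔼-cong (run 0 H) λ m → 𝔼-cong (run 0 T) λ m′ → cong (λ z → majorant τ τ′ (z ℤ.+ m) (+ c ℤ.+ m′)) eq)))
                (majorant-mean≤4 τ τ′ long short H/L≤H H/L≤T hs-nonEmpty ts-nonEmpty e c (ℕ.≤-trans e≤ dT≤dH) c≤)

            third : ∣ 𝔼 (grid d) outer ∣ ≤ main-error
            third = subst (λ z → ∣ z ∣ ≤ main-error) (sym eq)
              (∣𝔼∣≤ (run 0 H) hs-nonEmpty λ m′ m′∈ → ∣𝔼∣≤ (run 0 H) hs-nonEmpty λ m m∈ → shifted-bound m m′ m∈ m′∈)
              where
              eq : 𝔼 (grid d) outer ≡ 𝔼 (run 0 H) λ m′ → 𝔼 (run 0 H) λ m → 𝔼 (grid d) λ t → 𝔼 (grid d) λ t′ → correlation (total t ℤ.+ m) (total t′ ℤ.+ m′)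
              eq = trans (𝔼-cong (grid d) λ t → trans (𝔼-swap (grid d) (run 0 H) _) (𝔼-cong (run 0 H) λ m′ → 𝔼-swap (grid d) (run 0 H) _))
                (trans (𝔼-swap (grid d) (run 0 H) _) (𝔼-cong (run 0 H) λ m′ → trans (𝔼-swap (grid d) (run 0 H) _)
                  (𝔼-cong (run 0 H) λ m → 𝔼-cong (grid d) λ t → 𝔼-cong (grid d) λ t′ →
                    cong (λ z → correlation (total t ℤ.+ m) (z ℤ.+ m′)) (ℤ.+-identityˡ (total t′)))))

            -- Smooth in m, then in m′, each at a boundary cost; what remains is bounded by the von
            -- Neumann inequality separately for every fixed m and m′.
            correlation-bound : ∣ whole ∣ ≤ boundary-error + (boundary-error + main-error)
            correlation-bound = ≤-trans (≤-reflexive (cong ∣_∣ (solve 3 (λ w i o → w := (w :- i) :+ ((i :- o) :+ o)) refl whole (𝔼 (grid d) inner) (𝔼 (grid d) outer))))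
              (≤-trans (∣x+y∣≤ _ _) (+-mono-≤ first (≤-trans (∣x+y∣≤ _ _) (+-mono-≤
                (≤-trans (≤-reflexive (cong ∣_∣ (sym (𝔼-- (grid d) inner outer)))) (∣𝔼∣≤ (grid d) (grid-nonEmpty d) second)) third))))

      -- Summation over the box of vectors b

      module Box (1≤B : 1# ≤ B) where

        Q : ℕ
        Q = ⌊ r ⌋

        axis : List ℤ
        axis = [- Q , Q ]

        box : List (Vec ℤ d)
        box = tuples (replicate d axis)

        -- `w₀` equals H/M, the normalisation left in the dual function once its sum over m is
        -- written as a mean. Thus `w₀ * side ^ d` is the normalised number of vectors, bounded in
        -- terms of C₀ and d.
        side σ w₀ : ℝ
        side = fromℕ (length axis)
        σ    = 2# * C₀ + 1#
        w₀   = (B ^ d) ⁻¹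

        B>0 : Positive B
        B>0 = 1≤⇒pos 1≤B

        0≤w₀ : 0# ≤ w₀
        0≤w₀ = proj₁ (⁻¹-pos (^-pos d B>0))

        0≤σ : 0# ≤ σ
        0≤σ = +-nonNegative (*-nonNegative 0≤2 0≤C₀) 0≤1

        side≡ : side ≡ 1# + (fromℕ Q + fromℕ Q)
        side≡ = trans (cong fromℕ (trans (length-map _ (upTo (suc (Q ℕ.+ Q)))) (length-upTo (suc (Q ℕ.+ Q))))) (cong (λ z → 1# + z) (fromℕ-+ Q Q))

        0≤side : 0# ≤ side
        0≤side = 0≤fromℕ (length axis)

        Q≤r : fromℕ Q ≤ r
        Q≤r = ⌊⌋-≤ 0≤r

        side≤ : ∀ {c} → C₀ ≤ c → side ≤ (2# * c + 1#) * B
        side≤ {c} C₀≤c = ≤-trans (≤-reflexive side≡) (≤-trans (+-mono-≤ 1≤B (+-mono-≤ Q≤cB Q≤cB))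
          (≤-reflexive (solve 2 (λ b c → b :+ (c :* b :+ c :* b) := (:2 :* c :+ :1) :* b) refl B c)))
          where
          Q≤cB : fromℕ Q ≤ c * B
          Q≤cB = ≤-trans Q≤r (*-monoˡ-≤ 0≤B C₀≤c)

        B≤side : B ≤ side
        B≤side = ≤-trans (≤-trans (≤-reflexive (sym (R.*-identityˡ B))) (*-monoˡ-≤ 0≤B 1≤C₀)) (≤-trans (≤-suc-⌊⌋ r)
          (≤-trans (+-monoʳ-≤ 1# (x≤x+y (0≤fromℕ Q))) (≤-reflexive (sym side≡))))

        axis-unique : Unique axis
        axis-unique = Unique.map⁺ (λ {i} {j} e → ℤ.+-injective (trans (sym (restore (+ i))) (trans (cong (ℤ._+ + Q) e) (restore (+ j))))) (Unique.upTo⁺ (suc (Q ℕ.+ Q)))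
          where
          restore : ∀ i → i ℤ.- + Q ℤ.+ + Q ≡ i
          restore i = ℤS.solve 2 (λ i q → i ℤS.:- q ℤS.:+ q ℤS.:= i) refl i (+ Q)

        axis-bounded : ∀ z → z ∈ axis → fromℕ ℤ.∣ z ∣ ≤ r
        axis-bounded z z∈ with ∈-map⁻ _ z∈
        ... | i , i∈ , refl = ≤-trans (fromℕ-mono (subst (λ z → ℤ.∣ z ∣ ℕ.≤ Q) (sym (ℤ.m-n≡m⊖n i Q)) bound)) Q≤r
          where
          bound : ℤ.∣ i ℤ.⊖ Q ∣ ℕ.≤ Q
          bound with ℕ.≤-total Q i
          ... | inj₁ Q≤i = ℕ.≤-trans (ℕ.≤-reflexive (cong ℤ.∣_∣ (ℤ.⊖-≥ Q≤i))) (ℕ.m≤n+o⇒m∸n≤o i Q (ℕ.s≤s⁻¹ (∈-upTo⁻ i∈)))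
          ... | inj₂ i≤Q = ℕ.≤-trans (ℕ.≤-reflexive (ℤ.∣⊖∣-≤ i≤Q)) (ℕ.m∸n≤m Q i)

        box-OK : ∀ b → b ∈ box → OKvec b
        box-OK = tuples-∈ axis axis-bounded

        w₀*side^d≤ : ∀ {c} → C₀ ≤ c → w₀ * side ^ d ≤ (2# * c + 1#) ^ d
        w₀*side^d≤ {c} C₀≤c = ≤-trans (*-monoʳ-≤ 0≤w₀ (≤-trans (^-monoˡ-≤ d 0≤side (side≤ C₀≤c)) (≤-reflexive (Exp.^-distrib-* (2# * c + 1#) B d))))
          (≤-reflexive (trans (solve 3 (λ w s b → w :* (s :* b) := s :* (b :* w)) refl w₀ ((2# * c + 1#) ^ d) (B ^ d))
            (trans (cong ((2# * c + 1#) ^ d *_) (x*x⁻¹ (^-pos d B>0))) (R.*-identityʳ _))))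

        -- Since C₀ ≥ 1 the side of the box is at least B, so degenerate vectors are a proportion
        -- O(1/B) of the box.
        ∑-box-degeneracy : ∑ box degeneracy ≤ fromℕ d * fromℕ d * side ^ d / B
        ∑-box-degeneracy = a*y≤x⇒a≤x/y B>0 (≤-trans (≤-reflexive (R.*-comm _ B))
          (≤-trans (*-monoˡ-≤ (∑-nonNegative box 0≤degeneracy) B≤side) (∑-degeneracy axis-unique d)))

        gramConstant : ℝ → ℝ → ℝ
        gramConstant ε R′ = ε + 2# * (fromℕ d * fromℕ d) * (R′ / B)

        -- Shared by both estimates. The first takes ω = ν - 1_[N] and as `combination` the real or
        -- the imaginary part of D; the second takes ω = 1 and the difference between the majorant
        -- of D and its constant part. In `pair` every coincidence in b or b′ is charged R′.
        module Gram {E : Set} (es : List E) (κ : Vec ℤ d × E → ℝ) (∣κ∣≤2 : ∀ o → ∣ κ o ∣ ≤ 2#) (V : Vec ℤ d × E → ℤ → ℝ)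
          (ω : ℤ → ℝ) (ε R′ : ℝ) (0≤ε : 0# ≤ ε) (0≤R′ : 0# ≤ R′)
          (pair : ∀ b b′ → b ∈ box → b′ ∈ box → ∀ e e′ →
            ∣ 𝔼 [1⋯ N ] (λ x → ω x * (V (b , e) x * V (b′ , e′) x)) ∣ ≤ ε + (degeneracy b + degeneracy b′) * R′) where

          Ω : List (Vec ℤ d × E)
          Ω = cartesianProductWith _,_ box es

          combination : ℤ → ℝ
          combination x = w₀ * ∑ Ω λ o → κ o * V o x

          corr : Vec ℤ d × E → Vec ℤ d × E → ℝ
          corr o o′ = 𝔼 [1⋯ N ] λ x → ω x * (V o x * V o′ x)

          bound : Vec ℤ d → Vec ℤ d → ℝ
          bound b b′ = ε + (degeneracy b + degeneracy b′) * R′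

          n S Δ : ℝ
          n = fromℕ (length es)
          S = side ^ d
          Δ = ∑ box degeneracy

          𝔼-∑ : ∀ {X : Set} (ys : List X) (F : ℤ → X → ℝ) → 𝔼 [1⋯ N ] (λ x → ∑ ys (F x)) ≡ ∑ ys λ y → 𝔼 [1⋯ N ] λ x → F x y
          𝔼-∑ ys F = trans (cong (_/ fromℕ (length [1⋯ N ])) (∑-swap [1⋯ N ] ys F)) (sym (∑-*ʳ ys _ _))

          expansion : 𝔼 [1⋯ N ] (λ x → ω x * (combination x * combination x)) ≡ w₀ * w₀ * ∑ Ω (λ o → ∑ Ω λ o′ → κ o * κ o′ * corr o o′)
          expansion = trans (𝔼-cong [1⋯ N ] λ x → trans
              (solve 3 (λ o w s → o :* (w :* s :* (w :* s)) := w :* w :* (o :* (s :* s))) refl (ω x) w₀ (∑ Ω λ o → κ o * V o x))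
              (cong (w₀ * w₀ *_) (trans (cong (ω x *_) (∑-*-∑ Ω Ω _ _)) (trans (sym (∑-*ˡ Ω (ω x) _)) (∑-cong Ω λ o → trans (sym (∑-*ˡ Ω (ω x) _))
                (∑-cong Ω λ o′ → solve 5 (λ w k u l v → w :* (k :* u :* (l :* v)) := k :* l :* (w :* (u :* v))) refl (ω x) (κ o) (V o x) (κ o′) (V o′ x)))))))
            (trans (𝔼-*ˡ [1⋯ N ] (w₀ * w₀) _) (cong (w₀ * w₀ *_) (trans (𝔼-∑ Ω _) (∑-cong Ω λ o → trans (𝔼-∑ Ω _) (∑-cong Ω λ o′ → 𝔼-*ˡ [1⋯ N ] (κ o * κ o′) _)))))

          ∑-Ω : ∀ (F : Vec ℤ d → ℝ) → ∑ Ω (F ∘ proj₁) ≡ n * ∑ box F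
          ∑-Ω F = trans (∑-cartesianProductWith _,_ box es _) (trans (∑-cong box λ b → ∑-const es (F b)) (∑-*ˡ box n F))

          ∑-box-const : ∀ c → ∑ box (λ _ → c) ≡ S * c
          ∑-box-const c = trans (∑-const box c) (cong (_* c) (length-tuples axis d))

          ∑-bound : ∑ Ω (λ o → ∑ Ω λ o′ → bound (proj₁ o) (proj₁ o′)) ≡ n * n * (S * S * ε + 2# * (S * Δ * R′))
          ∑-bound = begin
            ∑ Ω (λ o → ∑ Ω λ o′ → bound (proj₁ o) (proj₁ o′))
              ≡⟨ ∑-cong Ω (λ o → trans (∑-Ω (bound (proj₁ o))) (cong (n *_) (inner (proj₁ o)))) ⟩
            ∑ Ω (λ o → n * (S * (ε + degeneracy (proj₁ o) * R′) + Δ * R′))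
              ≡⟨ ∑-Ω (λ b → n * (S * (ε + degeneracy b * R′) + Δ * R′)) ⟩
            n * ∑ box (λ b → n * (S * (ε + degeneracy b * R′) + Δ * R′))
              ≡⟨ cong (n *_) (trans (∑-*ˡ box n _) (cong (n *_) outer)) ⟩
            n * (n * (S * (S * ε + Δ * R′) + S * (Δ * R′)))
              ≡⟨ solve 5 (λ n s e d r → n :* (n :* (s :* (s :* e :+ d :* r) :+ s :* (d :* r))) := n :* n :* (s :* s :* e :+ :2 :* (s :* d :* r))) refl n S ε Δ R′ ⟩
            n * n * (S * S * ε + 2# * (S * Δ * R′)) ∎
            where
            open ≡-Reasoning
            inner : ∀ b → ∑ box (bound b) ≡ S * (ε + degeneracy b * R′) + Δ * R′
            inner b = trans (∑-cong box λ b′ → solve 4 (λ e x y r → e :+ (x :+ y) :* r := (e :+ x :* r) :+ y :* r) refl ε (degeneracy b) (degeneracy b′) R′)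
              (trans (∑-+ box _ _) (cong₂ _+_ (∑-box-const (ε + degeneracy b * R′)) (∑-*ʳ box R′ degeneracy)))
            outer : ∑ box (λ b → S * (ε + degeneracy b * R′) + Δ * R′) ≡ S * (S * ε + Δ * R′) + S * (Δ * R′)
            outer = trans (∑-+ box _ _) (cong₂ _+_
              (trans (∑-*ˡ box S _) (cong (S *_) (trans (∑-+ box _ _) (cong₂ _+_ (∑-box-const ε) (∑-*ʳ box R′ degeneracy)))))
              (∑-box-const (Δ * R′)))

          ∈-Ω : ∀ o → o ∈ Ω → proj₁ o ∈ box
          ∈-Ω o o∈ with ∈-cartesianProductWith⁻ _,_ box es o∈
          ... | _ , _ , b∈ , _ , refl = b∈

          -- The factor w₀² offsets the number of pairs (b, b′), since w₀ times the size of the box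
          -- is at most σ^d. Up to constants only the mean of the pair bounds is left, and averaging
          -- the degeneracy brings in 1/B.
          gram-bound : ∣ 𝔼 [1⋯ N ] (λ x → ω x * (combination x * combination x)) ∣ ≤ (2# * 2# * (n * n)) * (σ ^ d * σ ^ d) * gramConstant ε R′
          gram-bound = begin
            ∣ 𝔼 [1⋯ N ] (λ x → ω x * (combination x * combination x)) ∣
              ≈⟨ cong ∣_∣ expansion ⟩
            ∣ w₀ * w₀ * ∑ Ω (λ o → ∑ Ω λ o′ → κ o * κ o′ * corr o o′) ∣
              ≤⟨ ∣x*y∣≤ (≤-reflexive (∣x∣≡x 0≤w₀²)) termwise ⟩
            w₀ * w₀ * (2# * 2# * ∑ Ω (λ o → ∑ Ω λ o′ → bound (proj₁ o) (proj₁ o′)))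
              ≈⟨ cong (λ z → w₀ * w₀ * (2# * 2# * z)) ∑-bound ⟩
            w₀ * w₀ * (2# * 2# * (n * n * (S * S * ε + 2# * (S * Δ * R′))))
              ≤⟨ *-monoʳ-≤ 0≤w₀² (*-monoʳ-≤ 0≤4 (*-monoʳ-≤ (*-nonNegative 0≤n 0≤n) (+-monoʳ-≤ (S * S * ε) (*-monoʳ-≤ 0≤2 (*-monoˡ-≤ 0≤R′ (*-monoʳ-≤ 0≤S ∑-box-degeneracy)))))) ⟩
            w₀ * w₀ * (2# * 2# * (n * n * (S * S * ε + 2# * (S * (fromℕ d * fromℕ d * S / B) * R′))))
              ≈⟨ solve 7 (λ w n s e d b r → w :* w :* (:2 :* :2 :* (n :* n :* (s :* s :* e :+ :2 :* (s :* (d :* d :* s :* b) :* r))))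
                   := :2 :* :2 :* (n :* n) :* (w :* s :* (w :* s)) :* (e :+ :2 :* (d :* d) :* (r :* b))) refl w₀ n S ε (fromℕ d) (B ⁻¹) R′ ⟩
            (2# * 2# * (n * n)) * (w₀ * S * (w₀ * S)) * gramConstant ε R′
              ≤⟨ *-monoˡ-≤ 0≤gram (*-monoʳ-≤ (*-nonNegative 0≤4 (*-nonNegative 0≤n 0≤n)) (*-mono-≤ (0≤^ d 0≤σ) 0≤w₀S (w₀*side^d≤ ≤-refl) (w₀*side^d≤ ≤-refl))) ⟩
            (2# * 2# * (n * n)) * (σ ^ d * σ ^ d) * gramConstant ε R′ ∎
            where
            open ≤-Reasoning
            0≤w₀² : 0# ≤ w₀ * w₀
            0≤w₀² = *-nonNegative 0≤w₀ 0≤w₀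
            0≤4 : 0# ≤ 2# * 2#
            0≤4 = *-nonNegative 0≤2 0≤2
            0≤n : 0# ≤ n
            0≤n = 0≤fromℕ (length es)
            0≤S : 0# ≤ S
            0≤S = 0≤^ d 0≤side
            0≤w₀S : 0# ≤ w₀ * S
            0≤w₀S = *-nonNegative 0≤w₀ 0≤S
            0≤gram : 0# ≤ gramConstant ε R′
            0≤gram = +-nonNegative 0≤ε (*-nonNegative (*-nonNegative 0≤2 (*-nonNegative (0≤fromℕ d) (0≤fromℕ d))) (*-nonNegative 0≤R′ (proj₁ (⁻¹-pos B>0))))
            termwise : ∣ ∑ Ω (λ o → ∑ Ω λ o′ → κ o * κ o′ * corr o o′) ∣ ≤ 2# * 2# * ∑ Ω (λ o → ∑ Ω λ o′ → bound (proj₁ o) (proj₁ o′))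
            termwise = ≤-trans (∣∑∣≤ Ω _) (≤-trans (∑-mono-∈ Ω λ o o∈ → ≤-trans (∣∑∣≤ Ω _) (∑-mono-∈ Ω λ o′ o′∈ →
                ∣x*y∣≤ (∣x*y∣≤ (∣κ∣≤2 o) (∣κ∣≤2 o′)) (pair (proj₁ o) (proj₁ o′) (∈-Ω o o∈) (∈-Ω o′ o′∈) (proj₂ o) (proj₂ o′))))
              (≤-reflexive (trans (∑-cong Ω λ o → ∑-*ˡ Ω (2# * 2#) _) (∑-*ˡ Ω (2# * 2#) _))))

      -- ρ stands for the root of η*. It enters only by dominating η, T/H and every t ≥ 0 whose
      -- power with exponent 2^(2d) is at most η.
      module Estimates
        (1≤B : 1# ≤ B) (ρ : ℝ) (0≤ρ : 0# ≤ ρ) (η≤ρ : η ≤ ρ) (T/H≤ρ : fromℕ T / fromℕ H ≤ ρ)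
        (root : ∀ t → 0# ≤ t → t ^ (2 ℕ.^ (d ℕ.+ d)) ≤ η → t ≤ ρ)
        (g : Fin d → ℤ → ℂ) (τ : Fin d → Tag) (g⊑ : ∀ i z → g i z ⊑ weight (τ i) z)
        (μ : Vec ℤ d → ℂ) (μ⊑1 : ∀ b → μ b ⊑ 1#)
        where

        open Box 1≤B

        M Rν R^C : ℝ
        M   = B ^ d′ * N
        Rν  = Rsup N ν
        R^C = Rν ^ suc (d ℕ.+ d)

        inner : Vec ℤ d → ℤ → ℂ
        inner b x = ∑ℂ (run 0 H) λ m → ∏ℂ (allFin d) λ i → g i (x ℤ.+ lookup b i ℤ.* m)

        D : ℤ → ℂ
        D x = (1# / M) • ∑ℂ box λ b → μ b *ℂ inner b x

        hs-nonEmpty : NonEmpty (run 0 H)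
        hs-nonEmpty = run-nonEmpty {0} 1≤H

        P-nonEmpty : NonEmpty [1⋯ N ]
        P-nonEmpty = run-nonEmpty {0} 1≤P

        M>0 : Positive M
        M>0 = *-pos (^-pos d′ B>0) (1≤⇒pos 1≤N)

        1/M*H≡w₀ : 1# / M * fromℕ H ≡ w₀
        1/M*H≡w₀ = ⁻¹-unique (trans (solve 4 (λ b p m h → b :* p :* (:1 :* m :* h) := p :* (b :* h) :* m) refl B (B ^ d′) (M ⁻¹) (fromℕ H))
          (trans (cong (λ z → B ^ d′ * z * M ⁻¹) BH≡N) (x*x⁻¹ M>0)))

        0≤1/M : 0# ≤ 1# / M
        0≤1/M = *-nonNegative 0≤1 (proj₁ (⁻¹-pos M>0))

        ∑≡H*𝔼 : ∀ (F : ℤ → ℝ) → ∑ (run 0 H) F ≡ fromℕ H * 𝔼 (run 0 H) F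
        ∑≡H*𝔼 F = sym (trans (cong (λ n → fromℕ H * (∑ (run 0 H) F / fromℕ n)) (length-run 0 H)) (trans (R.*-comm (fromℕ H) _) (/-cancel H>0)))

        1≤Rν : 1# ≤ Rν
        1≤Rν = 1≤Rsup N ν

        0≤Rν : 0# ≤ Rν
        0≤Rν = ≤-trans 0≤1 1≤Rν

        0≤R^C : 0# ≤ R^C
        0≤R^C = 0≤^ (suc (d ℕ.+ d)) 0≤Rν

        0≤R^d : 0# ≤ Rν ^ d
        0≤R^d = 0≤^ d 0≤Rν

        weight≤Rν : ∀ σ z → weight σ z ≤ Rν
        weight≤Rν maj z = ≤-Rsup N ν ν-supp z
        weight≤Rν one z = ≤-trans (𝟙≤1 N z) 1≤Rν

        ∣∏∣≤R^d : ∀ {f : Fin d → ℝ} → (∀ i → ∣ f i ∣ ≤ Rν) → ∣ ∏ (allFin d) f ∣ ≤ Rν ^ d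
        ∣∏∣≤R^d p = ≤-trans (∣∏∣≤ (allFin d) p) (≤-reflexive (trans (∏-const (allFin d) Rν) (cong (Rν ^_) (List.length-tabulate {n = d} (λ i → i)))))

        -- One additive formula covers both cases: a nondegenerate pair is paid for by ε alone, and
        -- in a degenerate one the coefficient of R′ is at least 1.
        degenerate-bound : ∀ (b b′ : Vec ℤ d) {v ε R′} → 0# ≤ ε → 0# ≤ R′ → ∣ v ∣ ≤ R′ → (NonDegenerate b → NonDegenerate b′ → ∣ v ∣ ≤ ε) →
          ∣ v ∣ ≤ ε + (degeneracy b + degeneracy b′) * R′
        degenerate-bound b b′ {v} {ε} {R′} 0≤ε 0≤R′ crude fine with nonDegenerate? b | nonDegenerate? b′
        ... | inj₁ nd | inj₁ nd′ = ≤-trans (fine nd nd′) (x≤x+y (*-nonNegative (+-nonNegative (0≤degeneracy b) (0≤degeneracy b′)) 0≤R′))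
        ... | inj₂ 1≤ | _        = ≤-trans (≤-trans crude (≤-trans (≤-reflexive (sym (R.*-identityˡ R′))) (*-monoˡ-≤ 0≤R′ (≤-trans 1≤ (x≤x+y (0≤degeneracy b′)))))) (x≤y+x 0≤ε)
        ... | inj₁ _  | inj₂ 1≤  = ≤-trans (≤-trans crude (≤-trans (≤-reflexive (sym (R.*-identityˡ R′))) (*-monoˡ-≤ 0≤R′ (≤-trans 1≤ (x≤y+x (0≤degeneracy b)))))) (x≤y+x 0≤ε)

        ≤-final : ∀ {G a b ε R′ v} → 0# ≤ G → 0# ≤ a → 0# ≤ b → ε ≡ a * ρ → R′ ≡ b * R^C →
          v ≤ G * gramConstant ε R′ → v ≤ G * (a + 2# * (fromℕ d * fromℕ d) * b) * (ρ + R^C / B)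
        ≤-final {G} {a} {b} 0≤G 0≤a 0≤b refl refl p = ≤-trans p (≤-trans (*-monoʳ-≤ 0≤G (≤-trans
            (≤-reflexive (solve 6 (λ a p d b r i → a :* p :+ :2 :* (d :* d) :* (b :* r :* i) := a :* p :+ :2 :* (d :* d) :* b :* (r :* i)) refl a ρ (fromℕ d) b R^C (B ⁻¹)))
            (linear≤ 0≤a (*-nonNegative (*-nonNegative 0≤2 (*-nonNegative (0≤fromℕ d) (0≤fromℕ d))) 0≤b) 0≤ρ (*-nonNegative 0≤R^C (proj₁ (⁻¹-pos B>0))))))
          (≤-reflexive (sym (R.*-assoc G _ _))))

        V : Vec ℤ d × Vec Bool d → ℤ → ℝ
        V (b , e) x = 𝔼 (run 0 H) λ m → monomial e λ i → g i (x ℤ.+ lookup b i ℤ.* m)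

        κre κim : Vec ℤ d × Vec Bool d → ℝ
        κre (b , e) = re (μ b) * re (unit e) - im (μ b) * im (unit e)
        κim (b , e) = re (μ b) * im (unit e) + im (μ b) * re (unit e)

        ∣κre∣≤2 : ∀ o → ∣ κre o ∣ ≤ 2#
        ∣κre∣≤2 (b , e) = ≤-trans (∣x+y∣≤ _ _) (+-mono-≤
          (≤-trans (∣x*y∣≤ (⊑⇒∣re∣≤ (μ b) (μ⊑1 b)) (proj₁ (∣unit∣≤1 e))) (≤-reflexive (R.*-identityˡ 1#)))
          (≤-trans (≤-reflexive (∣-x∣≡∣x∣ _)) (≤-trans (∣x*y∣≤ (⊑⇒∣im∣≤ (μ b) (μ⊑1 b)) (proj₂ (∣unit∣≤1 e))) (≤-reflexive (R.*-identityˡ 1#)))))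

        ∣κim∣≤2 : ∀ o → ∣ κim o ∣ ≤ 2#
        ∣κim∣≤2 (b , e) = ≤-trans (∣x+y∣≤ _ _) (+-mono-≤
          (≤-trans (∣x*y∣≤ (⊑⇒∣re∣≤ (μ b) (μ⊑1 b)) (proj₂ (∣unit∣≤1 e))) (≤-reflexive (R.*-identityˡ 1#)))
          (≤-trans (∣x*y∣≤ (⊑⇒∣im∣≤ (μ b) (μ⊑1 b)) (proj₁ (∣unit∣≤1 e))) (≤-reflexive (R.*-identityˡ 1#))))

        inner-expand : ∀ b x → re (inner b x) ≡ fromℕ H * ∑ (choices d) (λ e → re (unit e) * V (b , e) x) ×
                                im (inner b x) ≡ fromℕ H * ∑ (choices d) (λ e → im (unit e) * V (b , e) x)
        inner-expand b x =
          trans (re-∑ℂ (run 0 H) _) (trans (∑-cong (run 0 H) λ m → proj₁ (∏ℂ-expand d (z m))) (collect (re ∘ unit))) ,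
          trans (im-∑ℂ (run 0 H) _) (trans (∑-cong (run 0 H) λ m → proj₂ (∏ℂ-expand d (z m))) (collect (im ∘ unit)))
          where
          z : ℤ → Fin d → ℂ
          z m i = g i (x ℤ.+ lookup b i ℤ.* m)
          collect : ∀ (u : Vec Bool d → ℝ) → ∑ (run 0 H) (λ m → ∑ (choices d) λ e → u e * monomial e (z m)) ≡ fromℕ H * ∑ (choices d) (λ e → u e * V (b , e) x)
          collect u = trans (∑-swap (run 0 H) (choices d) _) (trans (∑-cong (choices d) λ e →
              trans (∑-*ˡ (run 0 H) (u e) _) (trans (cong (u e *_) (∑≡H*𝔼 _))
                (solve 3 (λ u h v → u :* (h :* v) := h :* (u :* v)) refl (u e) (fromℕ H) (V (b , e) x))))
            (∑-*ˡ (choices d) (fromℕ H) _))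

        combine : (Vec ℤ d × Vec Bool d → ℝ) → ℤ → ℝ
        combine κ x = w₀ * ∑ (cartesianProductWith _,_ box (choices d)) λ o → κ o * V o x

        combine-eq : ∀ (κ : Vec ℤ d × Vec Bool d → ℝ) (F : Vec ℤ d → ℝ) x →
          (∀ b → F b ≡ fromℕ H * ∑ (choices d) (λ e → κ (b , e) * V (b , e) x)) → 1# / M * ∑ box F ≡ combine κ x
        combine-eq κ F x p = trans (cong (1# / M *_) (trans (∑-cong box p) (∑-*ˡ box (fromℕ H) _))) (trans (sym (R.*-assoc _ _ _))
          (cong₂ _*_ 1/M*H≡w₀ (sym (∑-cartesianProductWith _,_ box (choices d) _))))

        re-D : ∀ x → re (D x) ≡ combine κre x
        re-D x = trans (cong (1# / M *_) (re-∑ℂ box _)) (combine-eq κre _ x λ b → trans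
          (cong₂ (λ s t → re (μ b) * s - im (μ b) * t) (proj₁ (inner-expand b x)) (proj₂ (inner-expand b x)))
          (trans (solve 5 (λ a c h s t → a :* (h :* s) :- c :* (h :* t) := h :* (a :* s :+ (:- c) :* t)) refl (re (μ b)) (im (μ b)) (fromℕ H) _ _)
          (cong (fromℕ H *_) (trans (cong₂ _+_ (sym (∑-*ˡ (choices d) (re (μ b)) _)) (sym (∑-*ˡ (choices d) (- im (μ b)) _)))
            (trans (sym (∑-+ (choices d) _ _)) (∑-cong (choices d) λ e →
              solve 5 (λ a c u w v → a :* (u :* v) :+ (:- c) :* (w :* v) := (a :* u :- c :* w) :* v) refl (re (μ b)) (im (μ b)) (re (unit e)) (im (unit e)) (V (b , e) x)))))))

        im-D : ∀ x → im (D x) ≡ combine κim x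
        im-D x = trans (cong (1# / M *_) (im-∑ℂ box _)) (combine-eq κim _ x λ b → trans
          (cong₂ (λ s t → re (μ b) * t + im (μ b) * s) (proj₁ (inner-expand b x)) (proj₂ (inner-expand b x)))
          (trans (solve 5 (λ a c h s t → a :* (h :* t) :+ c :* (h :* s) := h :* (a :* t :+ c :* s)) refl (re (μ b)) (im (μ b)) (fromℕ H) _ _)
          (cong (fromℕ H *_) (trans (cong₂ _+_ (sym (∑-*ˡ (choices d) (re (μ b)) _)) (sym (∑-*ˡ (choices d) (im (μ b)) _)))
            (trans (sym (∑-+ (choices d) _ _)) (∑-cong (choices d) λ e →
              solve 5 (λ a c u w v → a :* (w :* v) :+ c :* (u :* v) := (a :* w :+ c :* u) :* v) refl (re (μ b)) (im (μ b)) (re (unit e)) (im (unit e)) (V (b , e) x)))))))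

        w : ℤ → ℝ
        w x = ν x - 𝟙[ N ] x

        ∣w∣≤Rν : ∀ x → ∣ w x ∣ ≤ Rν
        ∣w∣≤Rν x = ∣∣-lub (≤-trans (≤-by (0≤𝟙 N x) (solve 2 (λ n i → n :- (n :- i) := i) refl (ν x) (𝟙[ N ] x))) (weight≤Rν maj x))
          (≤-trans (≤-by (0≤ν x) (solve 2 (λ n i → i :- (:- (n :- i)) := n) refl (ν x) (𝟙[ N ] x))) (weight≤Rν one x))

        ∣V∣≤R^d : ∀ o x → ∣ V o x ∣ ≤ Rν ^ d
        ∣V∣≤R^d (b , e) x = ∣𝔼∣≤ (run 0 H) hs-nonEmpty λ m _ → ∣∏∣≤R^d λ i →
          ≤-trans (⊑⇒∣part∣≤ (lookup e i) _ (g⊑ i (x ℤ.+ lookup b i ℤ.* m))) (weight≤Rν (τ i) _)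

        R*R^d*R^d≡R^C : Rν * (Rν ^ d * Rν ^ d) ≡ R^C
        R*R^d*R^d≡R^C = cong (Rν *_) (sym (Exp.^-homo-* Rν d d))

        ε₁ : ℝ
        ε₁ = correlationConstant d A * ρ

        0≤ε₁ : 0# ≤ ε₁
        0≤ε₁ = *-nonNegative (0≤correlationConstant d A) 0≤ρ

        -- The crude bound has one factor ν - 1_[N] and 2d factors from the two monomials, each at
        -- most R_ν; this fixes the exponent in `R^C`. Nondegenerate pairs go through
        -- `correlation-bound`.
        pair₁ : ∀ b b′ → b ∈ box → b′ ∈ box → ∀ e e′ →
          ∣ 𝔼 [1⋯ N ] (λ x → w x * (V (b , e) x * V (b′ , e′) x)) ∣ ≤ ε₁ + (degeneracy b + degeneracy b′) * R^C
        pair₁ b b′ b∈ b′∈ e e′ = degenerate-bound b b′ 0≤ε₁ 0≤R^C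
          (∣𝔼∣≤ [1⋯ N ] P-nonEmpty λ x _ → ≤-trans (∣x*y∣≤ (∣w∣≤Rν x) (∣x*y∣≤ (∣V∣≤R^d (b , e) x) (∣V∣≤R^d (b′ , e′) x))) (≤-reflexive R*R^d*R^d≡R^C))
          λ nd nd′ → let open Correlation b b′ nd nd′ (box-OK b b∈) (box-OK b′ b′∈) τ τ
                               (λ i z → part (lookup e i) (g i z)) (λ i z → part (lookup e′ i) (g i z))
                               (λ i z → ⊑⇒∣part∣≤ (lookup e i) (g i z) (g⊑ i z)) (λ i z → ⊑⇒∣part∣≤ (lookup e′ i) (g i z) (g⊑ i z))
                     in ≤-trans (≤-reflexive (cong ∣_∣ (trans (𝔼-cong [1⋯ N ] λ x → trans (cong (w x *_) (𝔼-*-𝔼 (run 0 H) (run 0 H) _ _))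
                            (trans (sym (𝔼-*ˡ (run 0 H) (w x) _)) (𝔼-cong (run 0 H) λ m → sym (𝔼-*ˡ (run 0 H) (w x) _))))
                          (trans (𝔼-swap [1⋯ N ] (run 0 H) _) (𝔼-cong (run 0 H) λ m → 𝔼-swap [1⋯ N ] (run 0 H) _)))))
                        (≤-trans (correlation-bound root) (≤-trans
                          (+-mono-≤ boundary≤ (+-mono-≤ boundary≤ ≤-refl))
                          (≤-reflexive (solve 4 (λ c u j p → c :* p :+ (c :* p :+ u :* (j :* p)) := (c :+ (c :+ u :* j)) :* p) refl
                            (fromℕ d * (2# * (2# + 2#))) (fromℕ (suc (A ℕ.+ A))) (2# * 2# ^ (3 ℕ.^ (d ℕ.+ d))) ρ))))
          where
          boundary≤ : fromℕ d * (2# * (2# + 2#) * (fromℕ T / fromℕ H)) ≤ fromℕ d * (2# * (2# + 2#)) * ρ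
          boundary≤ = ≤-trans (*-monoʳ-≤ (0≤fromℕ d) (*-monoʳ-≤ (*-nonNegative 0≤2 (+-nonNegative 0≤2 0≤2)) T/H≤ρ)) (≤-reflexive (sym (R.*-assoc _ _ _)))

        module G₁ = Gram (choices d) κre ∣κre∣≤2 V w ε₁ R^C 0≤ε₁ 0≤R^C pair₁
        module G₂ = Gram (choices d) κim ∣κim∣≤2 V w ε₁ R^C 0≤ε₁ 0≤R^C pair₁

        𝟙≡1 : ∀ x → x ∈ [1⋯ N ] → 𝟙[ N ] x ≡ 1#
        𝟙≡1 x x∈ with ∈-run {0} x∈ | 𝟙-values N x
        ... | i , i<P , refl | inj₁ (_ , e) = e
        ... | i , i<P , refl | inj₂ (x∉ , _) = ⊥-elim (x∉ (ℤ.+≤+ (ℕ.s≤s ℕ.z≤n) , ℤ.+≤+ i<P))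

        first-bound : ∣ 𝔼 [1⋯ N ] (λ x → (ν x - 1#) * ∣ D x ∣ℂ ^ 2) ∣ ≤ firstConstant d C₀ A * (ρ + R^C / B)
        first-bound = ≤-trans (≤-reflexive (cong ∣_∣ split)) (≤-trans (≤-trans (∣x+y∣≤ _ _) (+-mono-≤ G₁.gram-bound G₂.gram-bound))
          (≤-trans (≤-final {G = 2# * gramFactor (length (choices d)) d C₀} {a = correlationConstant d A} {b = 1#}
              (*-nonNegative 0≤2 (0≤gramFactor (length (choices d)) d 0≤C₀)) (0≤correlationConstant d A) 0≤1 refl (sym (R.*-identityˡ _))
              (≤-reflexive (solve 2 (λ f c → f :* c :+ f :* c := :2 :* f :* c) refl (gramFactor (length (choices d)) d C₀) (gramConstant ε₁ R^C))))
            (≤-reflexive (cong (λ z → 2# * gramFactor (length (choices d)) d C₀ * (correlationConstant d A + z) * (ρ + R^C / B)) (R.*-identityʳ _)))))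
          where
          split : 𝔼 [1⋯ N ] (λ x → (ν x - 1#) * ∣ D x ∣ℂ ^ 2) ≡
                  𝔼 [1⋯ N ] (λ x → w x * (combine κre x * combine κre x)) + 𝔼 [1⋯ N ] (λ x → w x * (combine κim x * combine κim x))
          split = trans (𝔼-cong-∈ [1⋯ N ] λ x x∈ → trans (cong₂ (λ i z → (ν x - i) * z) (sym (𝟙≡1 x x∈))
              (trans (∣∣ℂ^2 (D x)) (cong₂ _+_ (cong₂ _*_ (re-D x) (re-D x)) (cong₂ _*_ (im-D x) (im-D x))))) (R.distribˡ (w x) _ _)) (𝔼-+ [1⋯ N ] _ _)

        majorantAt constantAt : Vec ℤ d → ℤ → ℝ
        majorantAt b x = 𝔼 (run 0 H) λ m → ∏ (allFin d) λ i → weight (τ i) (x ℤ.+ lookup b i ℤ.* m)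
        constantAt b x = 𝔼 (run 0 H) λ m → ∏ (allFin d) λ i → 𝟙[ N ] (x ℤ.+ lookup b i ℤ.* m)

        V₂ : Vec ℤ d × ⊤ → ℤ → ℝ
        V₂ (b , _) x = majorantAt b x - constantAt b x

        ∣V₂∣≤ : ∀ o x → ∣ V₂ o x ∣ ≤ 2# * Rν ^ d
        ∣V₂∣≤ (b , _) x = ≤-trans (∣x+y∣≤ _ _) (≤-trans (+-mono-≤
            (∣𝔼∣≤ (run 0 H) hs-nonEmpty λ m _ → ∣∏∣≤R^d λ i → ≤-trans (≤-reflexive (∣x∣≡x (0≤weight (τ i) _))) (weight≤Rν (τ i) _))
            (≤-trans (≤-reflexive (∣-x∣≡∣x∣ _)) (∣𝔼∣≤ (run 0 H) hs-nonEmpty λ m _ → ∣∏∣≤R^d λ i → ≤-trans (≤-reflexive (∣x∣≡x (0≤𝟙 N (x ℤ.+ lookup b i ℤ.* m)))) (weight≤Rν one (x ℤ.+ lookup b i ℤ.* m)))))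
          (≤-reflexive (solve 1 (λ r → r :+ r := :2 :* r) refl (Rν ^ d))))

        ε₂ R₂ : ℝ
        ε₂ = (2# + 1#) * ρ
        R₂ = 2# * 2# * R^C

        0≤3 : 0# ≤ 2# + 1#
        0≤3 = +-nonNegative 0≤2 0≤1

        0≤R₂ : 0# ≤ R₂
        0≤R₂ = *-nonNegative (*-nonNegative 0≤2 0≤2) 0≤R^C

        -- The product of the two differences expands into four means sharing one main term, that
        -- with all weights 1_[N]. It cancels, leaving three errors of size η.
        pair₂ : ∀ b b′ → b ∈ box → b′ ∈ box → (e e′ : ⊤) →
          ∣ 𝔼 [1⋯ N ] (λ x → 1# * (V₂ (b , e) x * V₂ (b′ , e′) x)) ∣ ≤ ε₂ + (degeneracy b + degeneracy b′) * R₂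
        pair₂ b b′ b∈ b′∈ _ _ = degenerate-bound b b′ (*-nonNegative 0≤3 0≤ρ) 0≤R₂
          (∣𝔼∣≤ [1⋯ N ] P-nonEmpty λ x _ → ≤-trans (≤-reflexive (cong ∣_∣ (R.*-identityˡ _))) (≤-trans (∣x*y∣≤ (∣V₂∣≤ (b , tt) x) (∣V₂∣≤ (b′ , tt) x)) R^2d≤))
          fine
          where
          R^2d≤ : 2# * Rν ^ d * (2# * Rν ^ d) ≤ R₂
          R^2d≤ = ≤-trans (≤-reflexive (solve 1 (λ r → :2 :* r :* (:2 :* r) := :2 :* :2 :* (:1 :* (r :* r))) refl (Rν ^ d)))
            (*-monoʳ-≤ (*-nonNegative 0≤2 0≤2) (≤-trans (*-monoˡ-≤ (*-nonNegative 0≤R^d 0≤R^d) 1≤Rν) (≤-reflexive R*R^d*R^d≡R^C)))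
          fine : NonDegenerate b → NonDegenerate b′ → ∣ 𝔼 [1⋯ N ] (λ x → 1# * (V₂ (b , tt) x * V₂ (b′ , tt) x)) ∣ ≤ ε₂
          fine nd nd′ = ≤-trans (≤-reflexive (cong ∣_∣ expand)) (≤-trans (∣x+y∣≤ _ _) (≤-trans (+-mono-≤ (lf τ τ) (≤-trans (∣x+y∣≤ _ _)
              (+-mono-≤ (≤-trans (≤-reflexive (∣-x∣≡∣x∣ _)) (lf τ ones)) (≤-trans (≤-reflexive (∣-x∣≡∣x∣ _)) (lf ones τ)))))
            (≤-trans (≤-reflexive (solve 1 (λ e → e :+ (e :+ e) := (:2 :+ :1) :* e) refl η)) (*-monoʳ-≤ 0≤3 η≤ρ))))
            where
            ones : Fin d → Tag
            ones _ = one
            at : (Fin d → Tag) → Vec ℤ d → ℤ → ℝ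
            at σ b x = 𝔼 (run 0 H) λ m → ∏ (allFin d) λ i → weight (σ i) (x ℤ.+ lookup b i ℤ.* m)
            gram : (Fin d → Tag) → (Fin d → Tag) → ℝ
            gram σ σ′ = 𝔼 [1⋯ N ] λ x → at σ b x * at σ′ b′ x
            lf : ∀ σ σ′ → ∣ gram σ σ′ - gram ones ones ∣ ≤ η
            lf σ σ′ = subst₂ (λ u v → ∣ u - v ∣ ≤ η) (eq σ σ′) (eq ones ones)
              (pair-linearForms b b′ nd nd′ (box-OK b b∈) (box-OK b′ b′∈) σ σ′)
              where
              eq : ∀ σ σ′ → 𝔼 [1⋯ N ] (λ x → 𝔼 (run 0 H) λ m → 𝔼 (run 0 H) λ m′ →
                     (∏ (allFin d) λ i → weight (σ i) (x ℤ.+ lookup b i ℤ.* m)) * (∏ (allFin d) λ i → weight (σ′ i) (x ℤ.+ lookup b′ i ℤ.* m′))) ≡ gram σ σ′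
              eq σ σ′ = 𝔼-cong [1⋯ N ] λ x → sym (𝔼-*-𝔼 (run 0 H) (run 0 H) _ _)
            expand : 𝔼 [1⋯ N ] (λ x → 1# * (V₂ (b , tt) x * V₂ (b′ , tt) x)) ≡
                     (gram τ τ - gram ones ones) + (- (gram τ ones - gram ones ones) + - (gram ones τ - gram ones ones))
            expand = trans (𝔼-cong [1⋯ N ] λ x → solve 4 (λ a c p q → :1 :* ((a :- c) :* (p :- q)) := (a :* p :- a :* q) :- (c :* p :- c :* q)) refl
                         (majorantAt b x) (constantAt b x) (majorantAt b′ x) (constantAt b′ x))
              (trans (𝔼-- [1⋯ N ] _ _) (trans (cong₂ _-_ (𝔼-- [1⋯ N ] _ _) (𝔼-- [1⋯ N ] _ _))
                (solve 4 (λ p q r s → (p :- q) :- (r :- s) := (p :- s) :+ (:- (q :- s) :+ :- (r :- s))) refl (gram τ τ) (gram τ ones) (gram ones τ) (gram ones ones))))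

        κ₂ : Vec ℤ d × ⊤ → ℝ
        κ₂ _ = 1#

        module G₃ = Gram (tt ∷ []) κ₂ (λ _ → ≤-trans (≤-reflexive (∣x∣≡x 0≤1)) 1≤2) V₂ (λ _ → 1#) ε₂ R₂ (*-nonNegative 0≤3 0≤ρ) 0≤R₂ pair₂

        D-majorant D-constant : ℤ → ℝ
        D-majorant x = w₀ * ∑ box λ b → majorantAt b x
        D-constant x = w₀ * ∑ box λ b → constantAt b x

        D⊑ : ∀ x → D x ⊑ D-majorant x
        D⊑ x = subst (D x ⊑_) eq (⊑-• (1# / M) _ 0≤1/M (⊑-∑ℂ box λ b → ⊑-* (μ b) (inner b x) (μ⊑1 b)
            (⊑-∑ℂ (run 0 H) λ m → ⊑-∏ℂ (allFin d) λ i → g⊑ i (x ℤ.+ lookup b i ℤ.* m))))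
          where
          eq : 1# / M * ∑ box (λ b → 1# * ∑ (run 0 H) λ m → ∏ (allFin d) λ i → weight (τ i) (x ℤ.+ lookup b i ℤ.* m)) ≡ D-majorant x
          eq = trans (cong (1# / M *_) (trans (∑-cong box λ b → trans (R.*-identityˡ _) (∑≡H*𝔼 _)) (∑-*ˡ box (fromℕ H) _)))
            (trans (sym (R.*-assoc _ _ _)) (cong (_* ∑ box λ b → majorantAt b x) 1/M*H≡w₀))

        -- Each mean of indicators is at most 1 and the box has at most ((2c + 1)B)^d vectors. For c
        -- = C_sup the bound is K_bd, so clipping can only cut into what ν contributes beyond 1_[N].
        D-constant≤ : ∀ {c} → C₀ ≤ c → ∀ x → D-constant x ≤ (2# * c + 1#) ^ d
        D-constant≤ C₀≤c x = ≤-trans (*-monoʳ-≤ 0≤w₀ (≤-trans (∑-mono box λ b → 𝔼-≤ (run 0 H) hs-nonEmpty λ m _ →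
            ≤-trans (∏-mono (allFin d) (λ i → 0≤𝟙 N (x ℤ.+ lookup b i ℤ.* m)) (λ i → 𝟙≤1 N (x ℤ.+ lookup b i ℤ.* m))) (≤-trans (≤-reflexive (∏-const (allFin d) 1#)) (^-≤1 (length (allFin d)) 0≤1 ≤-refl)))
            (≤-reflexive (trans (∑-const box 1#) (trans (R.*-identityʳ _) (length-tuples axis d))))))
          (w₀*side^d≤ C₀≤c)

        second-bound : ∀ {c} → C₀ ≤ c →
          𝔼 [1⋯ N ] (λ x → ∣ D x -ℂ 𝟙[ N ] x • clip ((2# * c + 1#) ^ d) (D x) ∣ℂ ^ 2) ≤ secondConstant d C₀ A * (ρ + R^C / B)
        second-bound {c} C₀≤c = ≤-trans (𝔼-mono-∈ [1⋯ N ] pointwise) (≤-trans (x≤∣x∣ _)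
          (≤-final {G = gramFactor 1 d C₀} {a = 2# + 1#} {b = 2# * 2#} (0≤gramFactor 1 d 0≤C₀) 0≤3 (*-nonNegative 0≤2 0≤2) refl refl G₃.gram-bound))
          where
          Kbd = (2# * c + 1#) ^ d
          0≤Kbd : 0# ≤ Kbd
          0≤Kbd = 0≤^ d (+-nonNegative (*-nonNegative 0≤2 (≤-trans 0≤C₀ C₀≤c)) 0≤1)
          difference : ∀ x → D-majorant x - D-constant x ≡ G₃.combination x
          difference x = trans (solve 3 (λ w a b → w :* a :- w :* b := w :* (a :+ (:- :1) :* b)) refl w₀ (∑ box λ b → majorantAt b x) (∑ box λ b → constantAt b x))
            (cong (w₀ *_) (trans (cong (λ z → ∑ box (λ b → majorantAt b x) + z) (sym (∑-*ˡ box (- 1#) _))) (trans (sym (∑-+ box _ _))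
              (sym (trans (∑-cartesianProductWith _,_ box (tt ∷ []) _) (∑-cong box λ b →
                solve 2 (λ a c → :1 :* (a :- c) :+ con (+ 0) := a :+ (:- :1) :* c) refl (majorantAt b x) (constantAt b x)))))))
          pointwise : ∀ x → x ∈ [1⋯ N ] → ∣ D x -ℂ 𝟙[ N ] x • clip Kbd (D x) ∣ℂ ^ 2 ≤ 1# * (G₃.combination x * G₃.combination x)
          pointwise x x∈ = begin
            ∣ D x -ℂ 𝟙[ N ] x • clip Kbd (D x) ∣ℂ ^ 2             ≈⟨ ∣∣ℂ^2 _ ⟩
            normSq (D x -ℂ 𝟙[ N ] x • clip Kbd (D x))             ≈⟨ cong (λ i → normSq (D x -ℂ i • clip Kbd (D x))) (𝟙≡1 x x∈) ⟩
            normSq (D x -ℂ 1# • clip Kbd (D x))                   ≤⟨ clip-error (D x) 0≤Kbd (D-constant≤ C₀≤c x) (D⊑ x) ⟩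
            (D-majorant x - D-constant x) * (D-majorant x - D-constant x) ≈⟨ cong₂ _*_ (difference x) (difference x) ⟩
            G₃.combination x * G₃.combination x                   ≈⟨ sym (R.*-identityˡ _) ⟩
            1# * (G₃.combination x * G₃.combination x)            ∎
            where open ≤-Reasoning

        -- Stated for any F that agrees pointwise with `D`, so that `dual` enters only through
        -- `dual-unfold`.
        first-bound-for : (F : ℤ → ℂ) → (∀ x → F x ≡ D x) →
          ∣ 𝔼 [1⋯ N ] (λ x → (ν x - 1#) * ∣ F x ∣ℂ ^ 2) ∣ ≤ firstConstant d C₀ A * (ρ + R^C / B)
        first-bound-for F F≡D = ≤-trans (≤-reflexive (cong ∣_∣ (𝔼-cong [1⋯ N ] λ x → cong (λ z → (ν x - 1#) * ∣ z ∣ℂ ^ 2) (F≡D x)))) first-bound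

        second-bound-for : (F : ℤ → ℂ) → (∀ x → F x ≡ D x) → ∀ {c} → C₀ ≤ c →
          𝔼 [1⋯ N ] (λ x → ∣ F x -ℂ 𝟙[ N ] x • clip ((2# * c + 1#) ^ d) (F x) ∣ℂ ^ 2) ≤ secondConstant d C₀ A * (ρ + R^C / B)
        second-bound-for F F≡D {c} C₀≤c = ≤-trans (≤-reflexive (𝔼-cong [1⋯ N ] λ x →
          cong (λ z → ∣ z -ℂ 𝟙[ N ] x • clip ((2# * c + 1#) ^ d) z ∣ℂ ^ 2) (F≡D x))) (second-bound C₀≤c)

  -- Choice of the constants and of ρ

  module Conclusion (d′ : ℕ) (C₀ : ℝ) (1≤C₀ : 1# ≤ C₀) where

    d A : ℕ
    d = suc d′
    A = proj₁ (archimedean (2# * fromℕ (d ℕ.+ d) * C₀))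

    -- The summands of `K₀` are the lower bounds on K required by `Pair`. All are nonnegative, so
    -- the sum serves as well as their maximum, and the same holds for `C′`.
    k₁ k₂ k₃ k₄ k₅ K₀ C′ : ℝ
    k₁ = fromℕ (3 ℕ.^ (d ℕ.+ d))
    k₂ = fromℕ ((d ℕ.+ d) ℕ.* 2)
    k₃ = fromℕ (suc (d ℕ.+ d))
    k₄ = 2# * C₀
    k₅ = (2# + 1#) * fromℕ A + fromℕ d * C₀
    K₀ = k₁ + (k₂ + (k₃ + (k₄ + k₅)))
    C′ = firstConstant d C₀ A + secondConstant d C₀ A

    0≤C₀ : 0# ≤ C₀
    0≤C₀ = ≤-trans 0≤1 1≤C₀

    0≤k₄ : 0# ≤ k₄
    0≤k₄ = *-nonNegative 0≤2 0≤C₀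

    0≤k₅ : 0# ≤ k₅
    0≤k₅ = +-nonNegative (*-nonNegative (+-nonNegative 0≤2 0≤1) (0≤fromℕ A)) (*-nonNegative (0≤fromℕ d) 0≤C₀)

    0≤d² : 0# ≤ 2# * (fromℕ d * fromℕ d)
    0≤d² = *-nonNegative 0≤2 (*-nonNegative (0≤fromℕ d) (0≤fromℕ d))

    0≤first : 0# ≤ firstConstant d C₀ A
    0≤first = *-nonNegative (*-nonNegative 0≤2 (0≤gramFactor (length (choices d)) d 0≤C₀)) (+-nonNegative (0≤correlationConstant d A) 0≤d²)

    0≤second : 0# ≤ secondConstant d C₀ A
    0≤second = *-nonNegative (0≤gramFactor 1 d 0≤C₀) (+-nonNegative (+-nonNegative 0≤2 0≤1) (*-nonNegative 0≤d² (*-nonNegative 0≤2 0≤2)))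

    fromℕ2≡2 : fromℕ 2 ≡ 2#
    fromℕ2≡2 = cong (λ z → 1# + z) (R.+-identityʳ 1#)

    module _
      (N : ℝ) (1≤N : 1# ≤ N) (H : ℕ) (1≤H : 1 ℕ.≤ H) (1≤B : 1# ≤ N / fromℕ H)
      (K L η : ℝ) (2≤K : fromℕ 2 ≤ K) (K₀≤K : K₀ ≤ K) (2≤L : fromℕ 2 ≤ L) (0<η : 0# < η) (η<1 : η < 1#)
      (ν : ℤ → ℝ) (0≤ν : ∀ z → 0# ≤ ν z) (ν-supp : SupportedOn 0# (_∈[ N ]) ν)
      (lfc : LinearFormsCondition ν K L η N (N / fromℕ H) H)
      (μ : Vec ℤ d → ℂ) (μ≤1 : ∀ b → ∣ μ b ∣ℂ ≤ 1#)
      (g : Fin d → ℤ → ℂ) (majorised : ∀ i → (∀ z → ∣ g i z ∣ℂ ≤ ν z) ⊎ (∀ z → ∣ g i z ∣ℂ ≤ 𝟙[ N ] z))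
      (Csup : ℝ) (C₀≤Csup : C₀ ≤ Csup)
      where

      private
        B η* ρ : ℝ
        q : ℕ
        B  = N / fromℕ H
        η* = η + L ⁻¹ + fromℕ H ⁻¹
        q  = 2 ℕ.^ (2 ℕ.* d)
        instance
          q≢0 : NonZero q
          q≢0 = ℕ.m^n≢0 2 (2 ℕ.* d)
        ρ = η* ^1/ q

      2≤L′ : 2# ≤ L
      2≤L′ = ≤-trans (≤-reflexive (sym fromℕ2≡2)) 2≤L

      open Setting N 1≤N H 1≤H K L η 2≤L′ (proj₁ 0<η) (proj₁ η<1) ν 0≤ν ν-supp lfc using (T; T≤H; T≤H/L+1; L>0; H>0; weight)

      0≤L⁻¹ : 0# ≤ L ⁻¹
      0≤L⁻¹ = proj₁ (⁻¹-pos L>0)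

      0≤H⁻¹ : 0# ≤ fromℕ H ⁻¹
      0≤H⁻¹ = proj₁ (⁻¹-pos H>0)

      η≤η* : η ≤ η*
      η≤η* = ≤-trans (x≤x+y 0≤L⁻¹) (x≤x+y 0≤H⁻¹)

      root : ∀ t → 0# ≤ t → t ^ (2 ℕ.^ (d ℕ.+ d)) ≤ η → t ≤ ρ
      -- `2 ℕ.* d` unfolds to d + (d + 0), hence the rewriting of the exponent.
      root t 0≤t p = ≤-^1/ q 0≤t (≤-trans (≤-reflexive (cong (λ n → t ^ (2 ℕ.^ (d ℕ.+ n))) (ℕ.+-identityʳ d))) (≤-trans p η≤η*))

      -- A number in [0, 1] is at least its q-th power, so being at most η* already puts it below
      -- the root of η*. The same argument serves for T/H.
      η≤ρ : η ≤ ρ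
      η≤ρ = ≤-^1/ q (proj₁ 0<η) (≤-trans (x^n≤x q (proj₁ 0<η) (proj₁ η<1)) η≤η*)

      T/H≤ρ : fromℕ T / fromℕ H ≤ ρ
      T/H≤ρ = ≤-^1/ q 0≤T/H (≤-trans (x^n≤x q 0≤T/H T/H≤1) (≤-trans T/H≤ (≤-trans (x≤y+x (proj₁ 0<η)) (≤-reflexive (sym (R.+-assoc η _ _))))))
        where
        0≤T/H : 0# ≤ fromℕ T / fromℕ H
        0≤T/H = *-nonNegative (0≤fromℕ T) 0≤H⁻¹
        T/H≤1 : fromℕ T / fromℕ H ≤ 1#
        T/H≤1 = x≤a*y⇒x/y≤a H>0 (≤-trans (fromℕ-mono T≤H) (≤-reflexive (sym (R.*-identityˡ _))))
        T/H≤ : fromℕ T / fromℕ H ≤ L ⁻¹ + fromℕ H ⁻¹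
        T/H≤ = x≤a*y⇒x/y≤a H>0 (≤-trans T≤H/L+1 (≤-reflexive (trans (cong₂ _+_ (R.*-comm (fromℕ H) (L ⁻¹)) (trans (sym (x*x⁻¹ H>0)) (R.*-comm (fromℕ H) _)))
          (sym (R.distribʳ (fromℕ H) (L ⁻¹) (fromℕ H ⁻¹))))))

      tag : Fin d → Tag
      tag i = [ (λ _ → maj) , (λ _ → one) ]′ (majorised i)

      g⊑ : ∀ i z → g i z ⊑ weight (tag i) z
      g⊑ i z with majorised i
      ... | inj₁ p = ∣∣ℂ≤⇒⊑ (g i z) (p z)
      ... | inj₂ p = ∣∣ℂ≤⇒⊑ (g i z) (p z)

      k₁≤K : k₁ ≤ K
      k₁≤K = ≤-trans (x≤x+y (+-nonNegative (0≤fromℕ ((d ℕ.+ d) ℕ.* 2)) (+-nonNegative (0≤fromℕ (suc (d ℕ.+ d))) (+-nonNegative 0≤k₄ 0≤k₅)))) K₀≤K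

      K≥₂ : k₂ + (k₃ + (k₄ + k₅)) ≤ K
      K≥₂ = ≤-trans (x≤y+x (0≤fromℕ (3 ℕ.^ (d ℕ.+ d)))) K₀≤K

      K≥₃ : k₃ + (k₄ + k₅) ≤ K
      K≥₃ = ≤-trans (x≤y+x (0≤fromℕ ((d ℕ.+ d) ℕ.* 2))) K≥₂

      K≥₄ : k₄ + k₅ ≤ K
      K≥₄ = ≤-trans (x≤y+x (0≤fromℕ (suc (d ℕ.+ d)))) K≥₃

      open Setting.Pair.Estimates N 1≤N H 1≤H K L η 2≤L′ (proj₁ 0<η) (proj₁ η<1) ν 0≤ν ν-supp lfc
        d′ C₀ 1≤C₀ A (proj₂ (archimedean (2# * fromℕ (d ℕ.+ d) * C₀))) k₁≤K
        (≤-trans (x≤x+y (+-nonNegative (0≤fromℕ (suc (d ℕ.+ d))) (+-nonNegative 0≤k₄ 0≤k₅))) K≥₂)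
        (≤-trans (x≤x+y (+-nonNegative 0≤k₄ 0≤k₅)) K≥₃) 2≤K
        (≤-trans (x≤x+y 0≤k₅) K≥₄) (≤-trans (x≤y+x 0≤k₄) K≥₄)
        1≤B ρ (^1/-nonNegative q η*) η≤ρ T/H≤ρ root g tag g⊑ μ (λ b → ∣∣ℂ≤⇒⊑ (μ b) (μ≤1 b))
        using (D; first-bound-for; second-bound-for; 0≤R^C)

      0≤total : 0# ≤ ρ + Rsup N ν ^ suc (d ℕ.+ d) / B
      0≤total = +-nonNegative (^1/-nonNegative q η*) (*-nonNegative 0≤R^C (proj₁ (⁻¹-pos (1≤⇒pos 1≤B))))

      conclusion : (F : ℤ → ℂ) → (∀ x → F x ≡ D x) → (Kbd : ℝ) → Kbd ≡ (fromℕ 2 * Csup + 1#) ^ d →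
        (∣ 𝔼 [1⋯ N ] (λ x → (ν x - 1#) * ∣ F x ∣ℂ ^ 2) ∣ ≤ C′ * (ρ + Rsup N ν ^ suc (d ℕ.+ d) / B)) ×
        (𝔼 [1⋯ N ] (λ x → ∣ F x -ℂ 𝟙[ N ] x • clip Kbd (F x) ∣ℂ ^ 2) ≤ C′ * (ρ + Rsup N ν ^ suc (d ℕ.+ d) / B))
      conclusion F F≡D Kbd Kbd≡ =
        ≤-trans (first-bound-for F F≡D) (*-monoˡ-≤ 0≤total (x≤x+y 0≤second)) ,
        ≤-trans (subst (λ K → 𝔼 [1⋯ N ] (λ x → ∣ F x -ℂ 𝟙[ N ] x • clip K (F x) ∣ℂ ^ 2) ≤ secondConstant d C₀ A * (ρ + Rsup N ν ^ suc (d ℕ.+ d) / B))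
            (sym (trans Kbd≡ (cong (λ two → (two * Csup + 1#) ^ d) fromℕ2≡2))) (second-bound-for F F≡D C₀≤Csup))
          (*-monoˡ-≤ 0≤total (x≤y+x 0≤first))

open import Data.Fin.Subset using (Subset; _∈_; _∉_)
open import Data.Fin.Subset.Properties using (_∈?_)
open import Data.Nat.Properties using (m^n≢0)

proposition6p4 : (𝓡 : Reals) → let open Analysis 𝓡 in
  ∀ (k : ℕ) → 2 ℕ.≤ k →
  Σ ℕ λ C →
  ∀ (C₀ : ℝ) → 1# ≤ C₀ →
  Σ ℝ λ K₀ → Σ ℝ λ C′ →
  ∀ (N : ℝ) → 1# ≤ N →
  ∀ (H : ℕ) → 1 ℕ.≤ H →
  let B = N / fromℕ H in
  1# ≤ B →
  ∀ (K L η : ℝ) → fromℕ 2 ≤ K → K₀ ≤ K → fromℕ 2 ≤ L → 0# < η → η < 1# →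
  ∀ (ν : ℤ → ℝ) → (∀ x → 0# ≤ ν x) → SupportedOn 0# (_∈[ N ]) ν →
  LinearFormsCondition ν K L η N B H →
  ∀ (μ : Vec ℤ (k ∸ 1) → ℂ) → (∀ b → ∣ μ b ∣ℂ ≤ 1#) →
  ∀ (μ-supp : SupportedOn 0ℂ (Box (C₀ * B)) μ) →
  ∀ (S : Subset (k ∸ 1)) (g : Fin (k ∸ 1) → ℤ → ℂ) →
  (∀ i → SupportedOn 0ℂ (_∈[ N ]) (g i)) →
  (∀ i → i ∈ S → ∀ x → ∣ g i x ∣ℂ ≤ ν x) →
  (∀ i → i ∉ S → ∀ x → ∣ g i x ∣ℂ ≤ 𝟙[ N ] x) →
  ∀ (Csup : ℝ) → C₀ ≤ Csup →
  let η* = η + L ⁻¹ + fromℕ H ⁻¹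
      q = 2 ℕ.^ (2 ℕ.* (k ∸ 1))
      D = dual k N B H (C₀ * B) μ μ-supp g
      Kbd = (fromℕ 2 * Csup + 1#) ^ (k ∸ 1)
      D♯ = λ x → 𝟙[ N ] x • clip Kbd (D x)
      bound = C′ * ((η* ^1/ q) {{m^n≢0 2 (2 ℕ.* (k ∸ 1))}} + Rsup N ν ^ C / B)
  in (∣ 𝔼 [1⋯ N ] (λ x → (ν x - 1#) * ∣ D x ∣ℂ ^ 2) ∣ ≤ bound)
     × (𝔼 [1⋯ N ] (λ x → ∣ D x -ℂ D♯ x ∣ℂ ^ 2) ≤ bound)
proposition6p4 𝓡 (suc zero) (ℕ.s≤s ())
-- The exponent 2(k - 1) + 1 counts the factors in the correlation of a pair: ν - 1 and twice k - 1
-- values of the g_i.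
proposition6p4 𝓡 (suc (suc d′)) _ = suc (suc d′ ℕ.+ suc d′) , λ C₀ 1≤C₀ → Development.Conclusion.K₀ 𝓡 d′ C₀ 1≤C₀ , Development.Conclusion.C′ 𝓡 d′ C₀ 1≤C₀ ,
  λ N 1≤N H 1≤H 1≤B K L η 2≤K K₀≤K 2≤L 0<η η<1 ν 0≤ν ν-supp lfc μ μ≤1 μ-supp S g _ g≤ν g≤𝟙 Csup C₀≤Csup →
  Development.Conclusion.conclusion 𝓡 d′ C₀ 1≤C₀ N 1≤N H 1≤H 1≤B K L η 2≤K K₀≤K 2≤L 0<η η<1 ν 0≤ν ν-supp lfc μ μ≤1 g (majorised S g≤ν g≤𝟙) Csup C₀≤Csup
    _ (Development.dual-unfold 𝓡 (suc (suc d′)) N _ H _ μ μ-supp g) _ refl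
  where
  majorised : ∀ {n} {P Q : Fin n → Set} (S : Subset n) → (∀ i → i ∈ S → P i) → (∀ i → i ∉ S → Q i) → ∀ i → P i ⊎ Q i
  majorised S p q i with i ∈? S
  ... | yes i∈S = inj₁ (p i i∈S)
  ... | no  i∉S = inj₂ (q i i∉S)
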